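{- Let $\Gamma$ be the graph whose vertices are the elliptic ovoids of the symplectic subquadrangles of the Hermitian surface $\mathcal{H}(3,4)$ of $\mathrm{PG}(3,4)$, two vertices being adjacent whenever they meet in exactly one point and their symplectic subquadrangles meet in exactly six points. For a maximal clique $\{\mathcal{E},\mathcal{E}',\mathcal{E}''\}$ of $\Gamma$ (consisting of three vertices), let $\mathcal{W},\mathcal{W}',\mathcal{W}''$ denote the symplectic subquadrangles of $\mathcal{E},\mathcal{E}',\mathcal{E}''$, respectively. Then $\Gamma$ has exactly $1440$ maximal cliques such that $|\mathcal{W}\cap\mathcal{W}'\cap\mathcal{W}''|=6$ and exactly $4320$ maximal cliques such that $|\mathcal{W}\cap\mathcal{W}'\cap\mathcal{W}''|=2$.
   Context: A maximal clique is a set of pairwise adjacent vertices that is not properly contained in a larger set of pairwise adjacent vertices. Let $\perp$ be a non-degenerate unitary polarity of $\mathrm{PG}(3,4)$ and let $\mathcal{H}(3,4)$ be the Hermitian surface it defines, i.e. the incidence structure of the points and lines of $\mathrm{PG}(3,4)$ that are totally isotropic with respect to $\perp$ (it has $45$ points and $27$ lines, and is a generalized quadrangle of order $(4,2)$). Symplectic subquadrangles: let $\Sigma$ be a Baer subgeometry of $\mathrm{PG}(3,4)$, i.e. a subgeometry isomorphic to $\mathrm{PG}(3,2)$, and let $\mathcal{W}=\mathcal{W}(3,2)$ be the incidence structure of all points of $\Sigma$ (there are $15$) and of the $15$ lines of $\Sigma$ (called generators of $\mathcal{W}$) that are totally isotropic with respect to a non-degenerate symplectic polarity of $\Sigma$.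 This polarity extends uniquely to a symplectic polarity $\tilde{\perp}$ of $\mathrm{PG}(3,4)$. $\mathcal{W}$ is called a symplectic subquadrangle of $\mathcal{H}(3,4)$ if $\tilde{\perp}\perp=\perp\tilde{\perp}=\sigma$, where $\sigma$ is a semilinear involution whose set of fixed points is $\Sigma$ (so all points of $\Sigma$ lie on $\mathcal{H}(3,4)$ and $\perp$, $\tilde{\perp}$ induce the same polarity on $\Sigma$). Intersections of symplectic subquadrangles denote the sets of their common points; "meeting in $n$ points" means $|\mathcal{W}\cap\mathcal{W}'|=n$. Elliptic ovoids: an elliptic ovoid of $\mathcal{W}$ is an elliptic quadric $\mathcal{Q}^-(3,2)$ of $\Sigma$ (a set of $5$ points) such that the lines of $\Sigma$ tangent to it (meeting it in exactly one point) are precisely the $15$ generators of $\mathcal{W}$. An elliptic quadric of $\Sigma$ determines a unique symplectic quadrangle $\mathcal{W}$ of $\Sigma$ in this way, called the symplectic subquadrangle of the elliptic ovoid. -}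

module Defs where

open import Algebra.Bundles using (CommutativeRing)
open import Algebra.Bundles.Raw using (RawRing)
open import Algebra.Morphism.Structures using (IsRingIsomorphism)
open import Data.Bool.Base using (Bool; true; false; _∧_; _xor_)
open import Data.Bool.Properties using (xor-∧-commutativeRing)
open import Data.Fin.Base using (Fin)
open import Data.Fin.Subset using (Subset; _∈_; _∩_; ∣_∣)
open import Data.List.Base using (List; []; _∷_; _++_; map; cartesianProductWith)
open import Data.Nat.Base using (ℕ; zero; suc)
open import Data.Product using (Σ; ∃; ∃₂; ∃!; _×_; proj₁)
open import Data.Vec.Base as Vec using (Vec; []; _∷_; lookup)
open import Function.Bundles using (Bijection; _⇔_)
open import Level using (Level; 0ℓ; _⊔_) renaming (suc to lsuc)
open import Relation.Binary.Bundles using (Setoid)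
open import Relation.Binary.Core using (Rel)
open import Relation.Binary.PropositionalEquality using (_≡_; _≢_; setoid)
import Relation.Binary.Construct.On as On
open import Relation.Nullary using (¬_)
open import Relation.Unary using (Pred; _⊆_; _≐_; ｛_｝; _∪_)
open import Relation.Unary.Relation.Binary.Equality using (≐-setoid)

F₂-rawRing : RawRing 0ℓ 0ℓ
F₂-rawRing = CommutativeRing.rawRing xor-∧-commutativeRing

-- a +ω b is the element a + bω of GF(4) = GF(2)[ω], where ω² = ω + 1.
record F₄ : Set where
  constructor _+ω_
  field
    const coeff : Bool

add multiply : F₄ → F₄ → F₄
add      (a +ω b) (c +ω d) = (a xor c) +ω (b xor d)
multiply (a +ω b) (c +ω d) =
  ((a ∧ c) xor (b ∧ d)) +ω (((a ∧ d) xor (b ∧ c)) xor (b ∧ d))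

F₄-rawRing : RawRing 0ℓ 0ℓ
F₄-rawRing = record
  { Carrier = F₄
  ; _≈_     = _≡_
  ; _+_     = add
  ; _*_     = multiply
  ; -_      = λ a → a
  ; 0#      = false +ω false
  ; 1#      = true +ω false
  }

-- The automorphism a ↦ a² of GF(4).
conj : F₄ → F₄
conj a = a * a
  where open RawRing F₄-rawRing

ι : Bool → F₄
ι a = a +ω false

-- The space K⁴ over a field K whose equality is propositional.
module Space (K : RawRing 0ℓ 0ℓ) where
  open RawRing K

  V : Set
  V = Vec Carrier 4

  infixl 6 _⊕_
  infixr 7 _·_

  _⊕_ : V → V → V
  _⊕_ = Vec.zipWith _+_

  _·_ : Carrier → V → V
  a · x = Vec.map (a *_) x

  𝟎 : V
  𝟎 = Vec.replicate 4 0#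

  combination : Vec Carrier 4 → Vec V 4 → V
  combination c b = Vec.foldr (λ _ → V) _⊕_ 𝟎 (Vec.zipWith _·_ c b)

  Independent : Vec V 4 → Set
  Independent b = ∀ c → combination c b ≡ 𝟎 → c ≡ 𝟎

  Form : Set
  Form = V → V → Carrier

  record IsBilinear (f : Form) : Set where
    field
      +-linearˡ : ∀ x y z → f (x ⊕ y) z ≡ f x z + f y z
      +-linearʳ : ∀ x y z → f x (y ⊕ z) ≡ f x y + f x z
      ·-linearˡ : ∀ a x y → f (a · x) y ≡ a * f x y
      ·-linearʳ : ∀ a x y → f x (a · y) ≡ a * f x y

  IsAlternating : Form → Set
  IsAlternating f = IsBilinear f × (∀ x → f x x ≡ 0#)

  Nondegenerate : Form → Set
  Nondegenerate f = ∀ x → (∀ y → f x y ≡ 0#) → x ≡ 𝟎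

  polarForm : (V → Carrier) → Form
  polarForm Q x y = (Q (x ⊕ y) + (- Q x)) + (- Q y)

  IsQuadratic : (V → Carrier) → Set
  IsQuadratic Q = (∀ a x → Q (a · x) ≡ (a * a) * Q x) × IsBilinear (polarForm Q)

  ⟨_,_⟩ : V → V → Pred V 0ℓ
  ⟨ x , y ⟩ z = ∃₂ λ a b → z ≡ (a · x) ⊕ (b · y)

  TotallyIsotropic : Form → Pred V 0ℓ → Set
  TotallyIsotropic f S = ∀ {x y} → S x → S y → f x y ≡ 0#

module S₂ = Space F₂-rawRing
module S₄ = Space F₄-rawRing

-- Since 1 is the only nonzero scalar, the points of PG(3,2) are the nonzero
-- vectors, and its lines are ⟨ x , y ⟩ for distinct nonzero x and y.
module PG₂ where
  open S₂

  ForAllLines : (V → V → Set) → Set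
  ForAllLines R = ∀ x y → x ≢ 𝟎 → y ≢ 𝟎 → x ≢ y → R x y

  -- A nonsingular quadric of PG(3,2) is elliptic when it contains no line.
  -- In even dimension it is nonsingular iff its polar form is nondegenerate.
  record IsElliptic (Q : V → Bool) : Set where
    field
      quadratic   : IsQuadratic Q
      nonsingular : Nondegenerate (polarForm Q)
      noLine      : ForAllLines λ x y → ¬ (∀ {z} → ⟨ x , y ⟩ z → Q z ≡ false)

  Tangent : (V → Bool) → V → V → Set
  Tangent Q x y = ∃! _≡_ λ z → z ≢ 𝟎 × ⟨ x , y ⟩ z × Q z ≡ false

open S₄ using (V; Form; _⊕_; _·_; 𝟎)

-- Unitary polarities are the polarities of nondegenerate Hermitian forms; the
-- form is linear in its first argument and conjugate-linear in its second.
record IsHermitian (h : Form) : Set where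
  open RawRing F₄-rawRing
  field
    +-linearˡ : ∀ x y z → h (x ⊕ y) z ≡ h x z + h y z
    ·-linearˡ : ∀ a x y → h (a · x) y ≡ a * h x y
    conj-sym  : ∀ x y → h y x ≡ conj (h x y)

-- Each point of PG(3,4), a one-dimensional subspace of GF(4)⁴, has a unique
-- representative whose first nonzero coordinate is 1.
module Enumeration where
  open RawRing F₄-rawRing

  scalars : List F₄
  scalars = cartesianProductWith _+ω_ bools bools
    where bools = false ∷ true ∷ []

  vectors : ∀ n → List (Vec F₄ n)
  vectors zero    = [] ∷ []
  vectors (suc n) = cartesianProductWith _∷_ scalars (vectors n)

  normalised : ∀ n → List (Vec F₄ n)
  normalised zero    = []
  normalised (suc n) = map (1# ∷_) (vectors n) ++ map (0# ∷_) (normalised n)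

Point : Set
Point = Fin 85

PointSet : Set
PointSet = Subset 85

representative : Point → V
representative = lookup (Vec.fromList (Enumeration.normalised 4))

_Represents_ : V → Point → Set
v Represents P = ∃ λ a → a ≢ RawRing.0# F₄-rawRing × v ≡ a · representative P

polar : Form → Pred Point 0ℓ → Pred Point 0ℓ
polar f S P = ∀ {Q} → S Q → f (representative Q) (representative P) ≡ RawRing.0# F₄-rawRing

record IsSemilinearInvolution (σ : Point → Point) : Set where
  open RawRing F₄-rawRing
  field
    θ              : F₄ → F₄
    θ-automorphism : IsRingIsomorphism F₄-rawRing F₄-rawRing θ
    s              : V → V
    s-additive     : ∀ x y → s (x ⊕ y) ≡ s x ⊕ s y
    s-semilinear   : ∀ a x → s (a · x) ≡ θ a · s x
    s-induces-σ    : ∀ P → s (representative P) Represents σ P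
    involutive     : ∀ P → σ (σ P) ≡ P

-- The Baer subgeometry consisting of the points spanned by the nonzero
-- GF(2)-combinations of a basis of GF(4)⁴.
record BaerSubgeometry : Set where
  field
    basis       : Vec V 4
    independent : S₄.Independent basis

  embed : S₂.V → V
  embed x = S₄.combination (Vec.map ι x) basis

  image : Pred S₂.V 0ℓ → Pred Point 0ℓ
  image S P = ∃ λ x → S x × embed x Represents P

  points : Pred Point 0ℓ
  points = image (_≢ S₂.𝟎)

-- The points of 𝒲(3,2) are all points of the Baer subgeometry, its lines the
-- lines that are totally isotropic with respect to form.
record SymplecticQuadrangle : Set where
  field
    baer          : BaerSubgeometry
    form          : S₂.Form
    alternating   : S₂.IsAlternating form
    nondegenerate : S₂.Nondegenerate form

  open BaerSubgeometry baer public

-- W is a symplectic subquadrangle of the Hermitian surface of h. The polarity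
-- ⊥̃ is that of the alternating form extension, which on the Baer subgeometry
-- induces the same polarity as form; ⊥ is the polarity of h. That all points
-- of W lie on the Hermitian surface is a consequence.
record IsSymplecticSubquadrangle (h : Form) (W : SymplecticQuadrangle) : Set where
  open SymplecticQuadrangle W
  field
    extension               : Form
    extension-alternating   : S₄.IsAlternating extension
    extension-nondegenerate : S₄.Nondegenerate extension
    extends                 : ∀ x y → form x y ≡ false ⇔
                              extension (embed x) (embed y) ≡ RawRing.0# F₄-rawRing
    σ                       : Point → Point
    σ-involution            : IsSemilinearInvolution σ
    ⊥̃⊥≐σ                    : ∀ P → polar h (polar extension ｛ P ｝) ≐ ｛ σ P ｝
    ⊥⊥̃≐σ                    : ∀ P → polar extension (polar h ｛ P ｝) ≐ ｛ σ P ｝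
    σ-fixed                 : (λ P → σ P ≡ P) ≐ points

record IsEllipticOvoid (E : PointSet) (W : SymplecticQuadrangle) : Set where
  open SymplecticQuadrangle W
  open S₂ using (⟨_,_⟩; TotallyIsotropic)
  open PG₂
  field
    Q        : S₂.V → Bool
    elliptic : IsElliptic Q
    zeros    : (_∈ E) ≐ image (λ x → x ≢ S₂.𝟎 × Q x ≡ false)
    tangents : ForAllLines λ x y → Tangent Q x y ⇔ TotallyIsotropic form ⟨ x , y ⟩

module Graph {A : Set} (Vertex : Pred A 0ℓ) (Adjacent : Rel A 0ℓ) where

  IsClique : Pred A 0ℓ → Set
  IsClique C = C ⊆ Vertex × (∀ {x y} → C x → C y → x ≢ y → Adjacent x y)

  IsMaximalClique : Pred A 0ℓ → Set₁
  IsMaximalClique C = IsClique C × (∀ {D} → IsClique D → C ⊆ D → D ⊆ C)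

module Γ (h : Form) where

  -- E is an elliptic ovoid of a symplectic subquadrangle with point set W.
  OvoidOf : PointSet → PointSet → Set
  OvoidOf E W = ∃ λ 𝒲 → IsSymplecticSubquadrangle h 𝒲 × IsEllipticOvoid E 𝒲 ×
                        (_∈ W) ≐ SymplecticQuadrangle.points 𝒲

  Vertex : Pred PointSet 0ℓ
  Vertex E = ∃ λ W → OvoidOf E W

  Adjacent : Rel PointSet 0ℓ
  Adjacent E E′ = ∃₂ λ W W′ → OvoidOf E W × OvoidOf E′ W′ ×
                              ∣ E ∩ E′ ∣ ≡ 1 × ∣ W ∩ W′ ∣ ≡ 6

  open Graph Vertex Adjacent public

  -- C consists of three vertices, and the point sets of their symplectic
  -- subquadrangles have exactly n points in common.
  record TripleMeetingIn (n : ℕ) (C : Pred PointSet 0ℓ) : Set where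
    field
      E E′ E″    : PointSet
      E≢E′       : E ≢ E′
      E≢E″       : E ≢ E″
      E′≢E″      : E′ ≢ E″
      C≐         : C ≐ ｛ E ｝ ∪ ｛ E′ ｝ ∪ ｛ E″ ｝
      W W′ W″    : PointSet
      E-ovoid    : OvoidOf E W
      E′-ovoid   : OvoidOf E′ W′
      E″-ovoid   : OvoidOf E″ W″
      meet       : ∣ W ∩ W′ ∩ W″ ∣ ≡ n

  MaximalCliquesMeetingIn : ℕ → Setoid (lsuc 0ℓ) 0ℓ
  MaximalCliquesMeetingIn n =
    On.setoid {B = Σ (Pred PointSet 0ℓ) λ C → IsMaximalClique C × TripleMeetingIn n C}
              (≐-setoid PointSet 0ℓ) proj₁

HasCardinality : {a ℓ : Level} → Setoid a ℓ → ℕ → Set (a ⊔ ℓ)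
HasCardinality S n = Bijection (setoid (Fin n)) S

-- Call five isotropic vectors with mutual products 1 a frame. An elliptic ovoid
-- E and its symplectic subquadrangle W come from a frame b₁, ..., b₅, unique up to
-- a common scalar: E consists of the points ⟨bᵢ⟩ and W of these and the points
-- ⟨bᵢ + bⱼ⟩. Indeed, since σ fixes W pointwise, the Hermitian form, restricted to
-- suitable vectors of W, is the symplectic form over GF(2); two points of E
-- are joined by a line that is not tangent, so their product is 1. Conversely the
-- vectors of a frame sum to 0 and four of them have an invertible Gram matrix over
-- GF(2), which defines the symplectic polarity. A nondegenerate Hermitian form has an
-- orthonormal basis, so it suffices to enumerate the frames of Σ xᵢ conj yᵢ. There
-- are 216 of them up to scalars, and their graph has 5760 triangles, which are
-- maximal cliques because there is no clique of size 4.
module Submission where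

open import Defs
open import Algebra.Bundles.Raw using (RawRing)
open import Algebra.Morphism.Structures using (IsRingIsomorphism)
open import Data.Bool.Base using (Bool; true; false; _∧_; _xor_)
import Data.Bool.Properties as 𝔹
open import Data.Fin.Base using (Fin; zero; suc; combine; funToFin; finToFun)
import Data.Fin.Properties as Fin
open import Data.Fin.Subset as Subset using (Subset; inside; outside; ∣_∣; _∩_)
import Data.Fin.Subset.Properties as Subset
open import Data.List.Base as List using (List; []; _∷_; _++_; length; filter; deduplicate; cartesianProductWith)
import Data.List.Membership.DecPropositional as DecMembership
open import Data.List.Membership.Propositional using (_∈_; _∉_; find; lose)
open import Data.List.Membership.Propositional.Properties
  using (∈-map⁺; ∈-map⁻; ∈-++⁺ˡ; ∈-++⁺ʳ; ∈-++⁻; ∈-filter⁺; ∈-filter⁻; ∈-lookup;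
         ∈-cartesianProductWith⁺; ∈-cartesianProductWith⁻; ∈-deduplicate⁺; ∈-deduplicate⁻)
open import Data.List.Membership.Propositional.Properties.WithK using (unique∧set⇒bag)
import Data.List.Properties as List
open import Data.List.Relation.Binary.BagAndSetEquality using (_∼[_]_; set; ∼bag⇒↭)
import Data.List.Relation.Binary.Permutation.Propositional.Properties as ↭
open import Data.List.Relation.Binary.Sublist.Heterogeneous.Properties using (⊆-filter-Sublist)
open import Data.List.Relation.Binary.Sublist.Propositional
  using ([]; _∷_; _∷ʳ_; lookup; minimum; ⊆-trans)
  renaming (_⊆_ to _⊑_)
open import Data.List.Relation.Binary.Sublist.Propositional.Properties using (filter-⊆)
open import Data.List.Relation.Unary.All as All using (All; []; _∷_)
import Data.List.Relation.Unary.All.Properties as All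
open import Data.List.Relation.Unary.AllPairs as AllPairs using (AllPairs; []; _∷_)
import Data.List.Relation.Unary.AllPairs.Properties as AllPairs
open import Data.List.Relation.Unary.Any as Any using (Any; here; there)
import Data.List.Relation.Unary.Any.Properties as Any
open import Data.List.Relation.Unary.Unique.DecPropositional using (unique?)
open import Data.List.Relation.Unary.Unique.DecPropositional.Properties using (deduplicate-!)
open import Data.List.Relation.Unary.Unique.Propositional using (Unique)
import Data.List.Relation.Unary.Unique.Propositional.Properties as Unique
open import Data.Nat.Base as ℕ using (ℕ; zero; suc; _<_; s≤s; z≤n; _/_; _%_)
open import Data.Nat.ListAction using (sum)
open import Data.Nat.ListAction.Properties using (sum-↭)
import Data.Nat.Properties as ℕ
open import Data.Product.Base using (∃; ∃-syntax; _×_; _,_; proj₁; proj₂; map₁)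
import Data.Product.Properties as Product
open import Data.Sum.Base using (_⊎_; inj₁; inj₂)
open import Data.Vec.Base as Vec using (Vec; []; _∷_)
import Data.Vec.Properties as Vec
open import Function.Base using (_∘_; id; case_of_)
open import Function.Bundles using (_⇔_; mk⇔; Equivalence)
open import Function.Construct.Composition using (_⇔-∘_)
open import Function.Construct.Symmetry using (⇔-sym)
open import Level using (0ℓ)
open import Relation.Binary.Core using (Rel)
open import Relation.Binary.Definitions using (Decidable; DecidableEquality; Symmetric)
open import Relation.Binary.PropositionalEquality
open import Relation.Nullary using (¬_; Dec; yes; no; ¬?; contradiction)
open import Relation.Nullary.Decidable
  using (map′; True; toWitness; does; dec-true; decidable-stable; _×-dec_; _⊎-dec_; _→-dec_)
open import Relation.Unary using (Pred; _≐_; ｛_｝)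

open RawRing F₄-rawRing using (0#; 1#; _+_; _*_)
open S₄ using (V)

-- The definition of `Γ` quantifies over Baer subgeometries, forms and semilinear maps, which are
-- not practical to search. A frame is the small finite datum that replaces them, and its
-- correspondence with ovoids is proved for an arbitrary nondegenerate `h`, in both directions,
-- before anything is counted. After that a single evaluation, on lists of natural numbers that
-- encode points, serves every `h`. Two facts make it legitimate to count lists. Distinct listed
-- frames have distinct ovoids, so the point set `E` alone determines `W`, although adjacency in `Γ`
-- only asks that suitable quadrangles exist. And each set of vertices is listed by exactly one
-- sublist of `vertices`, so that counting such sublists counts cliques, which are predicates
-- compared by `≐`. Identities over GF(2) and GF(4) in a bounded number of variables are settled by
-- running through all values.

decide : {A : Set} (A? : Dec A) → {_ : True A?} → A
decide A? {t} = toWitness t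

-- Finite types and decision by exhaustion

record Finite (A : Set) : Set where
  field
    elements : List A
    complete : ∀ a → a ∈ elements

open Finite {{...}}

∀? : {A : Set} {{_ : Finite A}} {P : A → Set} → (∀ a → Dec (P a)) → Dec (∀ a → P a)
∀? P? = map′ (λ ps a → All.lookup ps (complete a)) (λ p → All.universal p elements) (All.all? P? elements)

∃? : {A : Set} {{_ : Finite A}} {P : A → Set} → (∀ a → Dec (P a)) → Dec (∃ P)
∃? P? = map′ Any.satisfied (λ (a , p) → lose (complete a) p) (Any.any? P? elements)

-- Constructively this rests on finiteness. It turns nondegeneracy, a statement about all vectors,
-- into an actual non-orthogonal vector.
¬∀⇒∃¬ : {A : Set} {{_ : Finite A}} {P : A → Set} → (∀ a → Dec (P a)) → ¬ (∀ a → P a) → ∃ λ a → ¬ P a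
¬∀⇒∃¬ P? ¬p with ∃? (¬? ∘ P?)
... | yes q = q
... | no ¬q = contradiction (λ a → decidable-stable (P? a) (λ ¬pa → ¬q (a , ¬pa))) ¬p

instance
  finite-Bool : Finite Bool
  finite-Bool = record
    { elements = false ∷ true ∷ []
    ; complete = λ { false → here refl ; true → there (here refl) }
    }

  finite-F₄ : Finite F₄
  finite-F₄ = record
    { elements = Enumeration.scalars
    ; complete = λ (a +ω b) → ∈-cartesianProductWith⁺ _+ω_ (complete a) (complete b)
    }

  finite-Vec : {A : Set} {n : ℕ} {{_ : Finite A}} → Finite (Vec A n)
  finite-Vec {n = zero} = record { elements = [] ∷ [] ; complete = λ { [] → here refl } }
  finite-Vec {n = suc n} = record
    { elements = cartesianProductWith _∷_ elements elements
    ; complete = λ { (x ∷ xs) → ∈-cartesianProductWith⁺ _∷_ (complete x) (complete xs) }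
    }

-- Arithmetic of GF(4)

infix 4 _≟_ _≟ᵥ_ _≟₂_

_≟_ : DecidableEquality F₄
(a +ω b) ≟ (c +ω d) = map′ (λ (p , q) → cong₂ _+ω_ p q) (λ { refl → refl , refl })
                           ((a 𝔹.≟ c) ×-dec (b 𝔹.≟ d))

_≟ᵥ_ : ∀ {n} → DecidableEquality (Vec F₄ n)
_≟ᵥ_ = Vec.≡-dec _≟_

_≟₂_ : ∀ {n} → DecidableEquality (Vec Bool n)
_≟₂_ = Vec.≡-dec 𝔹._≟_

+-assoc : ∀ a b c → (a + b) + c ≡ a + (b + c)
+-assoc = decide (∀? λ a → ∀? λ b → ∀? λ c → _ ≟ _)

+-identityˡ : ∀ a → 0# + a ≡ a
+-identityˡ = decide (∀? λ a → _ ≟ _)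

+-identityʳ : ∀ a → a + 0# ≡ a
+-identityʳ = decide (∀? λ a → _ ≟ _)

+-self : ∀ a → a + a ≡ 0#
+-self = decide (∀? λ a → _ ≟ _)

+-interchange : ∀ a b c d → (a + b) + (c + d) ≡ (a + c) + (b + d)
+-interchange = decide (∀? λ a → ∀? λ b → ∀? λ c → ∀? λ d → _ ≟ _)

*-assoc : ∀ a b c → (a * b) * c ≡ a * (b * c)
*-assoc = decide (∀? λ a → ∀? λ b → ∀? λ c → _ ≟ _)

*-comm : ∀ a b → a * b ≡ b * a
*-comm = decide (∀? λ a → ∀? λ b → _ ≟ _)

*-identityˡ : ∀ a → 1# * a ≡ a
*-identityˡ = decide (∀? λ a → _ ≟ _)

*-zeroˡ : ∀ a → 0# * a ≡ 0#
*-zeroˡ = decide (∀? λ a → _ ≟ _)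

*-zeroʳ : ∀ a → a * 0# ≡ 0#
*-zeroʳ = decide (∀? λ a → _ ≟ _)

*-distribˡ : ∀ a b c → a * (b + c) ≡ a * b + a * c
*-distribˡ = decide (∀? λ a → ∀? λ b → ∀? λ c → _ ≟ _)

*-distribʳ : ∀ a b c → (a + b) * c ≡ a * c + b * c
*-distribʳ = decide (∀? λ a → ∀? λ b → ∀? λ c → _ ≟ _)

conj-+ : ∀ a b → conj (a + b) ≡ conj a + conj b
conj-+ = decide (∀? λ a → ∀? λ b → _ ≟ _)

conj-* : ∀ a b → conj (a * b) ≡ conj a * conj b
conj-* = decide (∀? λ a → ∀? λ b → _ ≟ _)

conj-conj : ∀ a → conj (conj a) ≡ a
conj-conj = decide (∀? λ a → _ ≟ _)

-- The nonzero elements form a group of order 3, so the square of `a` is its inverse. Throughout,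
-- `conj a` serves both as the conjugate and as the inverse of a nonzero `a`.
conj-inverse : ∀ a → a ≢ 0# → conj a * a ≡ 1#
conj-inverse = decide (∀? λ a → ¬? (a ≟ 0#) →-dec (_ ≟ _))

conj-nonzero : ∀ a → a ≢ 0# → conj a ≢ 0#
conj-nonzero = decide (∀? λ a → ¬? (a ≟ 0#) →-dec ¬? (_ ≟ _))

*-nonzero : ∀ a b → a ≢ 0# → b ≢ 0# → a * b ≢ 0#
*-nonzero = decide (∀? λ a → ∀? λ b → ¬? (a ≟ 0#) →-dec (¬? (b ≟ 0#) →-dec ¬? (_ ≟ _)))

zero-product : ∀ a b → a ≢ 0# → a * b ≡ 0# → b ≡ 0#
zero-product = decide (∀? λ a → ∀? λ b → ¬? (a ≟ 0#) →-dec ((_ ≟ _) →-dec (_ ≟ _)))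

1≢0 : 1# ≢ 0#
1≢0 ()

-- Vectors and linear combinations over GF(4)

infixl 6 _⊕_
infixr 7 _·_

private variable
  m n : ℕ

_⊕_ : Vec F₄ n → Vec F₄ n → Vec F₄ n
_⊕_ = Vec.zipWith _+_

_·_ : F₄ → Vec F₄ n → Vec F₄ n
a · x = Vec.map (a *_) x

𝟎 : Vec F₄ n
𝟎 = Vec.replicate _ 0#

⊕-assoc : (x y z : Vec F₄ n) → (x ⊕ y) ⊕ z ≡ x ⊕ (y ⊕ z)
⊕-assoc = Vec.zipWith-assoc +-assoc

⊕-identityˡ : (x : Vec F₄ n) → 𝟎 ⊕ x ≡ x
⊕-identityˡ = Vec.zipWith-identityˡ +-identityˡ

⊕-identityʳ : (x : Vec F₄ n) → x ⊕ 𝟎 ≡ x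
⊕-identityʳ = Vec.zipWith-identityʳ +-identityʳ

⊕-self : (x : Vec F₄ n) → x ⊕ x ≡ 𝟎
⊕-self []      = refl
⊕-self (a ∷ x) = cong₂ _∷_ (+-self a) (⊕-self x)

⊕-interchange : (w x y z : Vec F₄ n) → (w ⊕ x) ⊕ (y ⊕ z) ≡ (w ⊕ y) ⊕ (x ⊕ z)
⊕-interchange []      []      []      []      = refl
⊕-interchange (a ∷ w) (b ∷ x) (c ∷ y) (d ∷ z) = cong₂ _∷_ (+-interchange a b c d) (⊕-interchange w x y z)

⊕≡𝟎⇒≡ : {x y : Vec F₄ n} → x ⊕ y ≡ 𝟎 → x ≡ y
⊕≡𝟎⇒≡ {x = x} {y} eq = begin
  x             ≡⟨ ⊕-identityʳ x ⟨
  x ⊕ 𝟎         ≡⟨ cong (x ⊕_) (⊕-self y) ⟨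
  x ⊕ (y ⊕ y)   ≡⟨ ⊕-assoc x y y ⟨
  (x ⊕ y) ⊕ y   ≡⟨ cong (_⊕ y) eq ⟩
  𝟎 ⊕ y         ≡⟨ ⊕-identityˡ y ⟩
  y             ∎
  where open ≡-Reasoning

·-assoc : ∀ a b (x : Vec F₄ n) → a · (b · x) ≡ (a * b) · x
·-assoc a b []      = refl
·-assoc a b (c ∷ x) = cong₂ _∷_ (sym (*-assoc a b c)) (·-assoc a b x)

·-identity : (x : Vec F₄ n) → 1# · x ≡ x
·-identity []      = refl
·-identity (a ∷ x) = cong₂ _∷_ (*-identityˡ a) (·-identity x)

·-zeroˡ : (x : Vec F₄ n) → 0# · x ≡ 𝟎
·-zeroˡ []      = refl
·-zeroˡ (a ∷ x) = cong₂ _∷_ (*-zeroˡ a) (·-zeroˡ x)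

·-zeroʳ : ∀ n a → a · 𝟎 {n} ≡ 𝟎
·-zeroʳ zero    a = refl
·-zeroʳ (suc n) a = cong₂ _∷_ (*-zeroʳ a) (·-zeroʳ n a)

·-distribˡ : ∀ a (x y : Vec F₄ n) → a · (x ⊕ y) ≡ a · x ⊕ a · y
·-distribˡ a []      []      = refl
·-distribˡ a (b ∷ x) (c ∷ y) = cong₂ _∷_ (*-distribˡ a b c) (·-distribˡ a x y)

·-distribʳ : ∀ a b (x : Vec F₄ n) → (a + b) · x ≡ a · x ⊕ b · x
·-distribʳ a b []      = refl
·-distribʳ a b (c ∷ x) = cong₂ _∷_ (*-distribʳ a b c) (·-distribʳ a b x)

·-inverse : ∀ {a} → a ≢ 0# → (x : Vec F₄ n) → conj a · (a · x) ≡ x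
·-inverse {a = a} a≢0 x = trans (·-assoc (conj a) a x)
  (trans (cong (_· x) (conj-inverse a a≢0)) (·-identity x))

·-injective : ∀ {a} → a ≢ 0# → {x y : Vec F₄ n} → a · x ≡ a · y → x ≡ y
·-injective {a = a} a≢0 {x} {y} eq = trans (sym (·-inverse a≢0 x)) (trans (cong (conj a ·_) eq) (·-inverse a≢0 y))

·-inverse′ : ∀ {a} → a ≢ 0# → (x : Vec F₄ n) → a · (conj a · x) ≡ x
·-inverse′ {a = a} a≢0 x = trans (·-assoc a (conj a) x)
  (trans (cong (_· x) (trans (*-comm a (conj a)) (conj-inverse a a≢0))) (·-identity x))

·-nonzero : ∀ {a} {x : Vec F₄ n} → a ≢ 0# → x ≢ 𝟎 → a · x ≢ 𝟎
·-nonzero {n} {a} {x} a≢0 x≢𝟎 ax≡𝟎 = x≢𝟎 (trans (sym (·-inverse a≢0 x))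
  (trans (cong (conj a ·_) ax≡𝟎) (·-zeroʳ n (conj a))))

conjᵥ : Vec F₄ n → Vec F₄ n
conjᵥ = Vec.map conj

conjᵥ-⊕ : (x y : Vec F₄ n) → conjᵥ (x ⊕ y) ≡ conjᵥ x ⊕ conjᵥ y
conjᵥ-⊕ []      []      = refl
conjᵥ-⊕ (a ∷ x) (b ∷ y) = cong₂ _∷_ (conj-+ a b) (conjᵥ-⊕ x y)

conjᵥ-· : ∀ a (x : Vec F₄ n) → conjᵥ (a · x) ≡ conj a · conjᵥ x
conjᵥ-· a []      = refl
conjᵥ-· a (b ∷ x) = cong₂ _∷_ (conj-* a b) (conjᵥ-· a x)

conjᵥ-conjᵥ : (x : Vec F₄ n) → conjᵥ (conjᵥ x) ≡ x
conjᵥ-conjᵥ []      = refl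
conjᵥ-conjᵥ (a ∷ x) = cong₂ _∷_ (conj-conj a) (conjᵥ-conjᵥ x)

conjᵥ-𝟎 : ∀ n → conjᵥ (𝟎 {n}) ≡ 𝟎
conjᵥ-𝟎 zero    = refl
conjᵥ-𝟎 (suc n) = cong (0# ∷_) (conjᵥ-𝟎 n)

dot : Vec F₄ n → Vec F₄ n → F₄
dot []      []      = 0#
dot (a ∷ x) (b ∷ y) = a * b + dot x y

dot-⊕ˡ : (x y z : Vec F₄ n) → dot (x ⊕ y) z ≡ dot x z + dot y z
dot-⊕ˡ []      []      []      = refl
dot-⊕ˡ (a ∷ x) (b ∷ y) (c ∷ z) = trans (cong₂ _+_ (*-distribʳ a b c) (dot-⊕ˡ x y z))
  (+-interchange (a * c) (b * c) (dot x z) (dot y z))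

dot-·ˡ : ∀ a (x y : Vec F₄ n) → dot (a · x) y ≡ a * dot x y
dot-·ˡ a []      []      = sym (*-zeroʳ a)
dot-·ˡ a (b ∷ x) (c ∷ y) = trans (cong₂ _+_ (*-assoc a b c) (dot-·ˡ a x y))
  (sym (*-distribˡ a (b * c) (dot x y)))

dot-comm : (x y : Vec F₄ n) → dot x y ≡ dot y x
dot-comm []      []      = refl
dot-comm (a ∷ x) (b ∷ y) = cong₂ _+_ (*-comm a b) (dot-comm x y)

dot-zeroʳ : (x : Vec F₄ n) → dot x 𝟎 ≡ 0#
dot-zeroʳ []      = refl
dot-zeroʳ (a ∷ x) = trans (cong₂ _+_ (*-zeroʳ a) (dot-zeroʳ x)) (+-identityʳ 0#)

conj-dot : (x y : Vec F₄ n) → conj (dot x y) ≡ dot (conjᵥ x) (conjᵥ y)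
conj-dot []      []      = refl
conj-dot (a ∷ x) (b ∷ y) = trans (conj-+ (a * b) (dot x y)) (cong₂ _+_ (conj-* a b) (conj-dot x y))

comb : Vec F₄ n → Vec V n → V
comb c b = Vec.foldr (λ _ → V) _⊕_ 𝟎 (Vec.zipWith _·_ c b)

comb-⊕ : (c d : Vec F₄ n) (b : Vec V n) → comb (c ⊕ d) b ≡ comb c b ⊕ comb d b
comb-⊕ []      []      []      = refl
comb-⊕ (c ∷ cs) (d ∷ ds) (b ∷ bs) = trans (cong₂ _⊕_ (·-distribʳ c d b) (comb-⊕ cs ds bs))
  (⊕-interchange (c · b) (d · b) (comb cs bs) (comb ds bs))

comb-· : ∀ a (c : Vec F₄ n) (b : Vec V n) → comb (a · c) b ≡ a · comb c b
comb-· a []       []       = sym (·-zeroʳ 4 a)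
comb-· a (c ∷ cs) (b ∷ bs) = trans (cong₂ _⊕_ (sym (·-assoc a c b)) (comb-· a cs bs))
  (sym (·-distribˡ a (c · b) (comb cs bs)))

comb-𝟎 : (b : Vec V n) → comb 𝟎 b ≡ 𝟎
comb-𝟎 []       = refl
comb-𝟎 (b ∷ bs) = trans (cong₂ _⊕_ (·-zeroˡ b) (comb-𝟎 bs)) (⊕-identityˡ 𝟎)

-- There are more vectors in the domain than in the codomain, so two of them
-- have the same image.
module _ where
  private
    fromFin : Fin 4 → F₄
    fromFin zero                   = false +ω false
    fromFin (suc zero)             = false +ω true
    fromFin (suc (suc zero))       = true +ω false
    fromFin (suc (suc (suc zero))) = true +ω true

    toFin : F₄ → Fin 4
    toFin (false +ω false) = zero
    toFin (false +ω true)  = suc zero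
    toFin (true +ω false)  = suc (suc zero)
    toFin (true +ω true)   = suc (suc (suc zero))

    toFin-fromFin : ∀ i → toFin (fromFin i) ≡ i
    toFin-fromFin zero                   = refl
    toFin-fromFin (suc zero)             = refl
    toFin-fromFin (suc (suc zero))       = refl
    toFin-fromFin (suc (suc (suc zero))) = refl

    fromFin-toFin : ∀ a → fromFin (toFin a) ≡ a
    fromFin-toFin = decide (∀? λ a → _ ≟ _)

    encode : ∀ n → Vec F₄ n → Fin (4 ℕ.^ n)
    encode n x = funToFin (toFin ∘ Vec.lookup x)

    decode : ∀ n → Fin (4 ℕ.^ n) → Vec F₄ n
    decode n i = Vec.tabulate (fromFin ∘ finToFun i)

    decode-encode : ∀ n x → decode n (encode n x) ≡ x
    decode-encode n x = trans
      (Vec.tabulate-cong λ i → trans (cong fromFin (Fin.finToFun-funToFin (toFin ∘ Vec.lookup x) i))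
                                     (fromFin-toFin (Vec.lookup x i)))
      (Vec.tabulate∘lookup x)

    funToFin-cong : ∀ {m n} {f g : Fin m → Fin n} → f ≗ g → funToFin f ≡ funToFin g
    funToFin-cong {zero}  eq = refl
    funToFin-cong {suc m} eq = cong₂ combine (eq zero) (funToFin-cong (eq ∘ suc))

    encode-decode : ∀ n i → encode n (decode n i) ≡ i
    encode-decode n i = trans
      (funToFin-cong {n} λ j → trans (cong toFin (Vec.lookup∘tabulate (fromFin ∘ finToFun i) j))
                                   (toFin-fromFin (finToFun i j)))
      (Fin.funToFin-finToFin {n} i)

  opaque
    nontrivial-kernel : m < n → (f : Vec F₄ n → Vec F₄ m) → (∀ x y → f (x ⊕ y) ≡ f x ⊕ f y) →
                        ∃ λ x → x ≢ 𝟎 × f x ≡ 𝟎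
    nontrivial-kernel {m} {n} m<n f f-⊕
      with Fin.pigeonhole (ℕ.^-monoʳ-< 4 (s≤s (s≤s z≤n)) m<n) (encode m ∘ f ∘ decode n)
    ... | i , j , i<j , eq = x ⊕ y
                           , (λ x⊕y≡𝟎 → contradiction (decode-injective (⊕≡𝟎⇒≡ x⊕y≡𝟎)) (Fin.<⇒≢ i<j))
                           , trans (f-⊕ x y) (trans (cong (_⊕ f y) (encode-injective eq)) (⊕-self (f y)))
      where
      x y : Vec F₄ n
      x = decode n i
      y = decode n j
      decode-injective : x ≡ y → i ≡ j
      decode-injective eq = trans (sym (encode-decode n i)) (trans (cong (encode n) eq) (encode-decode n j))
      encode-injective : encode m (f x) ≡ encode m (f y) → f x ≡ f y
      encode-injective eq = trans (sym (decode-encode m (f x))) (trans (cong (decode m) eq) (decode-encode m (f y)))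

-- Five vectors of a four-dimensional space satisfy a nontrivial linear relation. Independence of
-- `b` forces the coefficient `d` of `v` to be nonzero, and the relation is solved for `v`.
independent⇒spanning : (b : Vec V 4) → S₄.Independent b → ∀ v → ∃ λ c → v ≡ comb c b
independent⇒spanning b independent v
  with nontrivial-kernel {4} {5} (s≤s (s≤s (s≤s (s≤s (s≤s z≤n))))) (λ c → comb c (v ∷ b)) (λ c d → comb-⊕ c d (v ∷ b))
... | (d ∷ c) , dc≢𝟎 , eq with d ≟ 0#
...   | yes refl = contradiction (cong (0# ∷_) (independent c
  (trans (sym (trans (cong (_⊕ comb c b) (·-zeroˡ v)) (⊕-identityˡ (comb c b)))) eq))) dc≢𝟎
...   | no d≢0 = conj d · c , (begin
  v                    ≡⟨ ·-inverse d≢0 v ⟨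
  conj d · (d · v)     ≡⟨ cong (conj d ·_) (⊕≡𝟎⇒≡ eq) ⟩
  conj d · comb c b    ≡⟨ comb-· (conj d) c b ⟨
  comb (conj d · c) b  ∎)
  where open ≡-Reasoning

-- Hermitian forms and orthonormal bases

ω : F₄
ω = false +ω true

module Hermitian (h : S₄.Form) (hermitian : IsHermitian h) where
  open IsHermitian hermitian public renaming (+-linearˡ to h-⊕ˡ; ·-linearˡ to h-·ˡ)
  open ≡-Reasoning

  h-⊕ʳ : ∀ x y z → h x (y ⊕ z) ≡ h x y + h x z
  h-⊕ʳ x y z = begin
    h x (y ⊕ z)                ≡⟨ conj-sym (y ⊕ z) x ⟩
    conj (h (y ⊕ z) x)         ≡⟨ cong conj (h-⊕ˡ y z x) ⟩
    conj (h y x + h z x)       ≡⟨ conj-+ (h y x) (h z x) ⟩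
    conj (h y x) + conj (h z x) ≡⟨ cong₂ _+_ (conj-sym y x) (conj-sym z x) ⟨
    h x y + h x z              ∎

  h-·ʳ : ∀ a x y → h x (a · y) ≡ conj a * h x y
  h-·ʳ a x y = begin
    h x (a · y)            ≡⟨ conj-sym (a · y) x ⟩
    conj (h (a · y) x)     ≡⟨ cong conj (h-·ˡ a y x) ⟩
    conj (a * h y x)       ≡⟨ conj-* a (h y x) ⟩
    conj a * conj (h y x)  ≡⟨ cong (conj a *_) (conj-sym y x) ⟨
    conj a * h x y         ∎

  h-𝟎ˡ : ∀ y → h 𝟎 y ≡ 0#
  h-𝟎ˡ y = trans (h-·ˡ 0# 𝟎 y) (*-zeroˡ (h 𝟎 y))

  h-𝟎ʳ : ∀ x → h x 𝟎 ≡ 0#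
  h-𝟎ʳ x = trans (h-·ʳ 0# x 𝟎) (*-zeroˡ (h x 𝟎))

  h-sym-zero : ∀ x y → h x y ≡ 0# → h y x ≡ 0#
  h-sym-zero x y eq = trans (conj-sym x y) (cong conj eq)

  -- The norm `a * conj a` of every nonzero scalar is 1, so multiplication by a nonzero scalar is an
  -- isometry.
  h-scale : ∀ a → a ≢ 0# → ∀ x y → h (a · x) (a · y) ≡ h x y
  h-scale a a≢0 x y = begin
    h (a · x) (a · y)       ≡⟨ h-·ˡ a x (a · y) ⟩
    a * h x (a · y)         ≡⟨ cong (a *_) (h-·ʳ a x y) ⟩
    a * (conj a * h x y)    ≡⟨ *-assoc a (conj a) (h x y) ⟨
    (a * conj a) * h x y    ≡⟨ cong (_* h x y) (trans (*-comm a (conj a)) (conj-inverse a a≢0)) ⟩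
    1# * h x y              ≡⟨ *-identityˡ (h x y) ⟩
    h x y                   ∎

  coordinates : Vec V n → V → Vec F₄ n
  coordinates b x = Vec.map (h x) b

  coordinates-⊕ : (b : Vec V n) → ∀ x y → coordinates b (x ⊕ y) ≡ coordinates b x ⊕ coordinates b y
  coordinates-⊕ []      x y = refl
  coordinates-⊕ (v ∷ b) x y = cong₂ _∷_ (h-⊕ˡ x y v) (coordinates-⊕ b x y)

  coordinates-· : (b : Vec V n) → ∀ a x → coordinates b (a · x) ≡ a · coordinates b x
  coordinates-· []      a x = refl
  coordinates-· (v ∷ b) a x = cong₂ _∷_ (h-·ˡ a x v) (coordinates-· b a x)

  h-comb : (c : Vec F₄ n) (b : Vec V n) → ∀ y → h (comb c b) y ≡ dot c (Vec.map (λ v → h v y) b)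
  h-comb []      []      y = h-𝟎ˡ y
  h-comb (a ∷ c) (v ∷ b) y = begin
    h (a · v ⊕ comb c b) y            ≡⟨ h-⊕ˡ (a · v) (comb c b) y ⟩
    h (a · v) y + h (comb c b) y      ≡⟨ cong₂ _+_ (h-·ˡ a v y) (h-comb c b y) ⟩
    a * h v y + dot c (Vec.map (λ v → h v y) b)  ∎

  map-conj-sym : (b : Vec V n) → ∀ y → Vec.map (λ v → h v y) b ≡ conjᵥ (coordinates b y)
  map-conj-sym []      y = refl
  map-conj-sym (v ∷ b) y = cong₂ _∷_ (conj-sym y v) (map-conj-sym b y)

  h-comb-conj : (c : Vec F₄ n) (b : Vec V n) → ∀ y → h (comb c b) y ≡ dot c (conjᵥ (coordinates b y))
  h-comb-conj c b y = trans (h-comb c b y) (cong (dot c) (map-conj-sym b y))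

  -- Taking unit vectors for `c` gives the usual condition that the Gram matrix is the identity. In
  -- this form it says directly that `coordinates b` is a left inverse of the combination map, which
  -- is what projections and changes of coordinates need.
  Orthonormal : Vec V n → Set
  Orthonormal b = ∀ c → coordinates b (comb c b) ≡ c

  orthogonal-comb : (b : Vec V n) → ∀ x → coordinates b x ≡ 𝟎 → ∀ c → h (comb c b) x ≡ 0#
  orthogonal-comb {n} b x eq c = begin
    h (comb c b) x                    ≡⟨ h-comb-conj c b x ⟩
    dot c (conjᵥ (coordinates b x))   ≡⟨ cong (dot c ∘ conjᵥ) eq ⟩
    dot c (conjᵥ 𝟎)                   ≡⟨ cong (dot c) (conjᵥ-𝟎 n) ⟩
    dot c 𝟎                           ≡⟨ dot-zeroʳ c ⟩
    0#                                ∎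

  orthonormal-∷ : (b : Vec V n) → Orthonormal b → ∀ v → h v v ≡ 1# → coordinates b v ≡ 𝟎 → Orthonormal (v ∷ b)
  orthonormal-∷ {n} b orthonormal v unit orthogonal (a ∷ c) = cong₂ _∷_
    (begin
      h (a · v ⊕ comb c b) v        ≡⟨ h-⊕ˡ (a · v) (comb c b) v ⟩
      h (a · v) v + h (comb c b) v  ≡⟨ cong₂ _+_ (trans (h-·ˡ a v v) (cong (a *_) unit)) (orthogonal-comb b v orthogonal c) ⟩
      a * 1# + 0#                   ≡⟨ +-identityʳ (a * 1#) ⟩
      a * 1#                        ≡⟨ *-comm a 1# ⟩
      1# * a                        ≡⟨ *-identityˡ a ⟩
      a                             ∎)
    (begin
      coordinates b (a · v ⊕ comb c b)                ≡⟨ coordinates-⊕ b (a · v) (comb c b) ⟩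
      coordinates b (a · v) ⊕ coordinates b (comb c b) ≡⟨ cong₂ _⊕_ (coordinates-· b a v) (orthonormal c) ⟩
      a · coordinates b v ⊕ c                         ≡⟨ cong (λ x → a · x ⊕ c) orthogonal ⟩
      a · 𝟎 ⊕ c                                       ≡⟨ cong (_⊕ c) (·-zeroʳ n a) ⟩
      𝟎 ⊕ c                                           ≡⟨ ⊕-identityˡ c ⟩
      c                                               ∎)

  -- By Hermitian symmetry `h x x` is fixed by conjugation, so it lies in the prime field.
  self-0or1 : ∀ x → h x x ≡ 0# ⊎ h x x ≡ 1#
  self-0or1 x = fixed (h x x) (conj-sym x x)
    where
    fixed : ∀ a → a ≡ conj a → a ≡ 0# ⊎ a ≡ 1#
    fixed (false +ω false) eq = inj₁ refl
    fixed (true +ω false)  eq = inj₂ refl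

  -- If x and y are isotropic, then h (a x + y) (a x + y) is the trace of
  -- a h(x , y), and ω has trace 1.
  unit-vector : ∀ x y → h x y ≢ 0# → (f : V → Vec F₄ n) → (∀ u v → f (u ⊕ v) ≡ f u ⊕ f v) →
                (∀ a u → f (a · u) ≡ a · f u) → f x ≡ 𝟎 → f y ≡ 𝟎 → ∃ λ v → h v v ≡ 1# × f v ≡ 𝟎
  unit-vector {n} x y xy≢0 f f-⊕ f-· fx fy with self-0or1 x | self-0or1 y
  ... | inj₂ xx | _       = x , xx , fx
  ... | inj₁ xx | inj₂ yy = y , yy , fy
  ... | inj₁ xx | inj₁ yy = a · x ⊕ y , (begin
      h (a · x ⊕ y) (a · x ⊕ y)                         ≡⟨ h-⊕ˡ (a · x) y (a · x ⊕ y) ⟩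
      h (a · x) (a · x ⊕ y) + h y (a · x ⊕ y)           ≡⟨ cong₂ _+_ (h-⊕ʳ (a · x) (a · x) y) (h-⊕ʳ y (a · x) y) ⟩
      (h (a · x) (a · x) + h (a · x) y) + (h y (a · x) + h y y)
        ≡⟨ cong₂ _+_ (cong₂ _+_ (trans (h-scale a a≢0 x x) xx) (h-·ˡ a x y))
                     (cong₂ _+_ (trans (conj-sym (a · x) y) (cong conj (h-·ˡ a x y))) yy) ⟩
      (0# + a * h x y) + (conj (a * h x y) + 0#)        ≡⟨ trace (h x y) xy≢0 ⟩
      1#                                                ∎) , (begin
      f (a · x ⊕ y)      ≡⟨ f-⊕ (a · x) y ⟩
      f (a · x) ⊕ f y    ≡⟨ cong₂ _⊕_ (trans (f-· a x) (trans (cong (a ·_) fx) (·-zeroʳ n a))) fy ⟩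
      𝟎 ⊕ 𝟎              ≡⟨ ⊕-self 𝟎 ⟩
      𝟎                  ∎)
    where
    a = ω * conj (h x y)
    a≢0 : a ≢ 0#
    a≢0 = *-nonzero ω (conj (h x y)) (λ ()) (conj-nonzero (h x y) xy≢0)
    trace : ∀ t → t ≢ 0# → (0# + (ω * conj t) * t) + (conj ((ω * conj t) * t) + 0#) ≡ 1#
    trace = decide (∀? λ t → ¬? (t ≟ 0#) →-dec (_ ≟ _))

  module _ (nondegenerate : S₄.Nondegenerate h) where

    opaque
      non-orthogonal : ∀ x → x ≢ 𝟎 → ∃ λ y → h x y ≢ 0#
      non-orthogonal x x≢𝟎 = ¬∀⇒∃¬ (λ y → h x y ≟ 0#) (x≢𝟎 ∘ nondegenerate x)

    -- A Gram-Schmidt step. As `n < 4`, some nonzero `x` is orthogonal to `b`, and it has a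
    -- non-orthogonal partner `y`. Removing from `y` its projection `p` to the span of `b` does not
    -- change the product with `x`. So the orthogonal complement of `b` contains two vectors with
    -- nonzero product, and therefore a unit vector.
    extend-orthonormal : n < 4 → (b : Vec V n) → Orthonormal b → ∃ λ v → Orthonormal (v ∷ b)
    extend-orthonormal {n} n<4 b orthonormal with nontrivial-kernel n<4 (coordinates b) (coordinates-⊕ b)
    ... | x , x≢𝟎 , x⊥b with non-orthogonal x x≢𝟎
    ... | y , xy≢0 =
        let v , unit , orthogonal =
              unit-vector x y′ xy′≢0 (coordinates b) (coordinates-⊕ b) (coordinates-· b) x⊥b y′⊥b
        in v , orthonormal-∷ b orthonormal v unit orthogonal
      where
      p y′ : V
      p = comb (coordinates b y) b
      y′ = y ⊕ p
      y′⊥b : coordinates b y′ ≡ 𝟎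
      y′⊥b = trans (coordinates-⊕ b y p)
        (trans (cong (coordinates b y ⊕_) (orthonormal (coordinates b y))) (⊕-self (coordinates b y)))
      xy′≢0 : h x y′ ≢ 0#
      xy′≢0 eq = xy≢0 (begin
        h x y            ≡⟨ +-identityʳ (h x y) ⟨
        h x y + 0#       ≡⟨ cong (h x y +_) (h-sym-zero p x (orthogonal-comb b x x⊥b (coordinates b y))) ⟨
        h x y + h x p    ≡⟨ h-⊕ʳ x y p ⟨
        h x y′           ≡⟨ eq ⟩
        0#               ∎)

    orthonormal-basis : ∃ λ (b : Vec V 4) → Orthonormal b
    orthonormal-basis =
      let v₁ , o₁ = extend-orthonormal (s≤s z≤n) [] (λ { [] → refl })
          v₂ , o₂ = extend-orthonormal (s≤s (s≤s z≤n)) (v₁ ∷ []) o₁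
          v₃ , o₃ = extend-orthonormal (s≤s (s≤s (s≤s z≤n))) (v₂ ∷ v₁ ∷ []) o₂
          v₄ , o₄ = extend-orthonormal (s≤s (s≤s (s≤s (s≤s z≤n)))) (v₃ ∷ v₂ ∷ v₁ ∷ []) o₃
      in v₄ ∷ v₃ ∷ v₂ ∷ v₁ ∷ [] , o₄

-- Points of PG(3,4)

-- In the last clause `a` is the first nonzero coordinate and `conj a` its inverse, so that
-- coordinate becomes 1.
normalise : Vec F₄ n → Vec F₄ n
normalise []                    = []
normalise ((false +ω false) ∷ x) = 0# ∷ normalise x
normalise (a ∷ x)               = conj a · (a ∷ x)

normalise-nonzero : ∀ {a} → a ≢ 0# → (x : Vec F₄ n) → normalise (a ∷ x) ≡ conj a · (a ∷ x)
normalise-nonzero {a = false +ω false} a≢0 x = contradiction refl a≢0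
normalise-nonzero {a = false +ω true}  a≢0 x = refl
normalise-nonzero {a = true +ω _}      a≢0 x = refl

normalise-multiple : (x : Vec F₄ n) → ∃ λ a → a ≢ 0# × normalise x ≡ a · x
normalise-multiple []      = 1# , 1≢0 , refl
normalise-multiple (b ∷ x) with b ≟ 0#
... | no b≢0   = conj b , conj-nonzero b b≢0 , normalise-nonzero b≢0 x
... | yes refl with normalise-multiple x
...   | a , a≢0 , eq = a , a≢0 , cong₂ _∷_ (sym (*-zeroʳ a)) eq

normalise-· : ∀ a → a ≢ 0# → (x : Vec F₄ n) → normalise (a · x) ≡ normalise x
normalise-· a a≢0 []      = refl
normalise-· a a≢0 (b ∷ x) with b ≟ 0#
... | yes refl = trans (cong (λ c → normalise (c ∷ a · x)) (*-zeroʳ a)) (cong (0# ∷_) (normalise-· a a≢0 x))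
... | no b≢0 = begin
  normalise (a · (b ∷ x))         ≡⟨ normalise-nonzero (*-nonzero a b a≢0 b≢0) (a · x) ⟩
  conj (a * b) · (a · (b ∷ x))    ≡⟨ ·-assoc (conj (a * b)) a (b ∷ x) ⟩
  (conj (a * b) * a) · (b ∷ x)    ≡⟨ cong (_· (b ∷ x)) (cancel a b a≢0) ⟩
  conj b · (b ∷ x)                ≡⟨ normalise-nonzero b≢0 x ⟨
  normalise (b ∷ x)               ∎
  where
  open ≡-Reasoning
  cancel : ∀ a b → a ≢ 0# → conj (a * b) * a ≡ conj b
  cancel = decide (∀? λ a → ∀? λ b → ¬? (a ≟ 0#) →-dec (_ ≟ _))

normalise-∈ : (x : Vec F₄ n) → x ≢ 𝟎 → normalise x ∈ Enumeration.normalised n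
normalise-∈ []      x≢𝟎 = contradiction refl x≢𝟎
normalise-∈ (a ∷ x) x≢𝟎 with a ≟ 0#
... | yes refl = ∈-++⁺ʳ _ (∈-map⁺ (0# ∷_) (normalise-∈ x (x≢𝟎 ∘ cong (0# ∷_))))
... | no a≢0 = subst (_∈ _) (sym (trans (normalise-nonzero a≢0 x) (cong (_∷ conj a · x) (conj-inverse a a≢0))))
                     (∈-++⁺ˡ (∈-map⁺ (1# ∷_) (∈-vectors (conj a · x))))
  where
  ∈-vectors : ∀ {n} (x : Vec F₄ n) → x ∈ Enumeration.vectors n
  ∈-vectors []      = here refl
  ∈-vectors (a ∷ x) = ∈-cartesianProductWith⁺ _∷_ (Finite.complete finite-F₄ a) (∈-vectors x)

normalise-normalised : ∀ {x} → x ∈ Enumeration.normalised 4 → normalise x ≡ x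
normalise-normalised = All.lookup (decide (All.all? (λ x → normalise x ≟ᵥ x) (Enumeration.normalised 4)))

normalised-nonzero : ∀ {x} → x ∈ Enumeration.normalised 4 → x ≢ 𝟎
normalised-nonzero = All.lookup (decide (All.all? (λ x → ¬? (x ≟ᵥ 𝟎)) (Enumeration.normalised 4)))

module _ {A : Set} where

  lookup-fromList-∈ : (xs : List A) (i : Fin (length xs)) → Vec.lookup (Vec.fromList xs) i ∈ xs
  lookup-fromList-∈ (x ∷ xs) zero    = here refl
  lookup-fromList-∈ (x ∷ xs) (suc i) = there (lookup-fromList-∈ xs i)

  lookup-fromList-surjective : (xs : List A) → ∀ {x} → x ∈ xs → ∃ λ i → Vec.lookup (Vec.fromList xs) i ≡ x
  lookup-fromList-surjective (x ∷ xs) (here refl) = zero , refl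
  lookup-fromList-surjective (x ∷ xs) (there x∈) =
    let i , eq = lookup-fromList-surjective xs x∈ in suc i , eq

  lookup-fromList-injective : (xs : List A) → Unique xs → ∀ i j →
                              Vec.lookup (Vec.fromList xs) i ≡ Vec.lookup (Vec.fromList xs) j → i ≡ j
  lookup-fromList-injective (x ∷ xs) (x∉xs ∷ u) zero    zero    eq = refl
  lookup-fromList-injective (x ∷ xs) (x∉xs ∷ u) zero    (suc j) eq =
    contradiction eq (All.lookup x∉xs (lookup-fromList-∈ xs j))
  lookup-fromList-injective (x ∷ xs) (x∉xs ∷ u) (suc i) zero    eq =
    contradiction (sym eq) (All.lookup x∉xs (lookup-fromList-∈ xs i))
  lookup-fromList-injective (x ∷ xs) (x∉xs ∷ u) (suc i) (suc j) eq =
    cong suc (lookup-fromList-injective xs u i j eq)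

opaque
  representative-∈ : ∀ P → representative P ∈ Enumeration.normalised 4
  representative-∈ = lookup-fromList-∈ (Enumeration.normalised 4)

  representative-surjective : ∀ {x} → x ∈ Enumeration.normalised 4 → ∃ λ P → representative P ≡ x
  representative-surjective = lookup-fromList-surjective (Enumeration.normalised 4)

  representative-injective : ∀ P Q → representative P ≡ representative Q → P ≡ Q
  representative-injective = lookup-fromList-injective (Enumeration.normalised 4)
    (decide (unique? _≟ᵥ_ (Enumeration.normalised 4)))

representative-nonzero : ∀ P → representative P ≢ 𝟎
representative-nonzero P = normalised-nonzero (representative-∈ P)

normalise-≡⇒multiple : {x y : Vec F₄ n} → normalise x ≡ normalise y → ∃ λ c → c ≢ 0# × x ≡ c · y
normalise-≡⇒multiple {x = x} {y} eq with normalise-multiple x | normalise-multiple y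
... | a , a≢0 , eqx | b , b≢0 , eqy = conj a * b , *-nonzero (conj a) b (conj-nonzero a a≢0) b≢0 , (begin
  x                 ≡⟨ ·-inverse a≢0 x ⟨
  conj a · (a · x)  ≡⟨ cong (conj a ·_) (trans (sym eqx) (trans eq eqy)) ⟩
  conj a · (b · y)  ≡⟨ ·-assoc (conj a) b y ⟩
  (conj a * b) · y  ∎)
  where open ≡-Reasoning

representative-represents : ∀ P → representative P Represents P
representative-represents P = 1# , 1≢0 , sym (·-identity (representative P))

represents⇒normalise : ∀ v P → v Represents P → normalise v ≡ representative P
represents⇒normalise _ P (a , a≢0 , refl) =
  trans (normalise-· a a≢0 (representative P)) (normalise-normalised (representative-∈ P))

represents-unique : ∀ v P Q → v Represents P → v Represents Q → P ≡ Q
represents-unique v P Q vP vQ =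
  representative-injective P Q (trans (sym (represents⇒normalise v P vP)) (represents⇒normalise v Q vQ))

point : ∀ {v} → v ≢ 𝟎 → ∃ λ P → v Represents P
point {v} v≢𝟎 =
  let P , eq = representative-surjective (normalise-∈ v v≢𝟎)
      a , a≢0 , eq′ = normalise-multiple v
  in P , conj a , conj-nonzero a a≢0 , sym (trans (cong (conj a ·_) (trans eq eq′)) (·-inverse a≢0 v))

digit : F₄ → ℕ
digit (false +ω false) = 0
digit (true +ω false)  = 1
digit (false +ω true)  = 2
digit (true +ω true)   = 3

-- A base 4 numeral, least significant digit first. Natural numbers are cheap to compare, which
-- matters when the intersections of all pairs of ovoids are evaluated.
code : Vec F₄ n → ℕ
code []      = 0
code (a ∷ x) = digit a ℕ.+ 4 ℕ.* code x

opaque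
  code-injective : ∀ (x y : V) → code x ≡ code y → x ≡ y
  code-injective x y eq = trans (sym (decode-code x)) (trans (cong (decode 4) eq) (decode-code y))
    where
    undigit : ℕ → F₄
    undigit 0 = false +ω false
    undigit 1 = true +ω false
    undigit 2 = false +ω true
    undigit _ = true +ω true
    decode : ∀ n → ℕ → Vec F₄ n
    decode zero    i = []
    decode (suc n) i = undigit (i % 4) ∷ decode n (i / 4)
    decode-code : ∀ (x : V) → decode 4 (code x) ≡ x
    decode-code = decide (∀? λ x → _ ≟ᵥ _)

pointCode : V → ℕ
pointCode x = code (normalise x)

pointCode-· : ∀ {a} → a ≢ 0# → ∀ x → pointCode (a · x) ≡ pointCode x
pointCode-· a≢0 x = cong code (normalise-· _ a≢0 x)

pointCode-≡⇒multiple : ∀ {x y} → pointCode x ≡ pointCode y → ∃ λ c → c ≢ 0# × x ≡ c · y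
pointCode-≡⇒multiple {x} {y} eq = normalise-≡⇒multiple (code-injective (normalise x) (normalise y) eq)

-- The vectors of a frame are scaled so that their products are 1.
record IsFrame (h : S₄.Form) (bs : List V) : Set where
  field
    five      : length bs ≡ 5
    unique    : Unique bs
    isotropic : ∀ {x} → x ∈ bs → h x x ≡ 0#
    products  : ∀ {x y} → x ∈ bs → y ∈ bs → x ≢ y → h x y ≡ 1#

Quadrangle : List V → Pred V 0ℓ
Quadrangle bs x = x ∈ bs ⊎ ∃[ y ] ∃[ z ] y ∈ bs × z ∈ bs × y ≢ z × x ≡ y ⊕ z

opaque
  -- In characteristic 2 the sums that vanish are exactly the `x ⊕ x`, so the filter removes the
  -- diagonal. A sum of two different vectors still occurs in both orders; `codes` removes such
  -- repetitions.
  sums : List V → List V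
  sums bs = filter (λ x → ¬? (x ≟ᵥ 𝟎)) (cartesianProductWith _⊕_ bs bs)

  quadrangle : List V → List V
  quadrangle bs = bs ++ sums bs

  ∈-quadrangle⁻ : ∀ {bs x} → x ∈ quadrangle bs → Quadrangle bs x
  ∈-quadrangle⁻ {bs} x∈ with ∈-++⁻ bs x∈
  ... | inj₁ x∈bs = inj₁ x∈bs
  ... | inj₂ x∈sums with ∈-filter⁻ (λ x → ¬? (x ≟ᵥ 𝟎)) {xs = cartesianProductWith _⊕_ bs bs} x∈sums
  ...   | x∈prod , x≢𝟎 with ∈-cartesianProductWith⁻ _⊕_ bs bs x∈prod
  ...     | y , z , y∈ , z∈ , refl = inj₂ (y , z , y∈ , z∈ , (λ { refl → x≢𝟎 (⊕-self y) }) , refl)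

  ∈-quadrangle⁺ : ∀ {bs x} → Quadrangle bs x → x ∈ quadrangle bs
  ∈-quadrangle⁺ (inj₁ x∈) = ∈-++⁺ˡ x∈
  ∈-quadrangle⁺ {bs} (inj₂ (y , z , y∈ , z∈ , y≢z , refl)) =
    ∈-++⁺ʳ bs (∈-filter⁺ (λ x → ¬? (x ≟ᵥ 𝟎)) (∈-cartesianProductWith⁺ _⊕_ y∈ z∈) (y≢z ∘ ⊕≡𝟎⇒≡))

Spanned : List V → Pred Point 0ℓ
Spanned xs P = ∃ λ x → x ∈ xs × x Represents P

FrameOf : S₄.Form → PointSet → PointSet → Set
FrameOf h E W = ∃ λ bs → IsFrame h bs × (Subset._∈ E) ≐ Spanned bs × (Subset._∈ W) ≐ Spanned (quadrangle bs)

module _ (h : S₄.Form) (hermitian : IsHermitian h) where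
  open Hermitian h hermitian

  -- The zero vector would have product 0, not 1, with another vector of the frame.
  frame-nonzero : ∀ {bs x} → IsFrame h bs → x ∈ bs → x ≢ 𝟎
  frame-nonzero {x ∷ []} record { five = () } x∈
  frame-nonzero {x₁ ∷ x₂ ∷ bs} frame x∈ refl with frame .IsFrame.unique
  ... | (x₁≢x₂ ∷ _) ∷ _ with x₁ ≟ᵥ 𝟎
  ...   | yes refl = contradiction (trans (sym (h-𝟎ˡ x₂)) (IsFrame.products frame x∈ (there (here refl)) x₁≢x₂)) λ ()
  ...   | no x₁≢𝟎 = contradiction (trans (sym (h-𝟎ˡ x₁)) (IsFrame.products frame x∈ (here refl) (x₁≢𝟎 ∘ sym))) λ ()

  quadrangle-nonzero : ∀ {bs x} → IsFrame h bs → x ∈ quadrangle bs → x ≢ 𝟎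
  quadrangle-nonzero frame x∈ with ∈-quadrangle⁻ x∈
  ... | inj₁ x∈bs = frame-nonzero frame x∈bs
  ... | inj₂ (y , z , _ , _ , y≢z , refl) = y≢z ∘ ⊕≡𝟎⇒≡

-- Coordinates that turn `h` into the standard Hermitian form

⟪_,_⟫ : V → V → F₄
⟪ x , y ⟫ = dot x (conjᵥ y)

⟪⟫-hermitian : IsHermitian ⟪_,_⟫
⟪⟫-hermitian = record
  { +-linearˡ = λ x y z → dot-⊕ˡ x y (conjᵥ z)
  ; ·-linearˡ = λ a x y → dot-·ˡ a x (conjᵥ y)
  ; conj-sym  = λ x y → sym (trans (conj-dot x (conjᵥ y))
                  (trans (cong (dot (conjᵥ x)) (conjᵥ-conjᵥ y)) (dot-comm (conjᵥ x) y)))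
  }

module Model (h : S₄.Form) (hermitian : IsHermitian h) (β : Vec V 4)
             (orthonormal : Hermitian.Orthonormal h hermitian β) where
  open Hermitian h hermitian
  open ≡-Reasoning

  φ φ⁻¹ : V → V
  φ = coordinates β
  φ⁻¹ c = comb c β

  φ-φ⁻¹ : ∀ c → φ (φ⁻¹ c) ≡ c
  φ-φ⁻¹ = orthonormal

  φ-𝟎 : φ 𝟎 ≡ 𝟎
  φ-𝟎 = trans (cong φ (sym (comb-𝟎 β))) (φ-φ⁻¹ 𝟎)

  φ⁻¹-φ : ∀ v → φ⁻¹ (φ v) ≡ v
  φ⁻¹-φ v with independent⇒spanning β (λ c eq → trans (sym (φ-φ⁻¹ c)) (trans (cong φ eq) φ-𝟎)) v
  ... | c , refl = cong φ⁻¹ (φ-φ⁻¹ c)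

  φ-injective : ∀ {u v} → φ u ≡ φ v → u ≡ v
  φ-injective {u} {v} eq = trans (sym (φ⁻¹-φ u)) (trans (cong φ⁻¹ eq) (φ⁻¹-φ v))

  φ-isometry : ∀ u v → ⟪ φ u , φ v ⟫ ≡ h u v
  φ-isometry u v = trans (sym (h-comb-conj (φ u) β v)) (cong (λ w → h w v) (φ⁻¹-φ u))

  φ⁻¹-isometry : ∀ c d → h (φ⁻¹ c) (φ⁻¹ d) ≡ ⟪ c , d ⟫
  φ⁻¹-isometry c d = trans (sym (φ-isometry (φ⁻¹ c) (φ⁻¹ d))) (cong₂ ⟪_,_⟫ (φ-φ⁻¹ c) (φ-φ⁻¹ d))

  -- The numbering in `Point` refers to the original coordinates, while frames are enumerated in
  -- orthonormal ones. `γ` names a point by its code in the latter.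
  γ : Point → ℕ
  γ P = pointCode (φ (representative P))

  represents⇒γ : ∀ v P → v Represents P → pointCode (φ v) ≡ γ P
  represents⇒γ _ P (a , a≢0 , refl) =
    trans (cong pointCode (coordinates-· β a (representative P))) (pointCode-· a≢0 (φ (representative P)))

  γ⇒represents : ∀ v P → pointCode (φ v) ≡ γ P → v Represents P
  γ⇒represents v P eq =
    let c , c≢0 , eq′ = pointCode-≡⇒multiple eq
    in c , c≢0 , φ-injective (trans eq′ (sym (coordinates-· β c (representative P))))

  γ-injective : ∀ P Q → γ P ≡ γ Q → P ≡ Q
  γ-injective P Q eq =
    represents-unique (representative P) P Q (representative-represents P) (γ⇒represents (representative P) Q eq)

-- Quadrics of PG(3,2)

ι-⊕ : ∀ {n} (x y : Vec Bool n) → Vec.map ι (Vec.zipWith _xor_ x y) ≡ Vec.map ι x ⊕ Vec.map ι y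
ι-⊕ []      []      = refl
ι-⊕ (a ∷ x) (b ∷ y) = cong (_ ∷_) (ι-⊕ x y)

ι-injective : ∀ {n} (x y : Vec Bool n) → Vec.map ι x ≡ Vec.map ι y → x ≡ y
ι-injective []      []      eq = refl
ι-injective (a ∷ x) (b ∷ y) eq = cong₂ _∷_ (cong (F₄.const ∘ Vec.head) eq) (ι-injective x y (cong Vec.tail eq))

conj-fixed⇒ι : ∀ {n} (x : Vec F₄ n) → conjᵥ x ≡ x → Vec.map ι (Vec.map F₄.const x) ≡ x
conj-fixed⇒ι []      eq = refl
conj-fixed⇒ι (a ∷ x) eq = cong₂ _∷_ (scalar a (cong Vec.head eq)) (conj-fixed⇒ι x (cong Vec.tail eq))
  where
  scalar : ∀ a → conj a ≡ a → ι (F₄.const a) ≡ a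
  scalar = decide (∀? λ a → (_ ≟ _) →-dec (_ ≟ _))

conjᵥ-ι : ∀ {n} (x : Vec Bool n) → conjᵥ (Vec.map ι x) ≡ Vec.map ι x
conjᵥ-ι []      = refl
conjᵥ-ι (a ∷ x) = cong₂ _∷_ (scalar a) (conjᵥ-ι x)
  where
  scalar : ∀ a → conj (ι a) ≡ ι a
  scalar = decide (∀? λ a → _ ≟ _)

span-first : ∀ x y → x ≡ true S₂.· x S₂.⊕ false S₂.· y
span-first = decide (∀? λ x → ∀? λ y → _ ≟₂ _)

span-second : ∀ x y → y ≡ false S₂.· x S₂.⊕ true S₂.· y
span-second = decide (∀? λ x → ∀? λ y → _ ≟₂ _)

-- On the span of `x` and `y` an alternating form is the determinant of the coefficients times
-- `f x y`.
isotropic-line : ∀ {f} → S₂.IsAlternating f → ∀ x y → S₂.TotallyIsotropic f S₂.⟨ x , y ⟩ ⇔ f x y ≡ false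
isotropic-line {f} (bilinear , alternating) x y = mk⇔
  (λ isotropic → isotropic (true , false , span-first x y) (false , true , span-second x y))
  (λ { xy {u} (a , b , refl) (c , d , refl) → begin
    f (a S₂.· x S₂.⊕ b S₂.· y) (c S₂.· x S₂.⊕ d S₂.· y)  ≡⟨ expandˡ a b _ ⟩
    (a ∧ f x _) xor (b ∧ f y _)
      ≡⟨ cong₂ (λ s t → (a ∧ s) xor (b ∧ t)) (expandʳ x c d) (expandʳ y c d) ⟩
    (a ∧ ((c ∧ f x x) xor (d ∧ f x y))) xor (b ∧ ((c ∧ f y x) xor (d ∧ f y y)))
      ≡⟨ cong₂ (λ s t → (a ∧ ((c ∧ s) xor (d ∧ f x y))) xor (b ∧ ((c ∧ f y x) xor (d ∧ t)))) (alternating x) (alternating y) ⟩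
    (a ∧ ((c ∧ false) xor (d ∧ f x y))) xor (b ∧ ((c ∧ f y x) xor (d ∧ false)))
      ≡⟨ cong₂ (λ s t → (a ∧ ((c ∧ false) xor (d ∧ s))) xor (b ∧ ((c ∧ t) xor (d ∧ false)))) xy (trans (symmetric xy) xy) ⟩
    (a ∧ ((c ∧ false) xor (d ∧ false))) xor (b ∧ ((c ∧ false) xor (d ∧ false))) ≡⟨ vanish a b c d ⟩
    false ∎ })
  where
  open S₂.IsBilinear bilinear
  open ≡-Reasoning
  expandˡ : ∀ a b v → f (a S₂.· x S₂.⊕ b S₂.· y) v ≡ (a ∧ f x v) xor (b ∧ f y v)
  expandˡ a b v = trans (+-linearˡ _ _ v) (cong₂ _xor_ (·-linearˡ a x v) (·-linearˡ b y v))
  expandʳ : ∀ u c d → f u (c S₂.· x S₂.⊕ d S₂.· y) ≡ (c ∧ f u x) xor (d ∧ f u y)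
  expandʳ u c d = trans (+-linearʳ u _ _) (cong₂ _xor_ (·-linearʳ c u x) (·-linearʳ d u y))
  cancel : ∀ s t → (false xor s) xor (t xor false) ≡ false → t ≡ s
  cancel = decide (∀? λ s → ∀? λ t → (_ 𝔹.≟ _) →-dec (_ 𝔹.≟ _))
  symmetric : f x y ≡ false → f y x ≡ f x y
  symmetric _ = cancel (f x y) (f y x) (begin
    (false xor f x y) xor (f y x xor false)
      ≡⟨ cong₂ (λ s t → (s xor f x y) xor (f y x xor t)) (alternating x) (alternating y) ⟨
    (f x x xor f x y) xor (f y x xor f y y)  ≡⟨ cong₂ _xor_ (+-linearʳ x x y) (+-linearʳ y x y) ⟨
    f x (x S₂.⊕ y) xor f y (x S₂.⊕ y)        ≡⟨ +-linearˡ x y (x S₂.⊕ y) ⟨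
    f (x S₂.⊕ y) (x S₂.⊕ y)                  ≡⟨ alternating (x S₂.⊕ y) ⟩
    false ∎)
  vanish : ∀ a b c d → (a ∧ ((c ∧ false) xor (d ∧ false))) xor (b ∧ ((c ∧ false) xor (d ∧ false))) ≡ false
  vanish = decide (∀? λ a → ∀? λ b → ∀? λ c → ∀? λ d → _ 𝔹.≟ _)

span? : ∀ x y z → Dec (S₂.⟨ x , y ⟩ z)
span? x y z = ∃? λ a → ∃? λ b → _ ≟₂ _

-- The second elementary symmetric polynomial. At a vector of weight `w` its value is the parity of
-- `w` choose 2, so its nonzero zeros are the vectors of weight 1 and 4, which `frame₀` lists.
Q₀ : S₂.V → Bool
Q₀ (a ∷ b ∷ c ∷ d ∷ []) = (a ∧ (b xor (c xor d))) xor ((b ∧ (c xor d)) xor (c ∧ d))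

form₀ : S₂.Form
form₀ = S₂.polarForm Q₀

opaque
  bilinear₀ : S₂.IsBilinear form₀
  bilinear₀ = record
    { +-linearˡ = decide (∀? λ x → ∀? λ y → ∀? λ z → _ 𝔹.≟ _)
    ; +-linearʳ = decide (∀? λ x → ∀? λ y → ∀? λ z → _ 𝔹.≟ _)
    ; ·-linearˡ = decide (∀? λ a → ∀? λ x → ∀? λ y → _ 𝔹.≟ _)
    ; ·-linearʳ = decide (∀? λ a → ∀? λ x → ∀? λ y → _ 𝔹.≟ _)
    }

  nondegenerate₀ : S₂.Nondegenerate form₀
  nondegenerate₀ = decide (∀? λ x → (∀? λ y → _ 𝔹.≟ _) →-dec (_ ≟₂ _))

  alternating₀ : S₂.IsAlternating form₀
  alternating₀ = bilinear₀ , decide (∀? λ x → _ 𝔹.≟ _)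

  elliptic₀ : PG₂.IsElliptic Q₀
  elliptic₀ = record
    { quadratic   = decide (∀? λ a → ∀? λ x → _ 𝔹.≟ _) , bilinear₀
    ; nonsingular = nondegenerate₀
    ; noLine      = λ x y x≢𝟎 y≢𝟎 x≢y line → singular x y x≢𝟎 y≢𝟎 x≢y λ z → line {z}
    }
    where
    singular : ∀ x y → x ≢ S₂.𝟎 → y ≢ S₂.𝟎 → x ≢ y → ¬ (∀ z → S₂.⟨ x , y ⟩ z → Q₀ z ≡ false)
    singular = decide (∀? λ x → ∀? λ y → ¬? (x ≟₂ _) →-dec (¬? (y ≟₂ _) →-dec (¬? (x ≟₂ y) →-dec
      ¬? (∀? λ z → span? x y z →-dec (Q₀ z 𝔹.≟ false)))))

  -- With `form₀ x y` in place of the total isotropy of the line, this is a finite check;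
  -- `isotropic-line` translates.
  tangents₀ : PG₂.ForAllLines λ x y → PG₂.Tangent Q₀ x y ⇔ form₀ x y ≡ false
  tangents₀ x y x≢𝟎 y≢𝟎 x≢y = let to , from = dec x y x≢𝟎 y≢𝟎 x≢y in mk⇔ to from
    where
    tangent? : ∀ x y → Dec (PG₂.Tangent Q₀ x y)
    tangent? x y = ∃? λ z → zero? z ×-dec map′ (λ p {w} → p w) (λ p w → p {w}) (∀? λ w → zero? w →-dec (z ≟₂ w))
      where
      zero? : ∀ z → Dec (z ≢ S₂.𝟎 × S₂.⟨ x , y ⟩ z × Q₀ z ≡ false)
      zero? z = ¬? (z ≟₂ _) ×-dec (span? x y z ×-dec (Q₀ z 𝔹.≟ false))
    dec : ∀ x y → x ≢ S₂.𝟎 → y ≢ S₂.𝟎 → x ≢ y →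
          (PG₂.Tangent Q₀ x y → form₀ x y ≡ false) × (form₀ x y ≡ false → PG₂.Tangent Q₀ x y)
    dec = decide (∀? λ x → ∀? λ y → ¬? (x ≟₂ _) →-dec (¬? (y ≟₂ _) →-dec (¬? (x ≟₂ y) →-dec
      ((tangent? x y →-dec (_ 𝔹.≟ _)) ×-dec ((_ 𝔹.≟ _) →-dec tangent? x y)))))

frame₀ : List S₂.V
frame₀ = (true ∷ false ∷ false ∷ false ∷ []) ∷ (false ∷ true ∷ false ∷ false ∷ []) ∷
         (false ∷ false ∷ true ∷ false ∷ []) ∷ (false ∷ false ∷ false ∷ true ∷ []) ∷
         (true ∷ true ∷ true ∷ true ∷ []) ∷ []

module _ where
  open DecMembership {A = S₂.V} _≟₂_ using (_∈?_)

  opaque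
    zeros₀ : ∀ x → x ≢ S₂.𝟎 × Q₀ x ≡ false → x ∈ frame₀
    zeros₀ = decide (∀? λ x → (¬? (x ≟₂ _) ×-dec (_ 𝔹.≟ _)) →-dec (x ∈? frame₀))

    frame₀-zeros : ∀ x → x ∈ frame₀ → x ≢ S₂.𝟎 × Q₀ x ≡ false
    frame₀-zeros = decide (∀? λ x → (x ∈? frame₀) →-dec (¬? (x ≟₂ _) ×-dec (_ 𝔹.≟ _)))

    -- A vector of weight 2 is the sum of two unit vectors, one of weight 3 the sum of a unit vector
    -- and the all-one vector.
    points₀ : ∀ x → x ≢ S₂.𝟎 → x ∈ frame₀ ⊎ ∃[ y ] ∃[ z ] y ∈ frame₀ × z ∈ frame₀ × y ≢ z × x ≡ y S₂.⊕ z
    points₀ = decide (∀? λ x → ¬? (x ≟₂ _) →-dec ((x ∈? frame₀) ⊎-dec (∃? λ y → ∃? λ z →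
      (y ∈? frame₀) ×-dec ((z ∈? frame₀) ×-dec (¬? (y ≟₂ z) ×-dec (_ ≟₂ _))))))

    distinct-sum : ∀ x y → x ≢ y → x S₂.⊕ y ≢ S₂.𝟎
    distinct-sum = decide (∀? λ x → ∀? λ y → ¬? (x ≟₂ y) →-dec ¬? (_ ≟₂ _))

-- The Gram matrix of four vectors of a frame, which is its own inverse.
gram : Vec V 4
gram = (0# ∷ 1# ∷ 1# ∷ 1# ∷ []) ∷ (1# ∷ 0# ∷ 1# ∷ 1# ∷ []) ∷
       (1# ∷ 1# ∷ 0# ∷ 1# ∷ []) ∷ (1# ∷ 1# ∷ 1# ∷ 0# ∷ []) ∷ []

G : V → V
G x = Vec.map (dot x) gram

opaque
  G-⊕ : ∀ x y → G (x ⊕ y) ≡ G x ⊕ G y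
  G-⊕ x y = rows gram
    where
    rows : ∀ {n} (zs : Vec V n) → Vec.map (dot (x ⊕ y)) zs ≡ Vec.map (dot x) zs ⊕ Vec.map (dot y) zs
    rows []       = refl
    rows (z ∷ zs) = cong₂ _∷_ (dot-⊕ˡ x y z) (rows zs)

  G-· : ∀ a x → G (a · x) ≡ a · G x
  G-· a x = rows gram
    where
    rows : ∀ {n} (zs : Vec V n) → Vec.map (dot (a · x)) zs ≡ a · Vec.map (dot x) zs
    rows []       = refl
    rows (z ∷ zs) = cong₂ _∷_ (dot-·ˡ a x z) (rows zs)

  -- If `J` is the all-one matrix of size 4, then `gram` is `J + I`, and its square is
  -- `4J + 2J + I = I` in characteristic 2.
  G-G : ∀ x → G (G x) ≡ x
  G-G = decide (∀? λ x → _ ≟ᵥ _)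

  G-conj : ∀ x → G (conjᵥ x) ≡ conjᵥ (G x)
  G-conj = decide (∀? λ x → _ ≟ᵥ _)

  dot-G-self : ∀ x → dot (G x) x ≡ 0#
  dot-G-self = decide (∀? λ x → _ ≟ _)

  -- The polar form of `Q₀` has the Gram matrix of a frame. Hence `form₀` agrees on embedded vectors
  -- with the form `ext` constructed from a frame.
  form₀-dot : ∀ x y → ι (form₀ x y) ≡ dot (Vec.map ι x) (G (Vec.map ι y))
  form₀-dot = decide (∀? λ x → ∀? λ y → _ ≟ _)

conj-automorphism : IsRingIsomorphism F₄-rawRing F₄-rawRing conj
conj-automorphism = record
  { isRingMonomorphism = record
    { isRingHomomorphism = record
      { isSemiringHomomorphism = record
        { isNearSemiringHomomorphism = record
          { +-isMonoidHomomorphism = record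
            { isMagmaHomomorphism = record { isRelHomomorphism = record { cong = cong conj } ; homo = conj-+ }
            ; ε-homo = refl
            }
          ; *-homo = conj-*
          }
        ; 1#-homo = refl
        }
      ; -‿homo = λ _ → refl
      }
    ; injective = λ {x} {y} eq → trans (sym (conj-conj x)) (trans (cong conj eq) (conj-conj y))
    }
  ; surjective = λ y → conj y , λ { refl → conj-conj y }
  }

-- From a frame to an elliptic ovoid

module FromFrame (h : S₄.Form) (hermitian : IsHermitian h) (nondegenerate : S₄.Nondegenerate h)
                 (b₁ b₂ b₃ b₄ b₅ : V) (frame : IsFrame h (b₁ ∷ b₂ ∷ b₃ ∷ b₄ ∷ b₅ ∷ [])) where
  open Hermitian h hermitian
  open IsFrame frame
  open ≡-Reasoning

  bs : List V
  bs = b₁ ∷ b₂ ∷ b₃ ∷ b₄ ∷ b₅ ∷ []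

  b : Vec V 4
  b = b₁ ∷ b₂ ∷ b₃ ∷ b₄ ∷ []

  gram-rows : coordinates b b₁ ≡ (0# ∷ 1# ∷ 1# ∷ 1# ∷ []) × coordinates b b₂ ≡ (1# ∷ 0# ∷ 1# ∷ 1# ∷ []) ×
    coordinates b b₃ ≡ (1# ∷ 1# ∷ 0# ∷ 1# ∷ []) × coordinates b b₄ ≡ (1# ∷ 1# ∷ 1# ∷ 0# ∷ []) ×
    coordinates b b₅ ≡ (1# ∷ 1# ∷ 1# ∷ 1# ∷ [])
  gram-rows with unique
  ... | (n₁₂ ∷ n₁₃ ∷ n₁₄ ∷ n₁₅ ∷ []) ∷ (n₂₃ ∷ n₂₄ ∷ n₂₅ ∷ []) ∷ (n₃₄ ∷ n₃₅ ∷ []) ∷ (n₄₅ ∷ []) ∷ [] ∷ [] =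
      vec≡ (isotropic i₁) (products i₁ i₂ n₁₂) (products i₁ i₃ n₁₃) (products i₁ i₄ n₁₄)
    , vec≡ (products i₂ i₁ (n₁₂ ∘ sym)) (isotropic i₂) (products i₂ i₃ n₂₃) (products i₂ i₄ n₂₄)
    , vec≡ (products i₃ i₁ (n₁₃ ∘ sym)) (products i₃ i₂ (n₂₃ ∘ sym)) (isotropic i₃) (products i₃ i₄ n₃₄)
    , vec≡ (products i₄ i₁ (n₁₄ ∘ sym)) (products i₄ i₂ (n₂₄ ∘ sym)) (products i₄ i₃ (n₃₄ ∘ sym)) (isotropic i₄)
    , vec≡ (products i₅ i₁ (n₁₅ ∘ sym)) (products i₅ i₂ (n₂₅ ∘ sym)) (products i₅ i₃ (n₃₅ ∘ sym)) (products i₅ i₄ (n₄₅ ∘ sym))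
    where
    i₁ : b₁ ∈ bs
    i₁ = here refl
    i₂ : b₂ ∈ bs
    i₂ = there (here refl)
    i₃ : b₃ ∈ bs
    i₃ = there (there (here refl))
    i₄ : b₄ ∈ bs
    i₄ = there (there (there (here refl)))
    i₅ : b₅ ∈ bs
    i₅ = there (there (there (there (here refl))))
    vec≡ : ∀ {p q r s p′ q′ r′ s′ : F₄} → p ≡ p′ → q ≡ q′ → r ≡ r′ → s ≡ s′ →
           _≡_ {A = V} (p ∷ q ∷ r ∷ s ∷ []) (p′ ∷ q′ ∷ r′ ∷ s′ ∷ [])
    vec≡ refl refl refl refl = refl

  -- As `G` inverts the Gram matrix, `φ` recovers the coefficients with respect to `b` from the
  -- products with `b`. Then `s` conjugates these coefficients: it is the semilinear involution that
  -- fixes the GF(2)-span of `b`.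
  k φ s : V → V
  k = coordinates b
  φ = G ∘ k
  s v = comb (conjᵥ (φ v)) b

  -- The bilinear form with the same Gram matrix on `b` as `h`, because `k v` is `G (φ v)`.
  ext : S₄.Form
  ext u v = dot (φ u) (k v)

  k-comb : ∀ c → k (comb c b) ≡ G c
  k-comb c = let e₁ , e₂ , e₃ , e₄ , _ = gram-rows in
    cong₂ _∷_ (column b₁ e₁) (cong₂ _∷_ (column b₂ e₂) (cong₂ _∷_ (column b₃ e₃) (cong₂ _∷_ (column b₄ e₄) refl)))
    where
    column : ∀ y {x} → k y ≡ x → h (comb c b) y ≡ dot c (conjᵥ x)
    column y eq = trans (h-comb-conj c b y) (cong (dot c ∘ conjᵥ) eq)

  φ-comb : ∀ c → φ (comb c b) ≡ c
  φ-comb c = trans (cong G (k-comb c)) (G-G c)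

  φ-⊕ : ∀ u v → φ (u ⊕ v) ≡ φ u ⊕ φ v
  φ-⊕ u v = trans (cong G (coordinates-⊕ b u v)) (G-⊕ (k u) (k v))

  φ-· : ∀ a v → φ (a · v) ≡ a · φ v
  φ-· a v = trans (cong G (coordinates-· b a v)) (G-· a (k v))

  φ-𝟎 : φ 𝟎 ≡ 𝟎
  φ-𝟎 = trans (cong φ (sym (comb-𝟎 b))) (φ-comb 𝟎)

  independent : S₄.Independent b
  independent c eq = trans (sym (φ-comb c)) (trans (cong φ eq) φ-𝟎)

  comb-φ : ∀ v → comb (φ v) b ≡ v
  comb-φ v with independent⇒spanning b independent v
  ... | c , refl = cong (λ d → comb d b) (φ-comb c)

  φ-s : ∀ v → φ (s v) ≡ conjᵥ (φ v)
  φ-s v = φ-comb (conjᵥ (φ v))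

  k-s : ∀ v → k (s v) ≡ conjᵥ (k v)
  k-s v = begin
    k (s v)             ≡⟨ k-comb (conjᵥ (φ v)) ⟩
    G (conjᵥ (φ v))     ≡⟨ G-conj (φ v) ⟩
    conjᵥ (G (G (k v))) ≡⟨ cong conjᵥ (G-G (k v)) ⟩
    conjᵥ (k v)         ∎

  -- The Gram matrix on `b` has entries in GF(2), so the Hermitian and the bilinear form with this
  -- matrix differ only by conjugating the coefficients of the second argument. This identity is why
  -- the two polarities commute with product `σ`.
  h≡ext-s : ∀ u v → h u v ≡ ext u (s v)
  h≡ext-s u v = begin
    h u v                    ≡⟨ cong (λ w → h w v) (comb-φ u) ⟨
    h (comb (φ u) b) v       ≡⟨ h-comb-conj (φ u) b v ⟩
    dot (φ u) (conjᵥ (k v))  ≡⟨ cong (dot (φ u)) (k-s v) ⟨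
    ext u (s v)              ∎

  s-s : ∀ v → s (s v) ≡ v
  s-s v = trans (cong (λ c → comb c b) (trans (cong conjᵥ (φ-s v)) (conjᵥ-conjᵥ (φ v)))) (comb-φ v)

  s-⊕ : ∀ u v → s (u ⊕ v) ≡ s u ⊕ s v
  s-⊕ u v = trans (cong (λ c → comb c b) (trans (cong conjᵥ (φ-⊕ u v)) (conjᵥ-⊕ (φ u) (φ v))))
    (comb-⊕ (conjᵥ (φ u)) (conjᵥ (φ v)) b)

  s-· : ∀ a v → s (a · v) ≡ conj a · s v
  s-· a v = trans (cong (λ c → comb c b) (trans (cong conjᵥ (φ-· a v)) (conjᵥ-· a (φ v))))
    (comb-· (conj a) (conjᵥ (φ v)) b)

  s-𝟎 : s 𝟎 ≡ 𝟎
  s-𝟎 = trans (cong (λ c → comb c b) (cong conjᵥ φ-𝟎)) (comb-𝟎 b)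

  s-nonzero : ∀ v → v ≢ 𝟎 → s v ≢ 𝟎
  s-nonzero v v≢𝟎 eq = v≢𝟎 (trans (sym (s-s v)) (trans (cong s eq) s-𝟎))

  ext-⊕ˡ : ∀ u v w → ext (u ⊕ v) w ≡ ext u w + ext v w
  ext-⊕ˡ u v w = trans (cong (λ x → dot x (k w)) (φ-⊕ u v)) (dot-⊕ˡ (φ u) (φ v) (k w))

  ext-·ˡ : ∀ a u v → ext (a · u) v ≡ a * ext u v
  ext-·ˡ a u v = trans (cong (λ x → dot x (k v)) (φ-· a u)) (dot-·ˡ a (φ u) (k v))

  ext-⊕ʳ : ∀ u v w → ext u (v ⊕ w) ≡ ext u v + ext u w
  ext-⊕ʳ u v w = begin
    dot (φ u) (k (v ⊕ w))                ≡⟨ cong (dot (φ u)) (coordinates-⊕ b v w) ⟩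
    dot (φ u) (k v ⊕ k w)                ≡⟨ dot-comm (φ u) (k v ⊕ k w) ⟩
    dot (k v ⊕ k w) (φ u)                ≡⟨ dot-⊕ˡ (k v) (k w) (φ u) ⟩
    dot (k v) (φ u) + dot (k w) (φ u)    ≡⟨ cong₂ _+_ (dot-comm (k v) (φ u)) (dot-comm (k w) (φ u)) ⟩
    ext u v + ext u w                    ∎

  ext-·ʳ : ∀ a u v → ext u (a · v) ≡ a * ext u v
  ext-·ʳ a u v = begin
    dot (φ u) (k (a · v))  ≡⟨ cong (dot (φ u)) (coordinates-· b a v) ⟩
    dot (φ u) (a · k v)    ≡⟨ dot-comm (φ u) (a · k v) ⟩
    dot (a · k v) (φ u)    ≡⟨ dot-·ˡ a (k v) (φ u) ⟩
    a * dot (k v) (φ u)    ≡⟨ cong (a *_) (dot-comm (k v) (φ u)) ⟩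
    a * ext u v            ∎

  ext-self : ∀ v → ext v v ≡ 0#
  ext-self v = dot-G-self (k v)

  ext-𝟎ʳ : ∀ u → ext u 𝟎 ≡ 0#
  ext-𝟎ʳ u = trans (ext-·ʳ 0# u 𝟎) (*-zeroˡ (ext u 𝟎))

  ext-sym : ∀ u v → ext u v ≡ ext v u
  ext-sym u v = cancel (ext u v) (ext v u) (begin
    (0# + ext u v) + (ext v u + 0#)          ≡⟨ cong₂ (λ p q → (p + ext u v) + (ext v u + q)) (ext-self u) (ext-self v) ⟨
    (ext u u + ext u v) + (ext v u + ext v v) ≡⟨ cong₂ _+_ (ext-⊕ʳ u u v) (ext-⊕ʳ v u v) ⟨
    ext u (u ⊕ v) + ext v (u ⊕ v)            ≡⟨ ext-⊕ˡ u v (u ⊕ v) ⟨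
    ext (u ⊕ v) (u ⊕ v)                      ≡⟨ ext-self (u ⊕ v) ⟩
    0#                                       ∎)
    where
    cancel : ∀ p q → (0# + p) + (q + 0#) ≡ 0# → p ≡ q
    cancel = decide (∀? λ p → ∀? λ q → (_ ≟ _) →-dec (_ ≟ _))

  ext-nondegenerate : S₄.Nondegenerate ext
  ext-nondegenerate u orthogonal = nondegenerate u λ v → trans (h≡ext-s u v) (orthogonal (s v))

  opaque
    -- Functionals with nested kernels are proportional. Let `ext u v₀` be a nonzero `t`. Adding to
    -- `v` the multiple of `v₀` by `ext u v` over `t` gives a vector in the kernel of `ext u`, hence
    -- in that of `ext w`. So `w` and `c · u`, with `c` the quotient of `ext w v₀` by `t`, have
    -- equal products with every `v`.
    ext-kernel : ∀ u w → u ≢ 𝟎 → (∀ v → ext u v ≡ 0# → ext w v ≡ 0#) → ∃ λ c → w ≡ c · u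
    ext-kernel u w u≢𝟎 kernel = multiple (¬∀⇒∃¬ (λ v → ext u v ≟ 0#) (u≢𝟎 ∘ ext-nondegenerate u))
      where
      solve : ∀ p q r t → p + (t * r) * q ≡ p + (t * q) * r
      solve p q r t = cong (p +_) (trans (*-assoc t r q) (trans (cong (t *_) (*-comm r q)) (sym (*-assoc t q r))))
      vanish : ∀ p t → t ≢ 0# → p + (conj t * p) * t ≡ 0#
      vanish = decide (∀? λ p → ∀? λ t → ¬? (t ≟ 0#) →-dec (_ ≟ _))
      multiple : (∃ λ v → ext u v ≢ 0#) → ∃ λ c → w ≡ c · u
      multiple (v₀ , t≢0) = c , ⊕≡𝟎⇒≡ (ext-nondegenerate (w ⊕ c · u) λ v → begin
        ext (w ⊕ c · u) v                         ≡⟨ ext-⊕ˡ w (c · u) v ⟩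
        ext w v + ext (c · u) v                   ≡⟨ cong (ext w v +_) (ext-·ˡ c u v) ⟩
        ext w v + c * ext u v                     ≡⟨ solve (ext w v) (ext u v) (ext w v₀) (conj t) ⟩
        ext w v + (conj t * ext u v) * ext w v₀   ≡⟨ cong (ext w v +_) (ext-·ʳ (conj t * ext u v) w v₀) ⟨
        ext w v + ext w ((conj t * ext u v) · v₀) ≡⟨ ext-⊕ʳ w v ((conj t * ext u v) · v₀) ⟨
        ext w (v ⊕ (conj t * ext u v) · v₀)       ≡⟨ kernel _ (begin
          ext u (v ⊕ (conj t * ext u v) · v₀)        ≡⟨ ext-⊕ʳ u v ((conj t * ext u v) · v₀) ⟩
          ext u v + ext u ((conj t * ext u v) · v₀)  ≡⟨ cong (ext u v +_) (ext-·ʳ (conj t * ext u v) u v₀) ⟩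
          ext u v + (conj t * ext u v) * t           ≡⟨ vanish (ext u v) t t≢0 ⟩
          0#                                         ∎) ⟩
        0#                                        ∎)
        where
        t c : F₄
        t = ext u v₀
        c = conj t * ext w v₀

  -- Polars are sets of points, so membership in them speaks only of representatives. Homogeneity
  -- extends this to all nonzero vectors; the zero vector represents no point and is treated apart.
  vanishes-everywhere : ∀ {f g : S₄.Form} →
    (∀ a u v → f u (a · v) ≡ 0# → a ≢ 0# → f u v ≡ 0#) →
    (∀ a u v → g u v ≡ 0# → g u (a · v) ≡ 0#) → (∀ u → g u 𝟎 ≡ 0#) →
    ∀ u w → (∀ Q → f u (representative Q) ≡ 0# → g w (representative Q) ≡ 0#) →
    ∀ v → f u v ≡ 0# → g w v ≡ 0#
  vanishes-everywhere {f} {g} f-· g-· g-𝟎 u w points v fuv with v ≟ᵥ 𝟎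
  ... | yes refl = g-𝟎 w
  ... | no v≢𝟎 = let Q , a , a≢0 , v≡aq = point v≢𝟎
                     q = representative Q
                 in subst (λ v → g w v ≡ 0#) (sym v≡aq)
                      (g-· a w q (points Q (f-· a u q (subst (λ v → f u v ≡ 0#) v≡aq fuv) a≢0)))

  ext-pointwise : ∀ u w → (∀ Q → ext u (representative Q) ≡ 0# → ext w (representative Q) ≡ 0#) →
                  ∀ v → ext u v ≡ 0# → ext w v ≡ 0#
  ext-pointwise = vanishes-everywhere {ext} {ext}
    (λ a u v eq a≢0 → zero-product a (ext u v) a≢0 (trans (sym (ext-·ʳ a u v)) eq))
    (λ a u v eq → trans (ext-·ʳ a u v) (trans (cong (a *_) eq) (*-zeroʳ a)))
    ext-𝟎ʳ

  σ-point : ∀ P → ∃ λ R → s (representative P) Represents R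
  σ-point P = point (s-nonzero (representative P) (representative-nonzero P))

  σ : Point → Point
  σ P = proj₁ (σ-point P)

  s-represents-σ : ∀ P → s (representative P) Represents σ P
  s-represents-σ P = proj₂ (σ-point P)

  represents⇒σ : ∀ P R → s (representative P) Represents R → σ P ≡ R
  represents⇒σ P R = represents-unique (s (representative P)) (σ P) R (s-represents-σ P)

  multiple⇒nonzero : ∀ {c} {u v : V} → v ≢ 𝟎 → v ≡ c · u → c ≢ 0#
  multiple⇒nonzero {u = u} v≢𝟎 eq refl = v≢𝟎 (trans eq (·-zeroˡ u))

  ext-scaled : ∀ {a u v w} → a ≢ 0# → v ≡ a · w → ext u v ≡ 0# → ext u w ≡ 0#
  ext-scaled {a} {u} {w = w} a≢0 refl eq = zero-product a (ext u w) a≢0 (trans (sym (ext-·ʳ a u w)) eq)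

  h⊥⇒ext⊥ : ∀ u v → h u v ≡ 0# → ext v (s u) ≡ 0#
  h⊥⇒ext⊥ u v eq = trans (sym (h≡ext-s v u)) (h-sym-zero u v eq)

  ext⊥⇒h⊥ : ∀ u v → ext v (s u) ≡ 0# → h u v ≡ 0#
  ext⊥⇒h⊥ u v eq = h-sym-zero v u (trans (h≡ext-s v u) eq)

  -- Let `R` be in the double polar and `r` its representative. By `h≡ext-s` every vector that `ext`
  -- makes orthogonal to `p` is also orthogonal to `s r`. So `s r` is a multiple of `p`, and
  -- applying `s` shows that `s p` represents `R`.
  ⊥̃⊥≐σ : ∀ P → polar h (polar ext ｛ P ｝) ≐ ｛ σ P ｝
  ⊥̃⊥≐σ P = (λ {R} → to R) , λ {R} → from R
    where
    p : V
    p = representative P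
    to : ∀ R → polar h (polar ext ｛ P ｝) R → σ P ≡ R
    to R polar-R =
      let r = representative R
          c , sr≡cp = ext-kernel p (s r) (representative-nonzero P) (ext-pointwise p (s r) λ Q pq →
            trans (ext-sym (s r) (representative Q))
              (trans (sym (h≡ext-s (representative Q) r)) (polar-R {Q} λ { refl → pq })))
          c≢0 = multiple⇒nonzero (s-nonzero r (representative-nonzero R)) sr≡cp
      in represents⇒σ P R (c , c≢0 , (begin
        s p                 ≡⟨ ·-inverse′ c≢0 (s p) ⟨
        c · (conj c · s p)  ≡⟨ cong (c ·_) (s-· c p) ⟨
        c · s (c · p)       ≡⟨ cong (λ v → c · s v) sr≡cp ⟨
        c · s (s r)         ≡⟨ cong (c ·_) (s-s r) ⟩
        c · r               ∎))
    from : ∀ R → σ P ≡ R → polar h (polar ext ｛ P ｝) R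
    from R refl {Q} polar-Q =
      let q = representative Q
          a , a≢0 , sp≡ar = s-represents-σ P
      in trans (h≡ext-s q (representative R)) (ext-scaled {conj a} {q} {p} {s (representative (σ P))} (conj-nonzero a a≢0)
           (trans (sym (s-s p)) (trans (cong s sp≡ar) (s-· a (representative R))))
           (trans (ext-sym q p) (polar-Q refl)))

  ⊥⊥̃≐σ : ∀ P → polar ext (polar h ｛ P ｝) ≐ ｛ σ P ｝
  ⊥⊥̃≐σ P = (λ {R} → to R) , λ {R} → from R
    where
    p : V
    p = representative P
    to : ∀ R → polar ext (polar h ｛ P ｝) R → σ P ≡ R
    to R polar-R =
      let r = representative R
          c , r≡csp = ext-kernel (s p) r (s-nonzero p (representative-nonzero P)) (ext-pointwise (s p) r λ Q spq →
            trans (ext-sym r (representative Q))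
              (polar-R {Q} λ { refl → ext⊥⇒h⊥ p (representative Q) (trans (ext-sym (representative Q) (s p)) spq) }))
          c≢0 = multiple⇒nonzero (representative-nonzero R) r≡csp
      in represents⇒σ P R (conj c , conj-nonzero c c≢0 ,
           trans (sym (·-inverse c≢0 (s p))) (cong (conj c ·_) (sym r≡csp)))
    from : ∀ R → σ P ≡ R → polar ext (polar h ｛ P ｝) R
    from R refl {Q} polar-Q =
      let a , a≢0 , sp≡ar = s-represents-σ P
      in ext-scaled {a} {representative Q} {s p} {representative (σ P)} a≢0 sp≡ar
           (h⊥⇒ext⊥ p (representative Q) (polar-Q refl))

  σ-involutive : ∀ P → σ (σ P) ≡ P
  σ-involutive P =
    let p = representative P
        a , a≢0 , sp≡ar = s-represents-σ P
    in represents⇒σ (σ P) P (a , a≢0 , (begin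
         s (representative (σ P))                     ≡⟨ cong s (·-inverse a≢0 (representative (σ P))) ⟨
         s (conj a · (a · representative (σ P)))      ≡⟨ cong (λ v → s (conj a · v)) sp≡ar ⟨
         s (conj a · s p)                             ≡⟨ s-· (conj a) (s p) ⟩
         conj (conj a) · s (s p)                      ≡⟨ cong₂ _·_ (conj-conj a) (s-s p) ⟩
         a · p                                        ∎))

  W : SymplecticQuadrangle
  W = record
    { baer = record { basis = b ; independent = independent }
    ; form = form₀
    ; alternating = alternating₀
    ; nondegenerate = nondegenerate₀
    }

  open SymplecticQuadrangle W using (embed; image; points)

  φ-embed : ∀ x → φ (embed x) ≡ Vec.map ι x
  φ-embed x = φ-comb (Vec.map ι x)

  embed-⊕ : ∀ x y → embed (x S₂.⊕ y) ≡ embed x ⊕ embed y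
  embed-⊕ x y = trans (cong (λ c → comb c b) (ι-⊕ x y)) (comb-⊕ (Vec.map ι x) (Vec.map ι y) b)

  embed-injective : ∀ x y → embed x ≡ embed y → x ≡ y
  embed-injective x y eq = ι-injective x y (trans (sym (φ-embed x)) (trans (cong φ eq) (φ-embed y)))

  s-embed : ∀ x → s (embed x) ≡ embed x
  s-embed x = cong (λ c → comb c b) (trans (cong conjᵥ (φ-embed x)) (conjᵥ-ι x))

  -- A fixed point only gives `s p ≡ a · p`. The multiple `conj a · p` is a fixed vector, since `s`
  -- sends it to `a · (a · p)` and the square of `a` is `conj a`. Its coefficients are then fixed by
  -- conjugation and lie in GF(2).
  σ-fixed : (λ P → σ P ≡ P) ≐ points
  σ-fixed = (λ {P} → to P) , λ {P} → from P
    where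
    to : ∀ P → σ P ≡ P → points P
    to P σP≡P = x , (λ x≡𝟎 → v≢𝟎 (trans (sym embed-x) (trans (cong embed x≡𝟎) (comb-𝟎 b))))
                  , conj a , conj-nonzero a a≢0 , embed-x
      where
      p : V
      p = representative P
      sp : s p Represents P
      sp = subst (s p Represents_) σP≡P (s-represents-σ P)
      a : F₄
      a = proj₁ sp
      a≢0 : a ≢ 0#
      a≢0 = proj₁ (proj₂ sp)
      v : V
      v = conj a · p
      v≢𝟎 : v ≢ 𝟎
      v≢𝟎 = ·-nonzero (conj-nonzero a a≢0) (representative-nonzero P)
      square : ∀ a → conj (conj a) * a ≡ conj a
      square = decide (∀? λ a → _ ≟ _)
      s-v : s v ≡ v
      s-v = begin
        s (conj a · p)             ≡⟨ s-· (conj a) p ⟩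
        conj (conj a) · s p        ≡⟨ cong (conj (conj a) ·_) (proj₂ (proj₂ sp)) ⟩
        conj (conj a) · (a · p)    ≡⟨ ·-assoc (conj (conj a)) a p ⟩
        (conj (conj a) * a) · p    ≡⟨ cong (_· p) (square a) ⟩
        conj a · p                 ∎
      x : S₂.V
      x = Vec.map F₄.const (φ v)
      embed-x : embed x ≡ v
      embed-x = trans (cong (λ c → comb c b) (conj-fixed⇒ι (φ v) (trans (sym (φ-s v)) (cong φ s-v)))) (comb-φ v)
    from : ∀ P → points P → σ P ≡ P
    from P (x , _ , a , a≢0 , eq) =
      let p = representative P
          p≡ : p ≡ conj a · embed x
          p≡ = trans (sym (·-inverse a≢0 p)) (cong (conj a ·_) (sym eq))
      in represents⇒σ P P (a * a , *-nonzero a a a≢0 a≢0 , (begin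
           s p                          ≡⟨ cong s p≡ ⟩
           s (conj a · embed x)         ≡⟨ s-· (conj a) (embed x) ⟩
           conj (conj a) · s (embed x)  ≡⟨ cong₂ _·_ (conj-conj a) (s-embed x) ⟩
           a · embed x                  ≡⟨ cong (a ·_) eq ⟩
           a · (a · p)                  ≡⟨ ·-assoc a a p ⟩
           (a * a) · p                  ∎))

  isSymplecticSubquadrangle : IsSymplecticSubquadrangle h W
  isSymplecticSubquadrangle = record
    { extension = ext
    ; extension-alternating = record
      { +-linearˡ = ext-⊕ˡ ; +-linearʳ = ext-⊕ʳ ; ·-linearˡ = ext-·ˡ ; ·-linearʳ = ext-·ʳ } , ext-self
    ; extension-nondegenerate = ext-nondegenerate
    ; extends = λ x y → mk⇔
        (λ eq → trans (sym (ext-embed x y)) (cong ι eq))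
        (λ eq → cong F₄.const (trans (ext-embed x y) eq))
    ; σ = σ
    ; σ-involution = record
      { θ = conj
      ; θ-automorphism = conj-automorphism
      ; s = s
      ; s-additive = s-⊕
      ; s-semilinear = s-·
      ; s-induces-σ = s-represents-σ
      ; involutive = σ-involutive
      }
    ; ⊥̃⊥≐σ = ⊥̃⊥≐σ
    ; ⊥⊥̃≐σ = ⊥⊥̃≐σ
    ; σ-fixed = σ-fixed
    }
    where
    ext-embed : ∀ x y → ι (form₀ x y) ≡ ext (embed x) (embed y)
    ext-embed x y = trans (form₀-dot x y) (sym (cong₂ dot (φ-embed x) (k-comb (Vec.map ι y))))

  -- The fifth vector is forced. It has product 1 with each of the other four, and `G` fixes the
  -- all-one vector, so it is their sum.
  map-embed : List.map embed frame₀ ≡ bs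
  map-embed = let e₁ , e₂ , e₃ , e₄ , e₅ = gram-rows in
    cong₂ _∷_ (embedded b₁ e₁) (cong₂ _∷_ (embedded b₂ e₂) (cong₂ _∷_ (embedded b₃ e₃)
      (cong₂ _∷_ (embedded b₄ e₄) (cong₂ _∷_ (embedded b₅ e₅) refl))))
    where
    embedded : ∀ v {x} → k v ≡ x → comb (G x) b ≡ v
    embedded v refl = comb-φ v

  embed-∈ : ∀ x → x ∈ frame₀ → embed x ∈ bs
  embed-∈ x x∈ = subst (embed x ∈_) map-embed (∈-map⁺ embed x∈)

  ∈-embed : ∀ v → v ∈ bs → ∃ λ x → x ∈ frame₀ × v ≡ embed x
  ∈-embed v v∈ = ∈-map⁻ embed (subst (v ∈_) (sym map-embed) v∈)

  spanned-bs : ∀ P → Spanned bs P ⇔ image (λ x → x ≢ S₂.𝟎 × Q₀ x ≡ false) P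
  spanned-bs P = mk⇔
    (λ (v , v∈ , vP) → let x , x∈ , v≡ = ∈-embed v v∈ in x , frame₀-zeros x x∈ , subst (_Represents P) v≡ vP)
    (λ (x , x-zero , xP) → embed x , embed-∈ x (zeros₀ x x-zero) , xP)

  spanned-quadrangle : ∀ P → Spanned (quadrangle bs) P ⇔ points P
  spanned-quadrangle P = mk⇔ to from
    where
    to : Spanned (quadrangle bs) P → points P
    to (v , v∈ , vP) with ∈-quadrangle⁻ v∈
    ... | inj₁ v∈bs = let x , x∈ , v≡ = ∈-embed v v∈bs in x , proj₁ (frame₀-zeros x x∈) , subst (_Represents P) v≡ vP
    ... | inj₂ (v₁ , v₂ , v₁∈ , v₂∈ , v₁≢v₂ , refl) =
      let x , x∈ , v₁≡ = ∈-embed v₁ v₁∈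
          y , y∈ , v₂≡ = ∈-embed v₂ v₂∈
      in x S₂.⊕ y , distinct-sum x y (λ x≡y → v₁≢v₂ (trans v₁≡ (trans (cong embed x≡y) (sym v₂≡))))
         , subst (_Represents P) (trans (cong₂ _⊕_ v₁≡ v₂≡) (sym (embed-⊕ x y))) vP
    from : points P → Spanned (quadrangle bs) P
    from (x , x≢𝟎 , xP) = embed x , ∈-quadrangle⁺ (quad (points₀ x x≢𝟎)) , xP
      where
      quad : x ∈ frame₀ ⊎ ∃[ y ] ∃[ z ] y ∈ frame₀ × z ∈ frame₀ × y ≢ z × x ≡ y S₂.⊕ z → Quadrangle bs (embed x)
      quad (inj₁ x∈) = inj₁ (embed-∈ x x∈)
      quad (inj₂ (y , z , y∈ , z∈ , y≢z , refl)) =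
        inj₂ (embed y , embed z , embed-∈ y y∈ , embed-∈ z z∈ , y≢z ∘ embed-injective y z , embed-⊕ y z)

  ovoid : ∀ {E W′} → (Subset._∈ E) ≐ Spanned bs → (Subset._∈ W′) ≐ Spanned (quadrangle bs) → Γ.OvoidOf h E W′
  ovoid (E⊆ , E⊇) (W⊆ , W⊇) = W , isSymplecticSubquadrangle , record
    { Q = Q₀
    ; elliptic = elliptic₀
    ; zeros = (λ {P} P∈ → Equivalence.to (spanned-bs P) (E⊆ P∈)) , λ {P} P∈ → E⊇ (Equivalence.from (spanned-bs P) P∈)
    ; tangents = λ x y x≢𝟎 y≢𝟎 x≢y → ⇔-sym (isotropic-line alternating₀ x y) ⇔-∘ tangents₀ x y x≢𝟎 y≢𝟎 x≢y
    } , ( (λ {P} P∈ → Equivalence.to (spanned-quadrangle P) (W⊆ P∈))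
        , λ {P} P∈ → W⊇ (Equivalence.from (spanned-quadrangle P) P∈) )

frame⇒ovoid : (h : S₄.Form) → IsHermitian h → S₄.Nondegenerate h → ∀ {E W} → FrameOf h E W → Γ.OvoidOf h E W
frame⇒ovoid h hermitian nondegenerate
  (b₁ ∷ b₂ ∷ b₃ ∷ b₄ ∷ b₅ ∷ [] , frame@record { five = refl } , E≐ , W≐) =
  FromFrame.ovoid h hermitian nondegenerate b₁ b₂ b₃ b₄ b₅ frame E≐ W≐

-- The zeros of an arbitrary elliptic quadric

module _ (Q : S₂.V → Bool) where

  zero? : ∀ x → Dec (x ≢ S₂.𝟎 × Q x ≡ false)
  zero? x = ¬? (x ≟₂ S₂.𝟎) ×-dec (Q x 𝔹.≟ false)

  zeros : List S₂.V
  zeros = filter zero? (Finite.elements finite-Vec)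

  -- The third point of the line through `x` and `y` is `x ⊕ y`, so this is the absence of lines on
  -- the quadric in a form that can be checked by evaluation.
  NoSingularLine : Set
  NoSingularLine = ∀ x → x ≢ S₂.𝟎 × Q x ≡ false → ∀ y → y ≢ S₂.𝟎 × Q y ≡ false → x ≢ y → Q (x S₂.⊕ y) ≢ false

  FiveSpanningZeros : Set
  FiveSpanningZeros = length zeros ≡ 5 ×
    (∀ x → x ≢ S₂.𝟎 → x ∈ zeros ⊎ Any (λ y → Any (λ z → y ≢ z × x ≡ y S₂.⊕ z) zeros) zeros)

elliptic⇒NoSingularLine : ∀ {Q} → PG₂.IsElliptic Q → NoSingularLine Q
elliptic⇒NoSingularLine {Q} elliptic x (x≢𝟎 , Qx) y (y≢𝟎 , Qy) x≢y Qx⊕y =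
  IsElliptic.noLine elliptic x y x≢𝟎 y≢𝟎 x≢y λ { {z} (a , b , refl) → line a b }
  where
  open PG₂
  Q𝟎 : Q S₂.𝟎 ≡ false
  Q𝟎 = proj₁ (IsElliptic.quadratic elliptic) false S₂.𝟎
  combinations : ∀ x y → false S₂.· x S₂.⊕ false S₂.· y ≡ S₂.𝟎 × false S₂.· x S₂.⊕ true S₂.· y ≡ y ×
                         true S₂.· x S₂.⊕ false S₂.· y ≡ x × true S₂.· x S₂.⊕ true S₂.· y ≡ x S₂.⊕ y
  combinations = decide (∀? λ x → ∀? λ y → (_ ≟₂ _) ×-dec ((_ ≟₂ _) ×-dec ((_ ≟₂ _) ×-dec (_ ≟₂ _))))
  line : ∀ a b → Q (a S₂.· x S₂.⊕ b S₂.· y) ≡ false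
  line false false = trans (cong Q (proj₁ (combinations x y))) Q𝟎
  line false true  = trans (cong Q (proj₁ (proj₂ (combinations x y)))) Qy
  line true  false = trans (cong Q (proj₁ (proj₂ (proj₂ (combinations x y))))) Qx
  line true  true  = trans (cong Q (proj₂ (proj₂ (proj₂ (combinations x y))))) Qx⊕y

-- A quadratic form is determined by its values on the basis vectors and by the
-- values of its polar form on pairs of them.
quadric : Vec Bool 10 → S₂.V → Bool
quadric (p ∷ q ∷ r ∷ s ∷ pq ∷ pr ∷ ps ∷ qr ∷ qs ∷ rs ∷ []) (a ∷ b ∷ c ∷ d ∷ []) =
  ((a ∧ a) ∧ p) xor (((b ∧ b) ∧ q) xor (((c ∧ c) ∧ r) xor ((d ∧ d) ∧ s) xor (c ∧ (d ∧ rs)))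
    xor (b ∧ ((c ∧ qr) xor (d ∧ qs)))) xor (a ∧ ((b ∧ pq) xor ((c ∧ pr) xor (d ∧ ps))))

opaque
  -- A run through all 1024 coefficient vectors takes the place of the classification of quadrics of
  -- PG(3,2).
  quadric-zeros : ∀ c → NoSingularLine (quadric c) → FiveSpanningZeros (quadric c)
  quadric-zeros = decide (∀? λ c → (∀? λ x → zero? (quadric c) x →-dec (∀? λ y → zero? (quadric c) y →-dec
      (¬? (x ≟₂ y) →-dec ¬? (quadric c (x S₂.⊕ y) 𝔹.≟ false))))
    →-dec ((length (zeros (quadric c)) ℕ.≟ 5) ×-dec
      (∀? λ x → ¬? (x ≟₂ _) →-dec ((x ∈? _) ⊎-dec Any.any? (λ y → Any.any? (λ z → ¬? (y ≟₂ z) ×-dec (x ≟₂ _)) _) _))))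
    where open DecMembership {A = S₂.V} _≟₂_ using (_∈?_)

-- One basis vector is split off at a time by `Q-⊕`. The bracketing of `quadric` and its
-- unsimplified squares `a ∧ a` are those that this expansion produces.
isQuadratic⇒quadric : ∀ {Q} → S₂.IsQuadratic Q → ∃ λ c → ∀ x → Q x ≡ quadric c x
isQuadratic⇒quadric {Q} (Q-· , bilinear) =
  (Q e₁ ∷ Q e₂ ∷ Q e₃ ∷ Q e₄ ∷ B e₁ e₂ ∷ B e₁ e₃ ∷ B e₁ e₄ ∷ B e₂ e₃ ∷ B e₂ e₄ ∷ B e₃ e₄ ∷ []) , λ
  { (a ∷ b ∷ c ∷ d ∷ []) → begin
    Q (a ∷ b ∷ c ∷ d ∷ [])
      ≡⟨ cong Q (basis a b c d) ⟩
    Q (a S₂.· e₁ S₂.⊕ (b S₂.· e₂ S₂.⊕ (c S₂.· e₃ S₂.⊕ d S₂.· e₄)))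
      ≡⟨ Q-⊕ a e₁ _ (cong₂ _xor_
           (Q-⊕ b e₂ _ (cong₂ _xor_
             (Q-⊕ c e₃ _ (cong₂ _xor_ (Q-· d e₄) (cong (c ∧_) (·-linearʳ d e₃ e₄))))
             (cong (b ∧_) (B-⊕ e₂ c d))))
           (cong (a ∧_) (trans (+-linearʳ e₁ (b S₂.· e₂) _) (cong₂ _xor_ (·-linearʳ b e₁ e₂) (B-⊕ e₁ c d))))) ⟩
    quadric _ (a ∷ b ∷ c ∷ d ∷ []) ∎ }
  where
  open S₂.IsBilinear bilinear
  open ≡-Reasoning
  B : S₂.Form
  B = S₂.polarForm Q
  e₁ e₂ e₃ e₄ : S₂.V
  e₁ = true ∷ false ∷ false ∷ false ∷ []
  e₂ = false ∷ true ∷ false ∷ false ∷ []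
  e₃ = false ∷ false ∷ true ∷ false ∷ []
  e₄ = false ∷ false ∷ false ∷ true ∷ []
  basis : ∀ a b c d → (a ∷ b ∷ c ∷ d ∷ []) ≡ a S₂.· e₁ S₂.⊕ (b S₂.· e₂ S₂.⊕ (c S₂.· e₃ S₂.⊕ d S₂.· e₄))
  basis = decide (∀? λ a → ∀? λ b → ∀? λ c → ∀? λ d → _ ≟₂ _)
  recover : ∀ t p q → t ≡ p xor (q xor ((t xor p) xor q))
  recover = decide (∀? λ t → ∀? λ p → ∀? λ q → _ 𝔹.≟ _)
  Q-⊕ : ∀ a x y {t} → Q y xor (a ∧ B x y) ≡ t → Q (a S₂.· x S₂.⊕ y) ≡ ((a ∧ a) ∧ Q x) xor t
  Q-⊕ a x y refl = trans (recover (Q (a S₂.· x S₂.⊕ y)) (Q (a S₂.· x)) (Q y))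
    (cong₂ (λ s t → s xor (Q y xor t)) (Q-· a x) (·-linearˡ a x y))
  B-⊕ : ∀ x c d → B x (c S₂.· e₃ S₂.⊕ d S₂.· e₄) ≡ (c ∧ B x e₃) xor (d ∧ B x e₄)
  B-⊕ x c d = trans (+-linearʳ x (c S₂.· e₃) (d S₂.· e₄)) (cong₂ _xor_ (·-linearʳ c x e₃) (·-linearʳ d x e₄))

zeros-cong : ∀ {Q Q′} → (∀ x → Q x ≡ Q′ x) → zeros Q ≡ zeros Q′
zeros-cong {Q} {Q′} eq = List.filter-≐ (zero? Q) (zero? Q′)
  ((λ {x} (x≢𝟎 , Qx) → x≢𝟎 , trans (sym (eq x)) Qx) , (λ {x} (x≢𝟎 , Qx) → x≢𝟎 , trans (eq x) Qx))
  (Finite.elements finite-Vec)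

elliptic-zeros : ∀ {Q} → PG₂.IsElliptic Q → FiveSpanningZeros Q
elliptic-zeros {Q} elliptic with isQuadratic⇒quadric (PG₂.IsElliptic.quadratic elliptic)
... | c , eq = subst (λ zs → length zs ≡ 5 × (∀ x → x ≢ S₂.𝟎 → x ∈ zs ⊎ Any (λ y → Any (λ z → y ≢ z × x ≡ y S₂.⊕ z) zs) zs))
  (sym (zeros-cong eq))
  (quadric-zeros c λ x (x≢𝟎 , qx) y (y≢𝟎 , qy) x≢y q →
    elliptic⇒NoSingularLine elliptic x (x≢𝟎 , trans (eq x) qx) y (y≢𝟎 , trans (eq y) qy) x≢y (trans (eq (x S₂.⊕ y)) q))

unique-vectors : Unique (Finite.elements (finite-Vec {Bool} {4}))
unique-vectors = decide (unique? _≟₂_ _)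

-- From an elliptic ovoid to a frame

module FromOvoid (h : S₄.Form) (hermitian : IsHermitian h) (nondegenerate : S₄.Nondegenerate h)
                 (W : SymplecticQuadrangle) (sub : IsSymplecticSubquadrangle h W)
                 (E : PointSet) (ovoid : IsEllipticOvoid E W) where
  open Hermitian h hermitian
  open SymplecticQuadrangle W renaming (alternating to form-alternating; nondegenerate to form-nondegenerate)
  open IsSymplecticSubquadrangle sub
  open IsEllipticOvoid ovoid renaming (zeros to E-zeros)
  open S₂.IsBilinear (proj₁ form-alternating)
  open S₂.IsBilinear (proj₁ form-alternating) using () renaming (+-linearʳ to form-⊕ʳ)
  open S₄.IsBilinear (proj₁ extension-alternating) using () renaming (·-linearˡ to ext-·ˡ; ·-linearʳ to ext-·ʳ)
  open ≡-Reasoning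

  embed-⊕ : ∀ x y → embed (x S₂.⊕ y) ≡ embed x ⊕ embed y
  embed-⊕ x y = trans (cong (λ c → comb c basis) (ι-⊕ x y)) (comb-⊕ (Vec.map ι x) (Vec.map ι y) basis)

  embed-𝟎 : embed S₂.𝟎 ≡ 𝟎
  embed-𝟎 = comb-𝟎 basis

  embed≡𝟎⇒≡𝟎 : ∀ x → embed x ≡ 𝟎 → x ≡ S₂.𝟎
  embed≡𝟎⇒≡𝟎 x eq = ι-injective x S₂.𝟎 (independent (Vec.map ι x) eq)

  embed-injective : ∀ {x y} → embed x ≡ embed y → x ≡ y
  embed-injective {x} {y} eq with x ≟₂ y
  ... | yes x≡y = x≡y
  ... | no x≢y = contradiction
    (embed≡𝟎⇒≡𝟎 (x S₂.⊕ y) (trans (embed-⊕ x y) (trans (cong (_⊕ embed y) eq) (⊕-self (embed y)))))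
    (distinct-sum x y x≢y)

  -- Points of W are fixed by σ, so there ⊥ and the polarity of extension agree.
  perpendicular : ∀ x y → form x y ≡ false → h (embed y) (embed x) ≡ 0#
  perpendicular x y xy with x ≟₂ S₂.𝟎 | y ≟₂ S₂.𝟎
  ... | yes refl | _        = trans (cong (h (embed y)) embed-𝟎) (h-𝟎ʳ (embed y))
  ... | no _     | yes refl = trans (cong (λ v → h v (embed x)) embed-𝟎) (h-𝟎ˡ (embed x))
  ... | no x≢𝟎   | no y≢𝟎   =
    let P , a , a≢0 , x≡ap = point (x≢𝟎 ∘ embed≡𝟎⇒≡𝟎 x)
        R , c , c≢0 , y≡cr = point (y≢𝟎 ∘ embed≡𝟎⇒≡𝟎 y)
        p = representative P
        r = representative R
        σP≡P = proj₂ σ-fixed {P} (x , x≢𝟎 , a , a≢0 , x≡ap)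
        ext≡0 = begin
          a * (c * extension p r)      ≡⟨ cong (a *_) (ext-·ʳ c p r) ⟨
          a * extension p (c · r)      ≡⟨ ext-·ˡ a p (c · r) ⟨
          extension (a · p) (c · r)    ≡⟨ cong₂ extension x≡ap y≡cr ⟨
          extension (embed x) (embed y) ≡⟨ Equivalence.to (extends x y) xy ⟩
          0#                           ∎
        pr≡0 = zero-product c (extension p r) c≢0 (zero-product a (c * extension p r) a≢0 ext≡0)
        rp≡0 = proj₂ (⊥̃⊥≐σ P) {P} σP≡P {R} λ { refl → pr≡0 }
    in begin
      h (embed y) (embed x)   ≡⟨ cong₂ h y≡cr x≡ap ⟩
      h (c · r) (a · p)       ≡⟨ h-·ˡ c r (a · p) ⟩
      c * h r (a · p)         ≡⟨ cong (c *_) (h-·ʳ a r p) ⟩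
      c * (conj a * h r p)    ≡⟨ cong (λ t → c * (conj a * t)) rp≡0 ⟩
      c * (conj a * 0#)       ≡⟨ cong (c *_) (*-zeroʳ (conj a)) ⟩
      c * 0#                  ≡⟨ *-zeroʳ c ⟩
      0#                      ∎

  isotropic : ∀ x → h (embed x) (embed x) ≡ 0#
  isotropic x = perpendicular x x (proj₂ form-alternating x)

  -- Sums of embedded vectors are embedded, hence isotropic, so the mixed terms in the expansion of
  -- `h (u ⊕ v) (u ⊕ v)` cancel. Together with `conj-sym` this puts every product of embedded
  -- vectors in GF(2).
  h-real : ∀ x y → h (embed y) (embed x) ≡ h (embed x) (embed y)
  h-real x y = cancel (h u v) (h v u) (begin
    (0# + h u v) + (h v u + 0#)        ≡⟨ cong₂ (λ s t → (s + h u v) + (h v u + t)) (isotropic x) (isotropic y) ⟨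
    (h u u + h u v) + (h v u + h v v)  ≡⟨ cong₂ _+_ (h-⊕ʳ u u v) (h-⊕ʳ v u v) ⟨
    h u (u ⊕ v) + h v (u ⊕ v)          ≡⟨ h-⊕ˡ u v (u ⊕ v) ⟨
    h (u ⊕ v) (u ⊕ v)                  ≡⟨ cong₂ h (embed-⊕ x y) (embed-⊕ x y) ⟨
    h (embed (x S₂.⊕ y)) (embed (x S₂.⊕ y)) ≡⟨ isotropic (x S₂.⊕ y) ⟩
    0#                                 ∎)
    where
    u v : V
    u = embed x
    v = embed y
    cancel : ∀ s t → (0# + s) + (t + 0#) ≡ 0# → t ≡ s
    cancel = decide (∀? λ s → ∀? λ t → (_ ≟ _) →-dec (_ ≟ _))

  -- Since 1 and `ω` are a basis of GF(4) over GF(2), each vector is `embed c₀ ⊕ ω · embed c₁`.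
  -- Orthogonality to the embedded vectors is therefore orthogonality to all vectors, and `h` is
  -- nondegenerate.
  radical : ∀ x → (∀ z → h (embed z) (embed x) ≡ 0#) → x ≡ S₂.𝟎
  radical x orthogonal = embed≡𝟎⇒≡𝟎 x (nondegenerate (embed x) λ v → h-sym-zero v (embed x) (all v))
    where
    split : ∀ {n} (c : Vec F₄ n) → c ≡ Vec.map ι (Vec.map F₄.const c) ⊕ ω · Vec.map ι (Vec.map F₄.coeff c)
    split []      = refl
    split (a ∷ c) = cong₂ _∷_ (scalar a) (split c)
      where
      scalar : ∀ a → a ≡ ι (F₄.const a) + ω * ι (F₄.coeff a)
      scalar = decide (∀? λ a → _ ≟ _)
    all : ∀ v → h v (embed x) ≡ 0#
    all v with independent⇒spanning basis independent v
    ... | c , refl = begin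
      h (comb c basis) (embed x)                       ≡⟨ cong (λ c → h (comb c basis) (embed x)) (split c) ⟩
      h (comb (Vec.map ι c₀ ⊕ ω · Vec.map ι c₁) basis) (embed x)
        ≡⟨ cong (λ v → h v (embed x)) (trans (comb-⊕ (Vec.map ι c₀) (ω · Vec.map ι c₁) basis)
             (cong (embed c₀ ⊕_) (comb-· ω (Vec.map ι c₁) basis))) ⟩
      h (embed c₀ ⊕ ω · embed c₁) (embed x)            ≡⟨ h-⊕ˡ (embed c₀) (ω · embed c₁) (embed x) ⟩
      h (embed c₀) (embed x) + h (ω · embed c₁) (embed x)
        ≡⟨ cong₂ _+_ (orthogonal c₀)
             (trans (h-·ˡ ω (embed c₁) (embed x)) (trans (cong (ω *_) (orthogonal c₁)) (*-zeroʳ ω))) ⟩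
      0# + 0#                                          ≡⟨ +-self 0# ⟩
      0#                                               ∎
      where
      c₀ c₁ : S₂.V
      c₀ = Vec.map F₄.const c
      c₁ = Vec.map F₄.coeff c

  -- So far `form` and `h` are linked only in one direction: where `form` vanishes, so does `h`.
  -- Suppose that `h` also vanished on this pair. For each `z`, one of `z` and `z ⊕ y` is orthogonal
  -- to `x` under `form`, so `z` would always be orthogonal to `x` under `h`, and `x` would be zero.
  -- Hence the product is a nonzero element of GF(2).
  product-one : ∀ x y → form x y ≡ true → h (embed x) (embed y) ≡ 1#
  product-one x y xy with h (embed y) (embed x) ≟ 0#
  ... | no yx≢0 = trans (sym (h-real x y))
          (real (h (embed y) (embed x)) (trans (sym (conj-sym (embed y) (embed x))) (sym (h-real x y))) yx≢0)
    where
    real : ∀ t → conj t ≡ t → t ≢ 0# → t ≡ 1#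
    real = decide (∀? λ t → (_ ≟ _) →-dec (¬? (t ≟ 0#) →-dec (t ≟ 1#)))
  ... | yes yx≡0 = contradiction (trans (sym xy) (form-𝟎 (radical x orthogonal))) λ ()
    where
    form-𝟎 : x ≡ S₂.𝟎 → form x y ≡ false
    form-𝟎 refl = ·-linearˡ false S₂.𝟎 y
    orthogonal : ∀ z → h (embed z) (embed x) ≡ 0#
    orthogonal z with form x z in xz
    ... | false = perpendicular x z xz
    ... | true = begin
      h (embed z) (embed x)                          ≡⟨ +-identityʳ (h (embed z) (embed x)) ⟨
      h (embed z) (embed x) + 0#                     ≡⟨ cong (h (embed z) (embed x) +_) yx≡0 ⟨
      h (embed z) (embed x) + h (embed y) (embed x)  ≡⟨ h-⊕ˡ (embed z) (embed y) (embed x) ⟨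
      h (embed z ⊕ embed y) (embed x)                ≡⟨ cong (λ v → h v (embed x)) (embed-⊕ z y) ⟨
      h (embed (z S₂.⊕ y)) (embed x)
        ≡⟨ perpendicular x (z S₂.⊕ y) (trans (form-⊕ʳ x z y) (cong₂ _xor_ xz xy)) ⟩
      0#                                             ∎

  zs : List S₂.V
  zs = zeros Q

  ∈-zs⁻ : ∀ {x} → x ∈ zs → x ≢ S₂.𝟎 × Q x ≡ false
  ∈-zs⁻ = proj₂ ∘ ∈-filter⁻ (zero? Q) {xs = Finite.elements finite-Vec}

  ∈-zs⁺ : ∀ {x} → x ≢ S₂.𝟎 × Q x ≡ false → x ∈ zs
  ∈-zs⁺ = ∈-filter⁺ (zero? Q) (Finite.complete finite-Vec _)

  -- The line through two zeros is not tangent.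
  zeros-product : ∀ {x y} → x ∈ zs → y ∈ zs → x ≢ y → form x y ≡ true
  zeros-product {x} {y} x∈ y∈ x≢y with form x y in xy
  ... | true  = refl
  ... | false =
    let x≢𝟎 , Qx = ∈-zs⁻ x∈
        y≢𝟎 , Qy = ∈-zs⁻ y∈
        z , _ , unique-z = Equivalence.from (tangents x y x≢𝟎 y≢𝟎 x≢y)
          (Equivalence.from (isotropic-line form-alternating x y) xy)
    in contradiction (trans (sym (unique-z (x≢𝟎 , (true , false , span-first x y) , Qx)))
                            (unique-z (y≢𝟎 , (false , true , span-second x y) , Qy))) x≢y

  bs : List V
  bs = List.map embed zs

  frame : IsFrame h bs
  frame = record
    { five      = trans (List.length-map embed zs) (proj₁ (elliptic-zeros elliptic))
    ; unique    = Unique.map⁺ embed-injective (Unique.filter⁺ (zero? Q) unique-vectors)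
    ; isotropic = λ v∈ → let x , _ , v≡ = ∈-map⁻ embed v∈ in trans (cong₂ h v≡ v≡) (isotropic x)
    ; products  = λ u∈ v∈ u≢v →
        let x , x∈ , u≡ = ∈-map⁻ embed u∈
            y , y∈ , v≡ = ∈-map⁻ embed v∈
        in trans (cong₂ h u≡ v≡) (product-one x y (zeros-product x∈ y∈
             λ x≡y → u≢v (trans u≡ (trans (cong embed x≡y) (sym v≡)))))
    }

  E≐ : (Subset._∈ E) ≐ Spanned bs
  E≐ = (λ {P} P∈ → let x , x-zero , xP = proj₁ E-zeros {P} P∈ in embed x , ∈-map⁺ embed (∈-zs⁺ x-zero) , xP)
     , λ {P} (v , v∈ , vP) → let x , x∈ , v≡ = ∈-map⁻ embed v∈
                             in proj₂ E-zeros {P} (x , ∈-zs⁻ x∈ , subst (_Represents P) v≡ vP)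

  points≐ : points ≐ Spanned (quadrangle bs)
  points≐ = (λ {P} → to P) , λ {P} → from P
    where
    quad : ∀ x → x ∈ zs ⊎ Any (λ y → Any (λ z → y ≢ z × x ≡ y S₂.⊕ z) zs) zs → Quadrangle bs (embed x)
    quad x (inj₁ x∈) = inj₁ (∈-map⁺ embed x∈)
    quad x (inj₂ any) with find any
    ... | y , y∈ , any′ with find any′
    ... | z , z∈ , y≢z , refl =
      inj₂ (embed y , embed z , ∈-map⁺ embed y∈ , ∈-map⁺ embed z∈ , y≢z ∘ embed-injective , embed-⊕ y z)
    to : ∀ P → points P → Spanned (quadrangle bs) P
    to P (x , x≢𝟎 , xP) = embed x , ∈-quadrangle⁺ (quad x (proj₂ (elliptic-zeros elliptic) x x≢𝟎)) , xP
    from : ∀ P → Spanned (quadrangle bs) P → points P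
    from P (v , v∈ , vP) with ∈-quadrangle⁻ v∈
    ... | inj₁ v∈bs = let x , x∈ , v≡ = ∈-map⁻ embed v∈bs in x , proj₁ (∈-zs⁻ x∈) , subst (_Represents P) v≡ vP
    ... | inj₂ (v₁ , v₂ , v₁∈ , v₂∈ , v₁≢v₂ , refl) =
      let x , x∈ , v₁≡ = ∈-map⁻ embed v₁∈
          y , y∈ , v₂≡ = ∈-map⁻ embed v₂∈
      in x S₂.⊕ y , distinct-sum x y (λ x≡y → v₁≢v₂ (trans v₁≡ (trans (cong embed x≡y) (sym v₂≡))))
         , subst (_Represents P) (trans (cong₂ _⊕_ v₁≡ v₂≡) (sym (embed-⊕ x y))) vP

ovoid⇒frame : (h : S₄.Form) → IsHermitian h → S₄.Nondegenerate h → ∀ {E W} → Γ.OvoidOf h E W → FrameOf h E W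
ovoid⇒frame h hermitian nondegenerate {E} (W , sub , ovoid , (⊆W , W⊆)) =
  bs , frame , E≐ , (λ {P} P∈ → proj₁ points≐ {P} (⊆W P∈)) , λ {P} P∈ → W⊆ (proj₂ points≐ {P} P∈)
  where open FromOvoid h hermitian nondegenerate W sub E ovoid

-- Cliques of a relation as lists

module _ {A : Set} where

  same-length : {xs ys : List A} → Unique xs → Unique ys → xs ∼[ set ] ys → length xs ≡ length ys
  same-length u v eq = ↭.↭-length (∼bag⇒↭ (unique∧set⇒bag u v eq))

  unique⇒pairs : {R : Rel A 0ℓ} {xs : List A} → Unique xs → (∀ {x y} → x ∈ xs → y ∈ xs → x ≢ y → R x y) → AllPairs R xs
  unique⇒pairs []       r = []
  unique⇒pairs (x∉ ∷ u) r = All.tabulate (λ y∈ → r (here refl) (there y∈) (All.lookup x∉ y∈))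
                          ∷ unique⇒pairs u (λ x∈ y∈ → r (there x∈) (there y∈))

  pairs⇒related : {R : Rel A 0ℓ} → Symmetric R → ∀ {xs} → AllPairs R xs → ∀ {x y} → x ∈ xs → y ∈ xs → x ≢ y → R x y
  pairs⇒related sym (r ∷ rs) (here refl) (here refl) x≢x = contradiction refl x≢x
  pairs⇒related sym (r ∷ rs) (here refl) (there y∈)  _   = All.lookup r y∈
  pairs⇒related sym (r ∷ rs) (there x∈)  (here refl) _   = sym (All.lookup r x∈)
  pairs⇒related sym (r ∷ rs) (there x∈)  (there y∈)  x≢y = pairs⇒related sym rs x∈ y∈ x≢y

  private
    drop-head : ∀ {x : A} {l l′} → x ∉ l → x ∷ l ∼[ set ] x ∷ l′ → ∀ {y} → y ∈ l → y ∈ l′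
    drop-head x∉l eq y∈l with Equivalence.to eq (there y∈l)
    ... | here refl = contradiction y∈l x∉l
    ... | there y∈l′ = y∈l′

  -- The order of a sublist is inherited from `xs`, so a set has at most one listing as a sublist.
  -- This lets lists be counted instead of sets.
  sublist-unique : ∀ {xs l l′ : List A} → Unique xs → l ⊑ xs → l′ ⊑ xs → l ∼[ set ] l′ → l ≡ l′
  sublist-unique u [] [] eq = refl
  sublist-unique (x∉ ∷ u) (_ ∷ʳ s) (_ ∷ʳ s′) eq = sublist-unique u s s′ eq
  sublist-unique (x∉ ∷ u) (refl ∷ s) (_ ∷ʳ s′) eq =
    contradiction refl (All.lookup x∉ (lookup s′ (Equivalence.to eq (here refl))))
  sublist-unique (x∉ ∷ u) (_ ∷ʳ s) (refl ∷ s′) eq =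
    contradiction refl (All.lookup x∉ (lookup s (Equivalence.from eq (here refl))))
  sublist-unique (x∉ ∷ u) (refl ∷ s) (refl ∷ s′) eq = cong (_ ∷_) (sublist-unique u s s′
    (mk⇔ (drop-head (λ x∈ → All.lookup x∉ (lookup s x∈) refl) eq)
         (drop-head (λ x∈ → All.lookup x∉ (lookup s′ x∈) refl) (mk⇔ (Equivalence.from eq) (Equivalence.to eq)))))

module _ {A : Set} {R : Rel A 0ℓ} (R? : Decidable R) where

  -- The recursion decides whether the head belongs to the clique, so each clique arises once, with
  -- its elements in the order of the given list.
  cliques : ℕ → List A → List (List A)
  cliques zero    xs       = [] ∷ []
  cliques (suc k) []       = []
  cliques (suc k) (x ∷ xs) = List.map (x ∷_) (cliques k (filter (R? x) xs)) ++ cliques (suc k) xs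

  cliques-sound : ∀ k xs {l} → l ∈ cliques k xs → length l ≡ k × l ⊑ xs × AllPairs R l
  cliques-sound zero    xs (here refl) = refl , minimum xs , []
  cliques-sound (suc k) (x ∷ xs) l∈ with ∈-++⁻ (List.map (x ∷_) (cliques k (filter (R? x) xs))) l∈
  ... | inj₂ l∈′ = let eq , l⊑ , r = cliques-sound (suc k) xs l∈′ in eq , x ∷ʳ l⊑ , r
  ... | inj₁ l∈′ with ∈-map⁻ (x ∷_) l∈′
  ...   | m , m∈ , refl =
    let eq , m⊑ , r = cliques-sound k (filter (R? x) xs) m∈
    in cong suc eq , refl ∷ ⊆-trans m⊑ (filter-⊆ (R? x) xs)
       , All.tabulate (λ y∈ → proj₂ (∈-filter⁻ (R? x) {xs = xs} (lookup m⊑ y∈))) ∷ r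

  cliques-complete : ∀ l xs → l ⊑ xs → AllPairs R l → l ∈ cliques (length l) xs
  cliques-complete []      xs       s          r        = here refl
  cliques-complete (x ∷ l) (y ∷ xs) (_ ∷ʳ s)   r        = ∈-++⁺ʳ _ (cliques-complete (x ∷ l) xs s r)
  cliques-complete (x ∷ l) (_ ∷ xs) (refl ∷ s) (p ∷ r) = ∈-++⁺ˡ (∈-map⁺ (x ∷_)
    (cliques-complete l (filter (R? x) xs)
      (subst (_⊑ _) (List.filter-all (R? x) p) (⊆-filter-Sublist (R? x) (R? x) (λ { refl q → q }) s)) r))

  cliques-unique : ∀ k xs → Unique xs → Unique (cliques k xs)
  cliques-unique zero    xs       u        = [] ∷ []
  cliques-unique (suc k) []       u        = []
  cliques-unique (suc k) (x ∷ xs) (x∉ ∷ u) = Unique.++⁺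
    (Unique.map⁺ (λ { refl → refl }) (cliques-unique k (filter (R? x) xs) (Unique.filter⁺ (R? x) u)))
    (cliques-unique (suc k) xs u)
    (λ (l∈ , l∈′) → case ∈-map⁻ (x ∷_) l∈ of λ
      { (m , _ , refl) → All.lookup x∉ (lookup (proj₁ (proj₂ (cliques-sound (suc k) xs l∈′))) (here refl)) refl })

  -- Filtering `xs` by membership in `l` puts the elements of `l` into the order in which `cliques`
  -- lists them.
  cliques-of-set : DecidableEquality A → ∀ {xs l} → Unique xs → Unique l → (∀ {x} → x ∈ l → x ∈ xs) →
                   (∀ {x y} → x ∈ l → y ∈ l → x ≢ y → R x y) →
                   ∃ λ l′ → l′ ∈ cliques (length l) xs × l′ ∼[ set ] l
  cliques-of-set _≟ₐ_ {xs} {l} u u′ l⊆xs related = l′ , subst (λ k → l′ ∈ cliques k xs) (same-length unique-l′ u′ l′∼l)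
      (cliques-complete l′ xs (filter-⊆ (_∈? l) xs) (unique⇒pairs unique-l′ λ x∈ y∈ → related (⊆l x∈) (⊆l y∈))) , l′∼l
    where
    open DecMembership _≟ₐ_ using (_∈?_)
    l′ : List A
    l′ = filter (_∈? l) xs
    ⊆l : ∀ {x} → x ∈ l′ → x ∈ l
    ⊆l = proj₂ ∘ ∈-filter⁻ (_∈? l) {xs = xs}
    l′∼l : l′ ∼[ set ] l
    l′∼l = mk⇔ ⊆l (λ x∈ → ∈-filter⁺ (_∈? l) (l⊆xs x∈) x∈)
    unique-l′ : Unique l′
    unique-l′ = Unique.filter⁺ (_∈? l) u

-- Enumeration of the frames of the form Σ xᵢ conj yᵢ, up to scalars

open Hermitian ⟪_,_⟫ ⟪⟫-hermitian using (h-·ˡ; h-·ʳ; h-scale; conj-sym; h-sym-zero)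

-- If `p` and `q` are not orthogonal, this is the one multiple of `q` whose product with `p` is 1,
-- because `conj t * t` is 1 for every nonzero `t`.
scaled : V → V → V
scaled p q = ⟪ p , q ⟫ · q

candidates : V → List V → List V
candidates p qs = List.map (scaled p) (filter (λ q → ¬? (⟪ p , q ⟫ ≟ 0#)) qs)

unit? : Decidable (λ x y → ⟪ x , y ⟫ ≡ 1#)
unit? x y = ⟪ x , y ⟫ ≟ 1#

-- Here `p` is the first listed point that occurs in the frame. Requiring the frame to contain the
-- listed vector of that point uses up the common scalar. The other four vectors are then determined
-- multiples of later points, with product 1 among themselves.
frames : List V → List (List V)
frames []       = []
frames (p ∷ qs) = List.map (p ∷_) (cliques unit? 4 (candidates p qs)) ++ frames qs

scale-frame : ∀ {a bs} → a ≢ 0# → IsFrame ⟪_,_⟫ bs → IsFrame ⟪_,_⟫ (List.map (a ·_) bs)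
scale-frame {a} {bs} a≢0 frame = record
  { five = trans (List.length-map (a ·_) bs) five
  ; unique = Unique.map⁺ (·-injective a≢0) unique
  ; isotropic = λ x∈ → case ∈-map⁻ (a ·_) x∈ of λ { (v , v∈ , refl) → trans (h-scale a a≢0 v v) (isotropic v∈) }
  ; products = λ x∈ y∈ x≢y → case (∈-map⁻ (a ·_) x∈ , ∈-map⁻ (a ·_) y∈) of λ
      { ((u , u∈ , refl) , (v , v∈ , refl)) → trans (h-scale a a≢0 u v) (products u∈ v∈ λ { refl → x≢y refl }) }
  }
  where open IsFrame frame

unit-symmetric : ∀ {x y} → ⟪ x , y ⟫ ≡ 1# → ⟪ y , x ⟫ ≡ 1#
unit-symmetric {x} {y} eq = trans (conj-sym x y) (cong conj eq)

module _ {p : V} {qs : List V} where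

  ∈-candidates : ∀ {x} → x ∈ candidates p qs → ∃ λ q → q ∈ qs × ⟪ p , q ⟫ ≢ 0# × x ≡ scaled p q
  ∈-candidates x∈ =
    let q , q∈ , eq = ∈-map⁻ (scaled p) x∈
        q∈qs , pq≢0 = ∈-filter⁻ (λ q → ¬? (⟪ p , q ⟫ ≟ 0#)) {xs = qs} q∈
    in q , q∈qs , pq≢0 , eq

  candidates-unit : ∀ {x} → x ∈ candidates p qs → ⟪ p , x ⟫ ≡ 1#
  candidates-unit x∈ with ∈-candidates x∈
  ... | q , _ , pq≢0 , refl = trans (h-·ʳ ⟪ p , q ⟫ p q) (conj-inverse ⟪ p , q ⟫ pq≢0)

  candidates-isotropic : (∀ {q} → q ∈ qs → ⟪ q , q ⟫ ≡ 0#) → ∀ {x} → x ∈ candidates p qs → ⟪ x , x ⟫ ≡ 0#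
  candidates-isotropic isotropic x∈ with ∈-candidates x∈
  ... | q , q∈ , pq≢0 , refl = trans (h-scale ⟪ p , q ⟫ pq≢0 q q) (isotropic q∈)

  unit⇒∈-candidates : ∀ {q x c} → q ∈ qs → x ≡ c · q → ⟪ p , x ⟫ ≡ 1# → x ∈ candidates p qs
  unit⇒∈-candidates {q} {c = c} q∈ refl px = subst (_∈ candidates p qs) (cong (_· q) (sym c≡))
    (∈-map⁺ (scaled p) (∈-filter⁺ (λ q → ¬? (⟪ p , q ⟫ ≟ 0#)) q∈ pq≢0))
    where
    factor : ∀ c t → conj c * t ≡ 1# → c ≡ t × t ≢ 0#
    factor = decide (∀? λ c → ∀? λ t → (_ ≟ _) →-dec ((c ≟ t) ×-dec ¬? (t ≟ 0#)))
    c≡ : c ≡ ⟪ p , q ⟫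
    c≡ = proj₁ (factor c ⟪ p , q ⟫ (trans (sym (h-·ʳ c p q)) px))
    pq≢0 : ⟪ p , q ⟫ ≢ 0#
    pq≢0 = proj₂ (factor c ⟪ p , q ⟫ (trans (sym (h-·ʳ c p q)) px))

  candidates-unique : Unique qs → (∀ {q} → q ∈ qs → normalise q ≡ q) → Unique (candidates p qs)
  candidates-unique unique normal = AllPairs.map⁺ (unique⇒pairs (Unique.filter⁺ (λ q → ¬? (⟪ p , q ⟫ ≟ 0#)) unique)
      λ {q} {r} q∈ r∈ q≢r eq → q≢r (trans (sym (normalise-scaled q∈)) (trans (cong normalise eq) (normalise-scaled r∈))))
    where
    normalise-scaled : ∀ {q} → q ∈ filter (λ q → ¬? (⟪ p , q ⟫ ≟ 0#)) qs → normalise (scaled p q) ≡ q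
    normalise-scaled {q} q∈ =
      let q∈qs , pq≢0 = ∈-filter⁻ (λ q → ¬? (⟪ p , q ⟫ ≟ 0#)) {xs = qs} q∈
      in trans (normalise-· ⟪ p , q ⟫ pq≢0 q) (normal q∈qs)

frames-sound : ∀ ps → (∀ {q} → q ∈ ps → ⟪ q , q ⟫ ≡ 0#) → ∀ {l} → l ∈ frames ps → IsFrame ⟪_,_⟫ l
frames-sound (p ∷ qs) isotropic l∈ with ∈-++⁻ (List.map (p ∷_) (cliques unit? 4 (candidates p qs))) l∈
... | inj₂ l∈′ = frames-sound qs (isotropic ∘ there) l∈′
... | inj₁ l∈′ with ∈-map⁻ (p ∷_) l∈′
...   | k , k∈ , refl with cliques-sound unit? 4 (candidates p qs) k∈
...     | four , k⊑ , units = record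
  { five = cong suc four
  ; unique = unique⇒distinct l-isotropic l-units
  ; isotropic = l-isotropic
  ; products = pairs⇒related unit-symmetric l-units
  }
  where
  l-isotropic : ∀ {x} → x ∈ p ∷ k → ⟪ x , x ⟫ ≡ 0#
  l-isotropic (here refl) = isotropic (here refl)
  l-isotropic (there x∈)  = candidates-isotropic {p} {qs} (isotropic ∘ there) (lookup k⊑ x∈)
  l-units : AllPairs (λ x y → ⟪ x , y ⟫ ≡ 1#) (p ∷ k)
  l-units = All.tabulate (λ x∈ → candidates-unit {p} {qs} (lookup k⊑ x∈)) ∷ units
  -- An isotropic vector has product 0 with itself, so product 1 implies distinctness.
  unique⇒distinct : ∀ {l} → (∀ {x} → x ∈ l → ⟪ x , x ⟫ ≡ 0#) → AllPairs (λ x y → ⟪ x , y ⟫ ≡ 1#) l → Unique l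
  unique⇒distinct iso []       = []
  unique⇒distinct iso (r ∷ rs) =
    All.map (λ { xy refl → contradiction (trans (sym (iso (here refl))) xy) λ () }) r ∷ unique⇒distinct (iso ∘ there) rs

-- The list is searched for the first point `p` that comes from a vector `b` of the frame. The
-- scalar `a` that normalises `b` is applied to the whole frame, and the remaining vectors then
-- occur among the candidates for `p`.
frames-complete : ∀ ps → Unique ps → (∀ {q} → q ∈ ps → normalise q ≡ q) → ∀ {bs} → IsFrame ⟪_,_⟫ bs →
                  (∀ {b} → b ∈ bs → normalise b ∈ ps) →
                  ∃ λ l → l ∈ frames ps × ∃ λ a → a ≢ 0# × l ∼[ set ] List.map (a ·_) bs
frames-complete [] unique normal {[]} record { five = () }
frames-complete [] unique normal {b ∷ bs} frame bs⊆ = case bs⊆ (here refl) of λ ()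
frames-complete (p ∷ qs) (p∉qs ∷ unique) normal {bs} frame bs⊆ with Any.any? (λ b → normalise b ≟ᵥ p) bs
... | no none = let l , l∈ , rest = frames-complete qs unique (normal ∘ there) frame λ b∈ → case bs⊆ b∈ of λ
                      { (here eq) → contradiction (lose b∈ eq) none ; (there b∈qs) → b∈qs }
                in l , ∈-++⁺ʳ _ l∈ , rest
... | yes some with find some
...   | b , b∈ , nb≡p with normalise-multiple b
...     | a , a≢0 , nb≡ab = p ∷ k , ∈-++⁺ˡ (∈-map⁺ (p ∷_) (subst (λ n → k ∈ cliques unit? n cs) four
            (cliques-complete unit? k cs (filter-⊆ (_∈? bs′) cs)
              (unique⇒pairs unique-k λ x∈ y∈ → products (⊆bs′ x∈) (⊆bs′ y∈)))))
          , a , a≢0 , l∼bs′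
  where
  bs′ cs k : List V
  bs′ = List.map (a ·_) bs
  cs = candidates p qs
  open DecMembership (_≟ᵥ_ {4}) using (_∈?_)
  k = filter (_∈? bs′) cs
  open IsFrame (scale-frame a≢0 frame) using (isotropic; products) renaming (five to five′; unique to unique′)
  p∈bs′ : p ∈ bs′
  p∈bs′ = subst (_∈ bs′) (trans (sym nb≡ab) nb≡p) (∈-map⁺ (a ·_) b∈)
  ⊆bs′ : ∀ {x} → x ∈ k → x ∈ bs′
  ⊆bs′ = proj₂ ∘ ∈-filter⁻ (_∈? bs′) {xs = cs}
  pp≡0 : ⟪ p , p ⟫ ≡ 0#
  pp≡0 = isotropic p∈bs′
  unique-k : Unique k
  unique-k = Unique.filter⁺ (_∈? bs′) (candidates-unique {p} {qs} unique (normal ∘ there))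
  candidate : ∀ {x} → x ∈ bs′ → x ≢ p → x ∈ cs
  candidate {x} x∈ x≢p with ∈-map⁻ (a ·_) x∈
  ... | v , v∈ , refl with bs⊆ v∈
  ...   | there nv∈qs =
    let c , _ , eq = normalise-≡⇒multiple {x = a · v} {y = normalise v}
          (trans (normalise-· a a≢0 v) (sym (normal (there nv∈qs))))
    in unit⇒∈-candidates {p} {qs} {c = c} nv∈qs eq (products p∈bs′ x∈ (x≢p ∘ sym))
  -- A second vector of the frame at the point `p` would be a multiple of the isotropic `p` and so
  -- have product 0 with it.
  ...   | here nv≡p =
    let c , _ , eq = normalise-≡⇒multiple {x = a · v} {y = p}
          (trans (normalise-· a a≢0 v) (trans nv≡p (sym (normal (here refl)))))
        zero-px = trans (cong ⟪ p ,_⟫ eq) (trans (h-·ʳ c p p) (trans (cong (conj c *_) pp≡0) (*-zeroʳ (conj c))))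
    in contradiction (trans (sym zero-px) (products p∈bs′ x∈ (x≢p ∘ sym))) λ ()
  l∼bs′ : p ∷ k ∼[ set ] bs′
  l∼bs′ = mk⇔ to from
    where
    to : ∀ {x} → x ∈ p ∷ k → x ∈ bs′
    to (here refl) = p∈bs′
    to (there x∈) = ⊆bs′ x∈
    from : ∀ {x} → x ∈ bs′ → x ∈ p ∷ k
    from {x} x∈ with x ≟ᵥ p
    ... | yes refl = here refl
    ... | no x≢p = there (∈-filter⁺ (_∈? bs′) (candidate x∈ x≢p) x∈)
  unique-l : Unique (p ∷ k)
  unique-l = All.tabulate (λ { x∈ refl → contradiction
    (trans (sym pp≡0) (candidates-unit {p} {qs} (proj₁ (∈-filter⁻ (_∈? bs′) {xs = cs} x∈)))) λ () }) ∷ unique-k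
  four : length k ≡ 4
  four = ℕ.suc-injective (trans (same-length unique-l unique′ l∼bs′) five′)

private
  isotropic? : ∀ v → Dec (⟪ v , v ⟫ ≡ 0#)
  isotropic? v = ⟪ v , v ⟫ ≟ 0#

opaque
  isotropicPoints : List V
  isotropicPoints = filter isotropic? (Enumeration.normalised 4)

  isotropicPoints-unique : Unique isotropicPoints
  isotropicPoints-unique = Unique.filter⁺ isotropic? (decide (unique? _≟ᵥ_ (Enumeration.normalised 4)))

  isotropicPoints⁻ : ∀ q → q ∈ isotropicPoints → normalise q ≡ q × ⟪ q , q ⟫ ≡ 0#
  isotropicPoints⁻ q q∈ =
    let q∈′ , qq≡0 = ∈-filter⁻ isotropic? {xs = Enumeration.normalised 4} q∈ in normalise-normalised q∈′ , qq≡0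

  isotropicPoints⁺ : ∀ v → v ≢ 𝟎 → ⟪ v , v ⟫ ≡ 0# → normalise v ∈ isotropicPoints
  isotropicPoints⁺ v v≢𝟎 vv≡0 = ∈-filter⁺ isotropic? (normalise-∈ v v≢𝟎)
    (let a , a≢0 , eq = normalise-multiple v in trans (cong₂ ⟪_,_⟫ eq eq) (trans (h-scale a a≢0 v v) vv≡0))

-- Each clique comes with its later common neighbours, so that one traversal both
-- counts the k-cliques and shows that there are no cliques of size k + 1.
module _ {A : Set} {R : Rel A 0ℓ} (R? : Decidable R) where

  extensions : ℕ → List A → List (List A × List A)
  extensions zero    xs       = ([] , xs) ∷ []
  extensions (suc k) []       = []
  extensions (suc k) (x ∷ xs) = List.map (map₁ (x ∷_)) (extensions k (filter (R? x) xs)) ++ extensions (suc k) xs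

  map-proj₁-extensions : ∀ k xs → List.map proj₁ (extensions k xs) ≡ cliques R? k xs
  map-proj₁-extensions zero    xs       = refl
  map-proj₁-extensions (suc k) []       = refl
  map-proj₁-extensions (suc k) (x ∷ xs) = begin
    List.map proj₁ (List.map (map₁ (x ∷_)) E ++ extensions (suc k) xs)
      ≡⟨ List.map-++ proj₁ (List.map (map₁ (x ∷_)) E) (extensions (suc k) xs) ⟩
    List.map proj₁ (List.map (map₁ (x ∷_)) E) ++ List.map proj₁ (extensions (suc k) xs)
      ≡⟨ cong₂ _++_ (trans (sym (List.map-∘ E)) (List.map-∘ E)) (map-proj₁-extensions (suc k) xs) ⟩
    List.map (x ∷_) (List.map proj₁ E) ++ cliques R? (suc k) xs
      ≡⟨ cong (λ ls → List.map (x ∷_) ls ++ cliques R? (suc k) xs) (map-proj₁-extensions k (filter (R? x) xs)) ⟩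
    List.map (x ∷_) (cliques R? k (filter (R? x) xs)) ++ cliques R? (suc k) xs ∎
    where
    open ≡-Reasoning
    E : List (List A × List A)
    E = extensions k (filter (R? x) xs)

  no-extensions : ∀ k xs → All (λ e → proj₂ e ≡ []) (extensions k xs) → cliques R? (suc k) xs ≡ []
  no-extensions zero    .[]      (refl ∷ []) = refl
  no-extensions (suc k) []       none = refl
  no-extensions (suc k) (x ∷ xs) none = cong₂ (λ ls ms → List.map (x ∷_) ls ++ ms)
    (no-extensions k (filter (R? x) xs) (All.map⁻ (All.++⁻ˡ _ none)))
    (no-extensions (suc k) xs (All.++⁻ʳ (List.map (map₁ (x ∷_)) (extensions k (filter (R? x) xs))) none))

-- Codes of ovoids and evaluation of the counts

open DecMembership ℕ._≟_ using (_∈?_)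

common : List (List ℕ) → List ℕ
common []         = []
common (ns ∷ nss) = filter (λ n → All.all? (n ∈?_) nss) ns

-- The codes of the points of an ovoid and of its quadrangle.
Codes : Set
Codes = List ℕ × List ℕ

Adjacent : Rel Codes 0ℓ
Adjacent x y = length (common (proj₁ x ∷ proj₁ y ∷ [])) ≡ 1 × length (common (proj₂ x ∷ proj₂ y ∷ [])) ≡ 6

adjacent? : Decidable Adjacent
adjacent? x y = (_ ℕ.≟ _) ×-dec (_ ℕ.≟ _)

_≟ₓ_ : DecidableEquality Codes
_≟ₓ_ = Product.≡-dec (List.≡-dec ℕ._≟_) (List.≡-dec ℕ._≟_)

codes : List V → List ℕ
codes xs = deduplicate ℕ._≟_ (List.map pointCode xs)

codesOf : List V → Codes
codesOf bs = codes bs , codes (quadrangle bs)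

meet : List Codes → ℕ
meet l = length (common (List.map proj₂ l))

-- The set of codes as a binary numeral, independent of the order of the list.
bitmask : Codes → ℕ
bitmask x = sum (List.map (2 ℕ.^_) (proj₁ x))

-- The list es is an argument so that it is evaluated only once.
counts? : (es : List (List Codes × List Codes)) →
          Dec (length (filter (λ l → meet l ℕ.≟ 6) (List.map proj₁ es)) ≡ 1440 ×
               length (filter (λ l → meet l ℕ.≟ 2) (List.map proj₁ es)) ≡ 4320 ×
               All (λ e → proj₂ e ≡ []) es)
counts? es = (_ ℕ.≟ _) ×-dec ((_ ℕ.≟ _) ×-dec All.all? (λ e → empty? (proj₂ e)) es)
  where
  empty? : (xs : List Codes) → Dec (xs ≡ [])
  empty? []       = yes refl
  empty? (x ∷ xs) = no λ ()

opaque
  unfolding isotropicPoints quadrangle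

  vertices : List Codes
  vertices = List.map codesOf (frames isotropicPoints)

  vertices⁻ : ∀ {x} → x ∈ vertices → ∃ λ l → l ∈ frames isotropicPoints × x ≡ codesOf l
  vertices⁻ = ∈-map⁻ codesOf {xs = frames isotropicPoints}

  vertices⁺ : ∀ {l} → l ∈ frames isotropicPoints → codesOf l ∈ vertices
  vertices⁺ = ∈-map⁺ codesOf {xs = frames isotropicPoints}

  -- A `bitmask` sees only the ovoid and not its quadrangle. So the ovoid alone identifies an entry
  -- of `vertices`, and with it the quadrangle.
  bitmasks-unique : Unique (List.map bitmask vertices)
  bitmasks-unique = decide (unique? ℕ._≟_ (List.map bitmask vertices))

  triangle-counts : length (filter (λ l → meet l ℕ.≟ 6) (List.map proj₁ (extensions adjacent? 3 vertices))) ≡ 1440 ×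
                    length (filter (λ l → meet l ℕ.≟ 2) (List.map proj₁ (extensions adjacent? 3 vertices))) ≡ 4320 ×
                    All (λ e → proj₂ e ≡ []) (extensions adjacent? 3 vertices)
  triangle-counts = decide (counts? (extensions adjacent? 3 vertices))

triangle-count : ℕ → ℕ → Set
triangle-count n N = length (filter (λ l → meet l ℕ.≟ n) (cliques adjacent? 3 vertices)) ≡ N

triangle-count-6 : triangle-count 6 1440
triangle-count-6 = subst (λ ls → length (filter (λ l → meet l ℕ.≟ 6) ls) ≡ 1440)
  (map-proj₁-extensions adjacent? 3 vertices) (proj₁ triangle-counts)

triangle-count-2 : triangle-count 2 4320
triangle-count-2 = subst (λ ls → length (filter (λ l → meet l ℕ.≟ 2) ls) ≡ 4320)
  (map-proj₁-extensions adjacent? 3 vertices) (proj₁ (proj₂ triangle-counts))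

no-4-cliques : cliques adjacent? 4 vertices ≡ []
no-4-cliques = no-extensions adjacent? 3 vertices (proj₂ (proj₂ triangle-counts))

vertices-unique : Unique vertices
vertices-unique = AllPairs.map (λ ne eq → ne (cong bitmask eq)) (AllPairs.map⁻ bitmasks-unique)

bitmask-injective : ∀ {x y} → x ∈ vertices → y ∈ vertices → bitmask x ≡ bitmask y → x ≡ y
bitmask-injective {x} {y} x∈ y∈ eq with x ≟ₓ y
... | yes x≡y = x≡y
... | no x≢y = contradiction eq (pairs⇒related (λ ne → ne ∘ sym) (AllPairs.map⁻ bitmasks-unique) x∈ y∈ x≢y)

members : ∀ {n} → Subset n → List (Fin n)
members []            = []
members (inside ∷ p)  = zero ∷ List.map suc (members p)
members (outside ∷ p) = List.map suc (members p)

length-members : ∀ {n} (p : Subset n) → length (members p) ≡ ∣ p ∣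
length-members []            = refl
length-members (inside ∷ p)  = cong suc (trans (List.length-map suc (members p)) (length-members p))
length-members (outside ∷ p) = trans (List.length-map suc (members p)) (length-members p)

∈-members⁺ : ∀ {n} {p : Subset n} {i} → i Subset.∈ p → i ∈ members p
∈-members⁺ {p = inside ∷ p}  Vec.here       = here refl
∈-members⁺ {p = inside ∷ p}  (Vec.there i∈) = there (∈-map⁺ suc (∈-members⁺ i∈))
∈-members⁺ {p = outside ∷ p} (Vec.there i∈) = ∈-map⁺ suc (∈-members⁺ i∈)

∈-members⁻ : ∀ {n} (p : Subset n) {i} → i ∈ members p → i Subset.∈ p
∈-members⁻ (inside ∷ p)  (here refl) = Vec.here
∈-members⁻ (inside ∷ p)  (there i∈) with ∈-map⁻ suc i∈
... | j , j∈ , refl = Vec.there (∈-members⁻ p j∈)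
∈-members⁻ (outside ∷ p) i∈ with ∈-map⁻ suc i∈
... | j , j∈ , refl = Vec.there (∈-members⁻ p j∈)

members-unique : ∀ {n} (p : Subset n) → Unique (members p)
members-unique []            = []
members-unique (inside ∷ p)  = All.map⁺ (All.tabulate λ _ ()) ∷ Unique.map⁺ Fin.suc-injective (members-unique p)
members-unique (outside ∷ p) = Unique.map⁺ Fin.suc-injective (members-unique p)

-- Transfer of the counts to `Γ`

module Counting (h : S₄.Form) (hermitian : IsHermitian h) (nondegenerate : S₄.Nondegenerate h)
                (β : Vec V 4) (orthonormal : Hermitian.Orthonormal h hermitian β) where
  open Model h hermitian β orthonormal
  open Hermitian h hermitian using (coordinates-⊕; coordinates-·)
  open Γ h using (OvoidOf; Vertex; IsClique; IsMaximalClique; TripleMeetingIn; MaximalCliquesMeetingIn)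

  opaque
    withCodes : List ℕ → PointSet
    withCodes ns = Vec.tabulate λ P → does (γ P ∈? ns)

    ∈-withCodes : ∀ ns P → P Subset.∈ withCodes ns ⇔ γ P ∈ ns
    ∈-withCodes ns P = mk⇔
      (λ P∈ → does⇒ (γ P ∈? ns) (trans (sym (Vec.lookup∘tabulate member P)) (Vec.[]=⇒lookup P∈)))
      (λ γP∈ → Vec.lookup⇒[]= P (withCodes ns) (trans (Vec.lookup∘tabulate member P) (dec-true (γ P ∈? ns) γP∈)))
      where
      member : Point → Bool
      member P = does (γ P ∈? ns)
      does⇒ : ∀ {A : Set} (a? : Dec A) → does a? ≡ true → A
      does⇒ (yes a) _ = a

  toE toW : Codes → PointSet
  toE = withCodes ∘ proj₁
  toW = withCodes ∘ proj₂

  extensionality : ∀ {A B : PointSet} → (∀ P → P Subset.∈ A ⇔ P Subset.∈ B) → A ≡ B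
  extensionality eq = Subset.⊆-antisym (λ {P} → Equivalence.to (eq P)) (λ {P} → Equivalence.from (eq P))

  -- The two conditions under which the length of a list is the size of the point set that it
  -- encodes: nothing is counted twice, and every entry comes from a point.
  Valid : List ℕ → Set
  Valid ns = Unique ns × (∀ {n} → n ∈ ns → ∃ λ P → γ P ≡ n)

  ∣∣≡length : ∀ {A ns} → Valid ns → (∀ P → P Subset.∈ A ⇔ γ P ∈ ns) → ∣ A ∣ ≡ length ns
  ∣∣≡length {A} {ns} (unique , valid) eq = begin
    ∣ A ∣                          ≡⟨ length-members A ⟨
    length (members A)            ≡⟨ List.length-map γ (members A) ⟨
    length (List.map γ (members A))
      ≡⟨ same-length (Unique.map⁺ (λ {P} {Q} → γ-injective P Q) (members-unique A)) unique (mk⇔ to from) ⟩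
    length ns                      ∎
    where
    open ≡-Reasoning
    to : ∀ {n} → n ∈ List.map γ (members A) → n ∈ ns
    to n∈ with ∈-map⁻ γ n∈
    ... | P , P∈ , refl = Equivalence.to (eq P) (∈-members⁻ A P∈)
    from : ∀ {n} → n ∈ ns → n ∈ List.map γ (members A)
    from n∈ with valid n∈
    ... | P , refl = ∈-map⁺ γ (∈-members⁺ (Equivalence.from (eq P) n∈))

  ∣⋂∣≡length-common : ∀ {A ns nss} → Valid ns → (∀ P → P Subset.∈ A ⇔ (∀ {ms} → ms ∈ ns ∷ nss → γ P ∈ ms)) →
                      ∣ A ∣ ≡ length (common (ns ∷ nss))
  ∣⋂∣≡length-common {A} {ns} {nss} (unique , valid) eq =
    ∣∣≡length (Unique.filter⁺ common? unique , valid ∘ proj₁ ∘ ∈-filter⁻ common? {xs = ns}) λ P → mk⇔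
      (λ P∈ → ∈-filter⁺ common? (Equivalence.to (eq P) P∈ (here refl)) (All.tabulate (Equivalence.to (eq P) P∈ ∘ there)))
      (λ γP∈ → let γP∈ns , all = ∈-filter⁻ common? {xs = ns} γP∈
               in Equivalence.from (eq P) λ { (here refl) → γP∈ns ; (there ms∈) → All.lookup all ms∈ })
    where
    common? : ∀ n → Dec (All (n ∈_) nss)
    common? n = All.all? (n ∈?_) nss

  valid-codes : ∀ {xs} → (∀ {x} → x ∈ xs → x ≢ 𝟎) → Valid (codes xs)
  valid-codes {xs} nonzero = deduplicate-! ℕ._≟_ (List.map pointCode xs) , λ n∈ →
    let x , x∈ , eq = ∈-map⁻ pointCode (∈-deduplicate⁻ ℕ._≟_ (List.map pointCode xs) n∈)
        P , xP = point (φ⁻¹-nonzero (nonzero x∈))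
    in P , trans (sym (represents⇒γ (φ⁻¹ x) P xP)) (trans (cong pointCode (φ-φ⁻¹ x)) (sym eq))
    where
    φ⁻¹-nonzero : ∀ {x} → x ≢ 𝟎 → φ⁻¹ x ≢ 𝟎
    φ⁻¹-nonzero {x} x≢𝟎 eq = x≢𝟎 (trans (sym (φ-φ⁻¹ x)) (trans (cong φ eq) φ-𝟎))

  frame-of : ∀ {l} → l ∈ frames isotropicPoints → IsFrame ⟪_,_⟫ l
  frame-of = frames-sound isotropicPoints (λ {q} q∈ → proj₂ (isotropicPoints⁻ q q∈))

  valid-E : ∀ {x} → x ∈ vertices → Valid (proj₁ x)
  valid-E x∈ with vertices⁻ x∈
  ... | l , l∈ , refl = valid-codes (frame-nonzero ⟪_,_⟫ ⟪⟫-hermitian (frame-of l∈))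

  valid-W : ∀ {x} → x ∈ vertices → Valid (proj₂ x)
  valid-W x∈ with vertices⁻ x∈
  ... | l , l∈ , refl = valid-codes (quadrangle-nonzero ⟪_,_⟫ ⟪⟫-hermitian (frame-of l∈))

  -- Equal point sets have codes with the same entries, but perhaps in different orders. A sum over
  -- the entries is the same for both, and distinct vertices have distinct bitmasks.
  toE-injective : ∀ {x y} → x ∈ vertices → y ∈ vertices → toE x ≡ toE y → x ≡ y
  toE-injective {x} {y} x∈ y∈ eq = bitmask-injective x∈ y∈
    (sum-↭ (↭.map⁺ (2 ℕ.^_) (∼bag⇒↭ (unique∧set⇒bag (proj₁ (valid-E x∈)) (proj₁ (valid-E y∈))
      (mk⇔ (transport x y x∈ eq) (transport y x y∈ (sym eq)))))))
    where
    transport : ∀ x y → x ∈ vertices → toE x ≡ toE y → ∀ {n} → n ∈ proj₁ x → n ∈ proj₁ y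
    transport x y x∈ eq n∈ with proj₂ (valid-E x∈) n∈
    ... | P , refl = Equivalence.to (∈-withCodes (proj₁ y) P)
      (subst (P Subset.∈_) eq (Equivalence.from (∈-withCodes (proj₁ x) P) n∈))

  _∝_ : List V → List V → Set
  xs ∝ ys = ∃ λ a → a ≢ 0# × xs ∼[ set ] List.map (a ·_) ys

  spanned⇔codes : ∀ xs ys → xs ∝ List.map φ ys →
                  ∀ P → Spanned ys P ⇔ γ P ∈ codes xs
  spanned⇔codes xs ys (a , a≢0 , xs∼) P = mk⇔ to from
    where
    to : Spanned ys P → γ P ∈ codes xs
    to (y , y∈ , yP) = ∈-deduplicate⁺ ℕ._≟_ (subst (_∈ List.map pointCode xs)
      (trans (pointCode-· a≢0 (φ y)) (represents⇒γ y P yP))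
      (∈-map⁺ pointCode (Equivalence.from xs∼ (∈-map⁺ (a ·_) (∈-map⁺ φ y∈)))))
    from : γ P ∈ codes xs → Spanned ys P
    from γP∈ =
      let x , x∈ , eq = ∈-map⁻ pointCode (∈-deduplicate⁻ ℕ._≟_ (List.map pointCode xs) γP∈)
          c , c∈ , eq′ = ∈-map⁻ (a ·_) (Equivalence.to xs∼ x∈)
          y , y∈ , eq″ = ∈-map⁻ φ c∈
      in y , y∈ , γ⇒represents y P (trans (cong pointCode (sym eq″))
           (trans (sym (pointCode-· a≢0 c)) (trans (cong pointCode (sym eq′)) (sym eq))))

  quadrangle-map : ∀ (f : V → V) → (∀ x y → f (x ⊕ y) ≡ f x ⊕ f y) → (∀ {x y} → f x ≡ f y → x ≡ y) →
                   ∀ ys → quadrangle (List.map f ys) ∼[ set ] List.map f (quadrangle ys)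
  quadrangle-map f f-⊕ f-injective ys = mk⇔ to from
    where
    to : ∀ {x} → x ∈ quadrangle (List.map f ys) → x ∈ List.map f (quadrangle ys)
    to x∈ with ∈-quadrangle⁻ x∈
    ... | inj₁ x∈′ = let y , y∈ , eq = ∈-map⁻ f x∈′ in subst (_∈ _) (sym eq) (∈-map⁺ f (∈-quadrangle⁺ (inj₁ y∈)))
    ... | inj₂ (u , v , u∈ , v∈ , u≢v , refl) with ∈-map⁻ f u∈ | ∈-map⁻ f v∈
    ...   | y , y∈ , refl | z , z∈ , refl =
      subst (_∈ _) (f-⊕ y z) (∈-map⁺ f (∈-quadrangle⁺ (inj₂ (y , z , y∈ , z∈ , (λ { refl → u≢v refl }) , refl))))
    from : ∀ {x} → x ∈ List.map f (quadrangle ys) → x ∈ quadrangle (List.map f ys)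
    from x∈ with ∈-map⁻ f x∈
    ... | y , y∈ , refl with ∈-quadrangle⁻ y∈
    ...   | inj₁ y∈′ = ∈-quadrangle⁺ (inj₁ (∈-map⁺ f y∈′))
    ...   | inj₂ (u , v , u∈ , v∈ , u≢v , refl) =
      ∈-quadrangle⁺ (inj₂ (f u , f v , ∈-map⁺ f u∈ , ∈-map⁺ f v∈ , u≢v ∘ f-injective , f-⊕ u v))

  quadrangle-cong : ∀ {xs ys} → xs ∼[ set ] ys → quadrangle xs ∼[ set ] quadrangle ys
  quadrangle-cong eq = mk⇔ (⊆ (Equivalence.to eq)) (⊆ (Equivalence.from eq))
    where
    ⊆ : ∀ {xs ys} → (∀ {x} → x ∈ xs → x ∈ ys) → ∀ {x} → x ∈ quadrangle xs → x ∈ quadrangle ys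
    ⊆ sub x∈ with ∈-quadrangle⁻ x∈
    ... | inj₁ x∈′ = ∈-quadrangle⁺ (inj₁ (sub x∈′))
    ... | inj₂ (y , z , y∈ , z∈ , rest) = ∈-quadrangle⁺ (inj₂ (y , z , sub y∈ , sub z∈ , rest))

  map-cong-∼ : ∀ (f : V → V) {xs ys} → xs ∼[ set ] ys → List.map f xs ∼[ set ] List.map f ys
  map-cong-∼ f eq = mk⇔ (⊆ (Equivalence.to eq)) (⊆ (Equivalence.from eq))
    where
    ⊆ : ∀ {xs ys} → (∀ {x} → x ∈ xs → x ∈ ys) → ∀ {x} → x ∈ List.map f xs → x ∈ List.map f ys
    ⊆ sub x∈ with ∈-map⁻ f x∈
    ... | y , y∈ , refl = ∈-map⁺ f (sub y∈)

  quadrangle-∝ : ∀ {l bs} → l ∝ List.map φ bs →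
                      quadrangle l ∝ List.map φ (quadrangle bs)
  quadrangle-∝ {l} {bs} (a , a≢0 , eq) = a , a≢0 ,
    map-cong-∼ (a ·_) (quadrangle-map φ (coordinates-⊕ β) φ-injective bs)
    ⇔-∘ (quadrangle-map (a ·_) (·-distribˡ a) (·-injective a≢0) (List.map φ bs)
    ⇔-∘ quadrangle-cong eq)

  spanned⇔withCodes : ∀ {ns A} {B : Pred Point 0ℓ} → (∀ P → B P ⇔ γ P ∈ ns) → (Subset._∈ A) ≐ B → A ≡ withCodes ns
  spanned⇔withCodes {ns} eq (⊆ , ⊇) = extensionality λ P → mk⇔
    (λ P∈ → Equivalence.from (∈-withCodes ns P) (Equivalence.to (eq P) (⊆ P∈)))
    (λ P∈ → ⊇ (Equivalence.from (eq P) (Equivalence.to (∈-withCodes ns P) P∈)))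

  opaque
    -- The ovoid yields a frame of `h`, which `φ` carries to a frame of the standard form, and that
    -- is a scalar multiple of a listed one up to order. Scalars do not move points, so the codes of
    -- the listed frame describe `E` and `W`.
    ovoid⁻ : ∀ {E W} → OvoidOf E W → ∃ λ x → x ∈ vertices × E ≡ toE x × W ≡ toW x
    ovoid⁻ {E} {W} ovoid =
      let bs , frame , E≐ , W≐ = ovoid⇒frame h hermitian nondegenerate ovoid
          model = model-frame frame
          l , l∈ , l∝bs = frames-complete isotropicPoints isotropicPoints-unique
            (λ {q} q∈ → proj₁ (isotropicPoints⁻ q q∈)) model
            λ {b} b∈ → isotropicPoints⁺ b (frame-nonzero ⟪_,_⟫ ⟪⟫-hermitian model b∈) (IsFrame.isotropic model b∈)
      in codesOf l , vertices⁺ l∈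
       , spanned⇔withCodes (spanned⇔codes l bs l∝bs) E≐
       , spanned⇔withCodes (spanned⇔codes (quadrangle l) (quadrangle bs) (quadrangle-∝ l∝bs)) W≐
      where
      model-frame : ∀ {bs} → IsFrame h bs → IsFrame ⟪_,_⟫ (List.map φ bs)
      model-frame {bs} frame = record
        { five = trans (List.length-map φ bs) five
        ; unique = Unique.map⁺ φ-injective unique
        ; isotropic = λ x∈ → case ∈-map⁻ φ x∈ of λ { (v , v∈ , refl) → trans (φ-isometry v v) (isotropic v∈) }
        ; products = λ x∈ y∈ x≢y → case (∈-map⁻ φ x∈ , ∈-map⁻ φ y∈) of λ
            { ((u , u∈ , refl) , (v , v∈ , refl)) → trans (φ-isometry u v) (products u∈ v∈ λ { refl → x≢y refl }) }
        }
        where open IsFrame frame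

    ovoid⁺ : ∀ {x} → x ∈ vertices → OvoidOf (toE x) (toW x)
    ovoid⁺ x∈ with vertices⁻ x∈
    ... | l , l∈ , refl = frame⇒ovoid h hermitian nondegenerate
      (bs , frame , withCodes≐ (spanned⇔codes l bs l∝bs)
                  , withCodes≐ (spanned⇔codes (quadrangle l) (quadrangle bs) (quadrangle-∝ l∝bs)))
      where
      bs : List V
      bs = List.map φ⁻¹ l
      open IsFrame (frame-of l∈)
      φ-bs : List.map φ bs ≡ l
      φ-bs = trans (sym (List.map-∘ l)) (trans (List.map-cong φ-φ⁻¹ l) (List.map-id l))
      l∝bs : l ∝ List.map φ bs
      l∝bs = 1# , 1≢0 , λ {x} → subst (λ k → x ∈ l ⇔ x ∈ k)
        (sym (trans (cong (List.map (1# ·_)) φ-bs) (trans (List.map-cong ·-identity l) (List.map-id l)))) (mk⇔ id id)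
      frame : IsFrame h bs
      frame = record
        { five = trans (List.length-map φ⁻¹ l) five
        ; unique = Unique.map⁺ (λ {x} {y} eq → trans (sym (φ-φ⁻¹ x)) (trans (cong φ eq) (φ-φ⁻¹ y))) unique
        ; isotropic = λ x∈ → case ∈-map⁻ φ⁻¹ x∈ of λ { (v , v∈ , refl) → trans (φ⁻¹-isometry v v) (isotropic v∈) }
        ; products = λ x∈ y∈ x≢y → case (∈-map⁻ φ⁻¹ x∈ , ∈-map⁻ φ⁻¹ y∈) of λ
            { ((u , u∈ , refl) , (v , v∈ , refl)) → trans (φ⁻¹-isometry u v) (products u∈ v∈ λ { refl → x≢y refl }) }
        }
      withCodes≐ : ∀ {ns} {B : Pred Point 0ℓ} → (∀ P → B P ⇔ γ P ∈ ns) → (Subset._∈ withCodes ns) ≐ B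
      withCodes≐ {ns} eq = (λ {P} P∈ → Equivalence.from (eq P) (Equivalence.to (∈-withCodes ns P) P∈))
                         , (λ {P} BP → Equivalence.from (∈-withCodes ns P) (Equivalence.to (eq P) BP))

  ∈-toW : ∀ x P → P Subset.∈ toW x ⇔ γ P ∈ proj₂ x
  ∈-toW x = ∈-withCodes (proj₂ x)

  ∣∩∣≡length-common : ∀ {ns ms} → Valid ns → ∣ withCodes ns ∩ withCodes ms ∣ ≡ length (common (ns ∷ ms ∷ []))
  ∣∩∣≡length-common {ns} {ms} valid = ∣⋂∣≡length-common valid λ P → mk⇔
    (λ P∈ → let P∈ns , P∈ms = Subset.x∈p∩q⁻ (withCodes ns) (withCodes ms) P∈ in λ
      { (here refl)         → Equivalence.to (∈-withCodes ns P) P∈ns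
      ; (there (here refl)) → Equivalence.to (∈-withCodes ms P) P∈ms })
    (λ all → Subset.x∈p∩q⁺ ( Equivalence.from (∈-withCodes ns P) (all (here refl))
                           , Equivalence.from (∈-withCodes ms P) (all (there (here refl)))))

  ∣⋂∣≡meet : ∀ {A} x l → x ∈ vertices →
             (∀ P → P Subset.∈ A ⇔ (∀ {y} → y ∈ x ∷ l → P Subset.∈ toW y)) → ∣ A ∣ ≡ meet (x ∷ l)
  ∣⋂∣≡meet x l x∈ eq = ∣⋂∣≡length-common (valid-W x∈) λ P → mk⇔
    (λ P∈ {ms} ms∈ → case ∈-map⁻ proj₂ {xs = x ∷ l} ms∈ of λ
      { (y , y∈ , refl) → Equivalence.to (∈-toW y P) (Equivalence.to (eq P) P∈ y∈) })
    (λ all → Equivalence.from (eq P) λ {y} y∈ → Equivalence.from (∈-toW y P) (all (∈-map⁺ proj₂ y∈)))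

  adjacent⁺ : ∀ {x y} → x ∈ vertices → y ∈ vertices → Adjacent x y → Γ.Adjacent h (toE x) (toE y)
  adjacent⁺ {x} {y} x∈ y∈ (one , six) = toW x , toW y , ovoid⁺ x∈ , ovoid⁺ y∈
    , trans (∣∩∣≡length-common (valid-E x∈)) one , trans (∣∩∣≡length-common (valid-W x∈)) six

  -- `Γ.Adjacent` brings its own quadrangles. By injectivity of `toE` they can only be the computed
  -- ones, so the sizes in its definition are sizes of computed intersections.
  toW-unique : ∀ {x W} → x ∈ vertices → OvoidOf (toE x) W → W ≡ toW x
  toW-unique x∈ ovoid =
    let y , y∈ , E≡ , W≡ = ovoid⁻ ovoid in trans W≡ (cong toW (toE-injective y∈ x∈ (sym E≡)))

  adjacent⁻ : ∀ {x y} → x ∈ vertices → y ∈ vertices → Γ.Adjacent h (toE x) (toE y) → Adjacent x y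
  adjacent⁻ x∈ y∈ (W , W′ , ovoid , ovoid′ , one , six) =
      trans (sym (∣∩∣≡length-common (valid-E x∈))) one
    , trans (sym (∣∩∣≡length-common (valid-W x∈)))
        (trans (sym (cong₂ (λ A B → ∣ A ∩ B ∣) (toW-unique x∈ ovoid) (toW-unique y∈ ovoid′))) six)

  Γ-symmetric : Symmetric (Γ.Adjacent h)
  Γ-symmetric {E} {E′} (W , W′ , ovoid , ovoid′ , one , six) = W′ , W , ovoid′ , ovoid
    , trans (cong ∣_∣ (Subset.∩-comm E′ E)) one , trans (cong ∣_∣ (Subset.∩-comm W′ W)) six

  Clique : List Codes → Pred PointSet 0ℓ
  Clique l E = ∃ λ x → x ∈ l × toE x ≡ E

  module Triangle {l : List Codes} (l∈ : l ∈ cliques adjacent? 3 vertices) where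

    ⊆vertices : ∀ {x} → x ∈ l → x ∈ vertices
    ⊆vertices = lookup (proj₁ (proj₂ (cliques-sound adjacent? 3 vertices l∈)))

    l-unique : Unique l
    l-unique = AllPairs-resp-⊑ (proj₁ (proj₂ (cliques-sound adjacent? 3 vertices l∈))) vertices-unique
      where
      AllPairs-resp-⊑ : ∀ {xs ys : List Codes} → xs ⊑ ys → Unique ys → Unique xs
      AllPairs-resp-⊑ []         u        = u
      AllPairs-resp-⊑ (_ ∷ʳ s)   (_ ∷ u)  = AllPairs-resp-⊑ s u
      AllPairs-resp-⊑ (refl ∷ s) (y∉ ∷ u) = All.tabulate (λ x∈ → All.lookup y∉ (lookup s x∈)) ∷ AllPairs-resp-⊑ s u

    related : ∀ {x y} → x ∈ l → y ∈ l → x ≢ y → Γ.Adjacent h (toE x) (toE y)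
    -- `common` filters its first list, which hides the symmetry of `Adjacent`; in `Γ` it is
    -- commutativity of `∩`. The relation carries the membership hypotheses because `adjacent⁺` asks
    -- for them.
    related x∈ y∈ x≢y = pairs⇒related
      {R = λ x y → x ∈ vertices → y ∈ vertices → Γ.Adjacent h (toE x) (toE y)} (λ r y∈ x∈ → Γ-symmetric (r x∈ y∈))
      (AllPairs.map (λ r x∈ y∈ → adjacent⁺ x∈ y∈ r) (proj₂ (proj₂ (cliques-sound adjacent? 3 vertices l∈))))
      x∈ y∈ x≢y (⊆vertices x∈) (⊆vertices y∈)

    isClique : IsClique (Clique l)
    isClique = (λ { (x , x∈ , refl) → toW x , ovoid⁺ (⊆vertices x∈) })
             , λ { (x , x∈ , refl) (y , y∈ , refl) ne → related x∈ y∈ (λ { refl → ne refl }) }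

    isMaximalClique : IsMaximalClique (Clique l)
    isMaximalClique = isClique , λ {D} D-clique l⊆D {E} E∈D → member D-clique l⊆D (proj₁ D-clique E∈D) E∈D
      where
      member : ∀ {D E} → IsClique D → (∀ {E} → Clique l E → D E) → Vertex E → D E → Clique l E
      member {D} {E} (_ , D-adjacent) l⊆D (W , ovoid) E∈D with ovoid⁻ ovoid
      ... | v , v∈ , refl , _ with Any.any? (v ≟ₓ_) l
      ...   | yes v∈l = v , v∈l , refl
      ...   | no v∉l = contradiction (proj₁ (proj₂ 4-clique)) (none (proj₁ 4-clique))
        where
        ∈D : ∀ {x} → x ∈ v ∷ l → D (toE x)
        ∈D (here refl) = E∈D
        ∈D (there x∈)  = l⊆D (_ , x∈ , refl)
        ∈vertices : ∀ {x} → x ∈ v ∷ l → x ∈ vertices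
        ∈vertices (here refl) = v∈
        ∈vertices (there x∈)  = ⊆vertices x∈
        4-clique : ∃ λ l′ → l′ ∈ cliques adjacent? (length (v ∷ l)) vertices × l′ ∼[ set ] v ∷ l
        4-clique = cliques-of-set adjacent? _≟ₓ_ vertices-unique
          (All.tabulate (λ { x∈ refl → v∉l x∈ }) ∷ l-unique) ∈vertices
          λ x∈ y∈ x≢y → adjacent⁻ (∈vertices x∈) (∈vertices y∈)
            (D-adjacent (∈D x∈) (∈D y∈) (x≢y ∘ toE-injective (∈vertices x∈) (∈vertices y∈)))
        none : ∀ l′ → l′ ∉ cliques adjacent? (length (v ∷ l)) vertices
        none l′ l′∈ = case subst (l′ ∈_) no-4-cliques
          (subst (λ k → l′ ∈ cliques adjacent? (suc k) vertices)
            (proj₁ (cliques-sound adjacent? 3 vertices l∈)) l′∈) of λ ()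

  ∈-three : ∀ {A B C : PointSet} {x y z} → A ≡ toW x → B ≡ toW y → C ≡ toW z →
            ∀ P → P Subset.∈ A ∩ B ∩ C ⇔ (∀ {w} → w ∈ x ∷ y ∷ z ∷ [] → P Subset.∈ toW w)
  ∈-three {A} {B} {C} refl refl refl P = mk⇔
    (λ P∈ → let P∈A , P∈B∩C = Subset.x∈p∩q⁻ A (B ∩ C) P∈
                P∈B , P∈C = Subset.x∈p∩q⁻ B C P∈B∩C
            in λ { (here refl) → P∈A ; (there (here refl)) → P∈B ; (there (there (here refl))) → P∈C })
    (λ all → Subset.x∈p∩q⁺ (all (here refl) , Subset.x∈p∩q⁺ (all (there (here refl)) , all (there (there (here refl))))))

  tripleMeetingIn : ∀ {n} l → l ∈ cliques adjacent? 3 vertices → meet l ≡ n → TripleMeetingIn n (Clique l)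
  tripleMeetingIn l l∈ eq with proj₁ (cliques-sound adjacent? 3 vertices l∈)
  tripleMeetingIn (x ∷ y ∷ z ∷ []) l∈ eq | refl with Triangle.l-unique l∈
  ... | (x≢y ∷ x≢z ∷ []) ∷ (y≢z ∷ []) ∷ [] ∷ [] = record
    { E = toE x ; E′ = toE y ; E″ = toE z
    ; E≢E′ = x≢y ∘ toE-injective x∈ y∈
    ; E≢E″ = x≢z ∘ toE-injective x∈ z∈
    ; E′≢E″ = y≢z ∘ toE-injective y∈ z∈
    ; C≐ = (λ { (_ , here refl , refl) → inj₁ refl
              ; (_ , there (here refl) , refl) → inj₂ (inj₁ refl)
              ; (_ , there (there (here refl)) , refl) → inj₂ (inj₂ refl) })
         , (λ { (inj₁ refl) → x , here refl , refl
              ; (inj₂ (inj₁ refl)) → y , there (here refl) , refl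
              ; (inj₂ (inj₂ refl)) → z , there (there (here refl)) , refl })
    ; W = toW x ; W′ = toW y ; W″ = toW z
    ; E-ovoid = ovoid⁺ x∈ ; E′-ovoid = ovoid⁺ y∈ ; E″-ovoid = ovoid⁺ z∈
    ; meet = trans (∣⋂∣≡meet x (y ∷ z ∷ []) x∈ (∈-three refl refl refl)) eq
    }
    where
    x∈ : x ∈ vertices
    x∈ = Triangle.⊆vertices l∈ (here refl)
    y∈ : y ∈ vertices
    y∈ = Triangle.⊆vertices l∈ (there (here refl))
    z∈ : z ∈ vertices
    z∈ = Triangle.⊆vertices l∈ (there (there (here refl)))

  cardinality : ∀ {n N} → triangle-count n N → HasCardinality (MaximalCliquesMeetingIn n) N
  -- Matching on `refl` makes `N` the length of `triangles`, so `Fin N` indexes that list.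
  cardinality {n} refl = record
    { to = λ i → Clique (List.lookup triangles i) , Triangle.isMaximalClique (triangle i)
                 , tripleMeetingIn (List.lookup triangles i) (triangle i) (meets i)
    ; cong = λ { refl → id , id }
    ; bijective = (λ {i} {j} → injective i j) , surjective
    }
    where
    meets? : ∀ l → Dec (meet l ≡ n)
    meets? l = meet l ℕ.≟ n
    triangles : List (List Codes)
    triangles = filter meets? (cliques adjacent? 3 vertices)
    triangle : ∀ i → List.lookup triangles i ∈ cliques adjacent? 3 vertices
    triangle i = proj₁ (∈-filter⁻ meets? {xs = cliques adjacent? 3 vertices} (∈-lookup i))
    meets : ∀ i → meet (List.lookup triangles i) ≡ n
    meets i = proj₂ (∈-filter⁻ meets? {xs = cliques adjacent? 3 vertices} (∈-lookup i))
    triangles-unique : Unique triangles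
    triangles-unique = Unique.filter⁺ meets? (cliques-unique adjacent? 3 vertices vertices-unique)
    sublist : ∀ i → List.lookup triangles i ⊑ vertices
    sublist i = proj₁ (proj₂ (cliques-sound adjacent? 3 vertices (triangle i)))
    transport : ∀ i j → (∀ {E} → Clique (List.lookup triangles i) E → Clique (List.lookup triangles j) E) →
                ∀ {x} → x ∈ List.lookup triangles i → x ∈ List.lookup triangles j
    transport i j sub {x} x∈ =
      let y , y∈ , eq = sub (x , x∈ , refl)
      in subst (_∈ _) (toE-injective (lookup (sublist j) y∈) (lookup (sublist i) x∈) eq) y∈
    lookup-injective : ∀ {ls : List (List Codes)} → Unique ls → ∀ i j → List.lookup ls i ≡ List.lookup ls j → i ≡ j
    lookup-injective (l∉ ∷ u) zero    zero    eq = refl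
    lookup-injective (l∉ ∷ u) zero    (suc j) eq = contradiction eq (All.lookup l∉ (∈-lookup j))
    lookup-injective (l∉ ∷ u) (suc i) zero    eq = contradiction (sym eq) (All.lookup l∉ (∈-lookup i))
    lookup-injective (l∉ ∷ u) (suc i) (suc j) eq = cong suc (lookup-injective u i j eq)
    injective : ∀ i j → Clique (List.lookup triangles i) ≐ Clique (List.lookup triangles j) → i ≡ j
    injective i j (⊆ , ⊇) = lookup-injective triangles-unique i j
      (sublist-unique vertices-unique (sublist i) (sublist j) (mk⇔ (transport i j ⊆) (transport j i ⊇)))
    -- The three ovoids in `TripleMeetingIn` come in any order. `cliques-of-set` rearranges their
    -- codes into the order of `vertices`, and `meet-l` shows that the size of the triple
    -- intersection is unaffected.
    surjective : ∀ c → ∃ λ i → ∀ {j} → j ≡ i → Clique (List.lookup triangles j) ≐ proj₁ c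
    surjective (C , (clique , maximal) , triple) =
      index , λ { refl → subst (λ l → Clique l ≐ C) (Any.lookup-index l∈triangles) Clique≐C }
      where
      open TripleMeetingIn triple renaming (meet to ∣W∩W′∩W″∣)
      vertex : ∀ {E W} → OvoidOf E W → Codes
      vertex = proj₁ ∘ ovoid⁻
      x y z : Codes
      x = vertex E-ovoid
      y = vertex E′-ovoid
      z = vertex E″-ovoid
      E≡ : E ≡ toE x
      E≡ = proj₁ (proj₂ (proj₂ (ovoid⁻ E-ovoid)))
      E′≡ : E′ ≡ toE y
      E′≡ = proj₁ (proj₂ (proj₂ (ovoid⁻ E′-ovoid)))
      E″≡ : E″ ≡ toE z
      E″≡ = proj₁ (proj₂ (proj₂ (ovoid⁻ E″-ovoid)))
      W≡ : W ≡ toW x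
      W≡ = proj₂ (proj₂ (proj₂ (ovoid⁻ E-ovoid)))
      W′≡ : W′ ≡ toW y
      W′≡ = proj₂ (proj₂ (proj₂ (ovoid⁻ E′-ovoid)))
      W″≡ : W″ ≡ toW z
      W″≡ = proj₂ (proj₂ (proj₂ (ovoid⁻ E″-ovoid)))
      xyz : List Codes
      xyz = x ∷ y ∷ z ∷ []
      ∈vertices : ∀ {w} → w ∈ xyz → w ∈ vertices
      ∈vertices (here refl)                 = proj₁ (proj₂ (ovoid⁻ E-ovoid))
      ∈vertices (there (here refl))         = proj₁ (proj₂ (ovoid⁻ E′-ovoid))
      ∈vertices (there (there (here refl))) = proj₁ (proj₂ (ovoid⁻ E″-ovoid))
      ∈C : ∀ {w} → w ∈ xyz → C (toE w)
      ∈C (here refl)                 = proj₂ C≐ (inj₁ E≡)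
      ∈C (there (here refl))         = proj₂ C≐ (inj₂ (inj₁ E′≡))
      ∈C (there (there (here refl))) = proj₂ C≐ (inj₂ (inj₂ E″≡))
      xyz-unique : Unique xyz
      xyz-unique = ((λ eq → E≢E′ (trans E≡ (trans (cong toE eq) (sym E′≡))))
                   ∷ (λ eq → E≢E″ (trans E≡ (trans (cong toE eq) (sym E″≡)))) ∷ [])
                 ∷ ((λ eq → E′≢E″ (trans E′≡ (trans (cong toE eq) (sym E″≡)))) ∷ []) ∷ [] ∷ []
      clique-of : ∃ λ l → l ∈ cliques adjacent? 3 vertices × l ∼[ set ] xyz
      clique-of = cliques-of-set adjacent? _≟ₓ_ vertices-unique xyz-unique ∈vertices
        λ u∈ v∈ u≢v → adjacent⁻ (∈vertices u∈) (∈vertices v∈)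
          (proj₂ clique (∈C u∈) (∈C v∈) (u≢v ∘ toE-injective (∈vertices u∈) (∈vertices v∈)))
      l : List Codes
      l = proj₁ clique-of
      l∼xyz : l ∼[ set ] xyz
      l∼xyz = proj₂ (proj₂ clique-of)
      meet-l : ∀ l → l ∈ cliques adjacent? 3 vertices → l ∼[ set ] xyz → ∣ W ∩ W′ ∩ W″ ∣ ≡ meet l
      meet-l [] l∈ _ = case proj₁ (cliques-sound adjacent? 3 vertices l∈) of λ ()
      meet-l (w ∷ ws) l∈ l∼ = ∣⋂∣≡meet w ws (∈vertices (Equivalence.to l∼ (here refl))) λ P → mk⇔
        (λ P∈ {u} u∈ → Equivalence.to (∈-three W≡ W′≡ W″≡ P) P∈ (Equivalence.to l∼ u∈))
        (λ all → Equivalence.from (∈-three W≡ W′≡ W″≡ P) λ u∈ → all (Equivalence.from l∼ u∈))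
      l∈triangles : l ∈ triangles
      l∈triangles = ∈-filter⁺ meets? (proj₁ (proj₂ clique-of))
        (trans (sym (meet-l l (proj₁ (proj₂ clique-of)) l∼xyz)) ∣W∩W′∩W″∣)
      index : Fin (length triangles)
      index = Any.index l∈triangles
      Clique≐C : Clique l ≐ C
      Clique≐C = (λ { (w , w∈ , refl) → ∈C (Equivalence.to l∼xyz w∈) })
               , λ CE → case proj₁ C≐ CE of λ
                   { (inj₁ refl)        → x , Equivalence.from l∼xyz (here refl) , sym E≡
                   ; (inj₂ (inj₁ refl)) → y , Equivalence.from l∼xyz (there (here refl)) , sym E′≡
                   ; (inj₂ (inj₂ refl)) → z , Equivalence.from l∼xyz (there (there (here refl))) , sym E″≡ }

proposition4p2 : (h : S₄.Form) → IsHermitian h → S₄.Nondegenerate h →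
    HasCardinality (Γ.MaximalCliquesMeetingIn h 6) 1440 ×
    HasCardinality (Γ.MaximalCliquesMeetingIn h 2) 4320
proposition4p2 h hermitian nondegenerate = cardinality triangle-count-6 , cardinality triangle-count-2
  where
  basis : ∃ λ (β : Vec V 4) → Hermitian.Orthonormal h hermitian β
  basis = Hermitian.orthonormal-basis h hermitian nondegenerate
  open Counting h hermitian nondegenerate (proj₁ basis) (proj₂ basis)
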